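{- Let $b\geq 2$ be an even integer, and let $G$ be a connected graph of even order $n$ with minimum degree $\delta\geq 1$, where $$n\geq\max\left\{\frac{b^{2}\delta+2b\delta-\delta-1}{b-1},\ \frac{b^{2}\delta^{2}+(4b^{2}+5b)\delta+b^{2}+4b+1}{6b}\right\}.$$ If $$e(G)\geq e\bigl(K_{\delta}\vee(K_{n-(b+1)\delta}\cup b\delta K_1)\bigr),$$ then $G$ has an $H_b$-factor, unless $G=K_{\delta}\vee(K_{n-(b+1)\delta}\cup b\delta K_1)$.
   Context: All graphs are finite, undirected and simple. For a graph $G$, the order is $|V(G)|$, the size is $e(G)=|E(G)|$, and $d_G(v)$ denotes the degree of the vertex $v$ in $G$; the minimum degree of $G$ is $\delta=\delta(G)$. $K_m$ is the complete graph on $m$ vertices. For vertex-disjoint graphs $G_1,G_2$, $G_1\cup G_2$ is their (disjoint) union, and the join $G_1\vee G_2$ is obtained from $G_1\cup G_2$ by adding every possible edge between $V(G_1)$ and $V(G_2)$. $mK_1$ denotes the disjoint union of $m$ copies of $K_1$. Equality of graphs means equality up to isomorphism. For an even integer $b\geq 2$, an $H_b$-factor of $G$ is a spanning subgraph $F$ of $G$ such that $d_F(v)\in\{1,3,5,\ldots,b-1,b\}$ for every $v\in V(G)$ (that is, each $d_F(v)$ is either an odd integer between $1$ and $b-1$ or equal to $b$). -}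

module Defs where

open import Data.Bool using (Bool; true; false; T)
open import Data.Bool.Properties using (T?)
open import Data.Fin using (Fin; splitAt)
import Data.Fin as Fin
import Data.Fin.Properties as Fin
open import Data.Fin.Subset using (Subset; ∣_∣)
open import Data.Integer using (+_; 1ℤ)
import Data.Integer as ℤ
open import Data.List using (List; length; filter; cartesianProduct; allFin)
open import Data.Nat using (ℕ; zero; suc; _+_; _*_; _∸_; _^_; _≤_; s≤s)
open import Data.Nat.Divisibility using (_∣_)
open import Data.Product using (Σ; ∃; _×_; _,_)
open import Data.Rational.Unnormalised using (ℚᵘ; _/_; _⊔_)
open import Data.Sum using (_⊎_; inj₁; inj₂)
open import Data.Vec using (tabulate)
open import Function.Bundles using (_↔_; Inverse)
open import Relation.Binary.Construct.Closure.ReflexiveTransitive using (Star)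
open import Relation.Binary.PropositionalEquality using (_≡_; refl)
import Relation.Nullary.Decidable as Dec
open import Relation.Nullary using (¬_; yes; no)

-- Finite simple graphs of order n, on the vertex set Fin n.
record Graph (n : ℕ) : Set where
  field
    adj    : Fin n → Fin n → Bool
    sym    : ∀ u v → adj u v ≡ adj v u
    irrefl : ∀ v → adj v v ≡ false

  Adj : Fin n → Fin n → Set
  Adj u v = T (adj u v)

open Graph public

neighbours : ∀ {n} → Graph n → Fin n → Subset n
neighbours G v = tabulate (adj G v)

degree : ∀ {n} → Graph n → Fin n → ℕ
degree G v = ∣ neighbours G v ∣

-- Each edge {u , v} is listed once, as the pair with u < v.
edges : ∀ {n} → Graph n → List (Fin n × Fin n)
edges {n} G =
  filter (λ (u , v) → (u Fin.<? v) Dec.×-dec T? (adj G u v))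
         (cartesianProduct (allFin n) (allFin n))

e : ∀ {n} → Graph n → ℕ
e G = length (edges G)

-- Vacuously true for n = 0; a graph with a minimum degree has a vertex.
Connected : ∀ {n} → Graph n → Set
Connected G = ∀ u v → Star (Adj G) u v

IsMinDegree : ∀ {n} → Graph n → ℕ → Set
IsMinDegree G δ = (∀ v → δ ≤ degree G v) × ∃ λ v → degree G v ≡ δ

infix 4 _≅_

_≅_ : ∀ {m n} → Graph m → Graph n → Set
_≅_ {m} {n} G H =
  Σ (Fin m ↔ Fin n) λ f →
    ∀ u v → adj G u v ≡ adj H (Inverse.to f u) (Inverse.to f v)

K : ∀ m → Graph m
K m = record { adj = adjacent ; sym = symmetric ; irrefl = irreflexive }
  where
  adjacent : Fin m → Fin m → Bool
  adjacent u v with u Fin.≟ v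
  ... | yes _ = false
  ... | no  _ = true

  symmetric : ∀ u v → adjacent u v ≡ adjacent v u
  symmetric u v with u Fin.≟ v | v Fin.≟ u
  ... | yes _    | yes _    = refl
  ... | no  _    | no  _    = refl
  ... | yes refl | no  v≢v  with () ← v≢v refl
  ... | no  u≢u  | yes refl with () ← u≢u refl

  irreflexive : ∀ v → adjacent v v ≡ false
  irreflexive v with v Fin.≟ v
  ... | yes _   = refl
  ... | no  v≢v with () ← v≢v refl

-- The disjoint union of G and H, with every pair of vertices from different
-- parts adjacent or not according to c.
combine : ∀ {m n} → Bool → Graph m → Graph n → Graph (m + n)
combine {m} {n} c G H = record
  { adj    = λ u v → adjacent (splitAt m u) (splitAt m v)
  ; sym    = λ u v → symmetric (splitAt m u) (splitAt m v)
  ; irrefl = λ v → irreflexive (splitAt m v)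
  }
  where
  adjacent : Fin m ⊎ Fin n → Fin m ⊎ Fin n → Bool
  adjacent (inj₁ u) (inj₁ v) = adj G u v
  adjacent (inj₂ u) (inj₂ v) = adj H u v
  adjacent (inj₁ _) (inj₂ _) = c
  adjacent (inj₂ _) (inj₁ _) = c

  symmetric : ∀ x y → adjacent x y ≡ adjacent y x
  symmetric (inj₁ u) (inj₁ v) = sym G u v
  symmetric (inj₂ u) (inj₂ v) = sym H u v
  symmetric (inj₁ _) (inj₂ _) = refl
  symmetric (inj₂ _) (inj₁ _) = refl

  irreflexive : ∀ x → adjacent x x ≡ false
  irreflexive (inj₁ v) = irrefl G v
  irreflexive (inj₂ v) = irrefl H v

infixr 6 _∪_
infixr 5 _∨_

_∪_ : ∀ {m n} → Graph m → Graph n → Graph (m + n)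
_∪_ = combine false

_∨_ : ∀ {m n} → Graph m → Graph n → Graph (m + n)
_∨_ = combine true

copies : ∀ k {m} → Graph m → Graph (k * m)
copies zero    G = K 0
copies (suc k) G = G ∪ copies k G

infix 4 _⊆_

-- F is a spanning subgraph of G: both have vertex set Fin n.
_⊆_ : ∀ {n} → Graph n → Graph n → Set
F ⊆ G = ∀ u v → Adj F u v → Adj G u v

-- Membership in {1, 3, 5, …, b - 1, b}, for b even.
AllowedDegree : ℕ → ℕ → Set
AllowedDegree b d = (¬ (2 ∣ d) × 1 ≤ d × d ≤ b ∸ 1) ⊎ d ≡ b

HasHFactor : ∀ {n} → ℕ → Graph n → Set
HasHFactor {n} b G =
  Σ (Graph n) λ F → F ⊆ G × (∀ v → AllowedDegree b (degree F v))

-- Matching on b makes the denominators b - 1 and 6b visibly nonzero.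
threshold : (b δ : ℕ) → 2 ≤ b → ℚᵘ
threshold b@(suc (suc _)) δ (s≤s (s≤s _)) =
    ((+ (b ^ 2 * δ + 2 * b * δ) ℤ.- + δ ℤ.- 1ℤ) / (b ∸ 1))
  ⊔ (+ (b ^ 2 * δ ^ 2 + (4 * b ^ 2 + 5 * b) * δ + b ^ 2 + 4 * b + 1) / (6 * b))

-- The difference is truncated at 0, so this is the intended graph, of order n,
-- only when (b + 1) δ ≤ n.  That holds when δ ≥ 1 and n is at least the first
-- bound in threshold, as (b² δ + 2 b δ - δ - 1) - (b - 1)(b + 1) δ = 2 b δ - 1 > 0.
extremal : (n b δ : ℕ) → Graph (δ + ((n ∸ (b + 1) * δ) + b * δ * 1))
extremal n b δ = K δ ∨ (K (n ∸ (b + 1) * δ) ∪ copies (b * δ) (K 1))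

{-# OPTIONS --safe #-}
-- Call a colour class odd if the f-weights of its vertices add up to an odd number. The factor
-- comes from bounded-factor: if 0 < f ≤ g and, for every vertex set S, at most g(S) components of
-- G − S are odd, then some spanning subgraph has at each v a degree that is either at most f(v)
-- with the parity of f(v), or between f(v) and g(v). Here f = b − 1 and g = b. For g = f ≥ 0 one
-- inducts on the number of edges. If some S with f(S) > 0 has exactly f(S) odd components, take
-- S as large and its components as small as possible: a Hall-type theorem attaches the odd
-- components to S so that every s in S gets f(s) edges, and by maximality every component
-- satisfies the hypothesis again once the weight of its attached vertex is lowered by one.
-- Otherwise parity leaves a slack of two and an edge can be either deleted or taken. For
-- general g the same attachment works for S maximising the number of odd components minus f(S).
--
-- If there is no factor, some S with |S| = s leaves at least bs + 1 components, whose sizes are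
-- at least max(1, δ − s + 1). By convexity the edges are most numerous when all components but
-- one have that size, and comparing with the extremal graph forces s = δ and equality throughout.
--
-- Both alternatives of the conclusion are decidable by finite search, so the existence
-- arguments may be classical, that is, carried out under ¬ ¬.

module Submission where

open import Defs hiding (sym; edges; _∨_)
open import Data.Bool using (Bool; T; true; false; not; _∧_; _∨_; _xor_; if_then_else_)
import Data.Bool as Bool
open import Data.Bool.Properties using (∧-comm; ∨-comm; ∧-zeroʳ; ∧-identityʳ; T?)
open import Data.Empty using (⊥; ⊥-elim)
open import Data.Fin using (Fin; zero; suc; _↑ˡ_; _↑ʳ_)
import Data.Fin as Fin
import Data.Fin.Properties as Fin
open import Data.Fin.Subset using (∣_∣)
import Data.Integer as ℤ
import Data.Integer.Properties as ℤ
import Data.Integer.Tactic.RingSolver as ℤSolver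
open import Data.List using ([]; _∷_; length; filter; cartesianProduct)
import Data.List as List
open import Data.List.Properties using (filter-++; length-++)
open import Data.Nat hiding (_≟_; _⊔_; _/_)
import Data.Nat as ℕ
open import Data.Nat.DivMod using (%-distribˡ-+; m%n≤m; m%n<n; m<n⇒m%n≡m)
open import Data.Nat.Divisibility using (_∣_; _∣?_; ∣m⇒∣m*n; n∣m⇒m%n≡0)
open import Data.Nat.Properties hiding (_≟_)
open import Data.Nat.Tactic.RingSolver using (solve)
open import Data.Product using (Σ; ∃; ∃₂; _×_; _,_; proj₁; proj₂)
import Data.Rational.Unnormalised as ℚᵘ
import Data.Rational.Unnormalised.Properties as ℚᵘ
open import Data.Sum using (_⊎_; inj₁; inj₂)
import Data.Sum as Sum
open import Data.Unit using (tt)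
open import Data.Vec using (tabulate)
import Data.Vec.Functional as Vector
open import Function using (_∘_)
open import Function.Bundles using (mk↔ₛ′)
open import Relation.Binary.Construct.Closure.ReflexiveTransitive using (Star; ε; _◅_)
open import Relation.Binary.Definitions using (tri<; tri≈; tri>)
open import Relation.Binary.PropositionalEquality as ≡ using (_≡_; _≢_; refl; sym; trans; cong; cong₂; subst; subst₂)
open import Relation.Nullary using (¬_; ¬?; Dec; yes; no; does; contradiction)
open import Relation.Nullary.Decidable using (dec-true; dec-false; _×-dec_; _⊎-dec_; _→-dec_; map′; decidable-stable; ¬¬-excluded-middle)
open import Algebra.Properties.Semiring.Sum +-*-semiring using (sum-cong-≗; ∑-distrib-+; ∑-comm; *-distribˡ-sum; *-distribʳ-sum) renaming (sum to ∑)

-- Finite sums, parities and relations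

-- Components are never constructed: a colour class may be any union of them. Merging components
-- cannot raise the number of odd classes, so this does not strengthen the condition, while
-- refining, merging and cutting become operations on a colour function.
--
-- The obstacle in the induction is that the Hall-type theorem does not say which vertex of an odd
-- class gets attached to S, although the weight of exactly that vertex is lowered. The choice
-- matters only if some U inside the class leaves f(U) + 1 odd pieces. Moving U into S then costs no
-- excess, and maximality of `potential` yields f(U) = 0 and a single piece of positive mass, into
-- which every choice falls.
--
-- For f = b - 1, which is odd, a class is odd exactly if it has an odd number of vertices.
-- Connectedness and even order rule out an empty S. The two terms of `threshold` then serve the two
-- wrong sizes of S: with s = δ + r, r > 0, the extremal bound exceeds the class bound by b r (2n -
-- 1 - (b + 2)(2δ + r)), handled by the first term; with s = a + 1 and δ = s + d, d > 0, by b d (a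
-- (2n - X) + d + 1), where `second-bound` gives X ≤ 2n.

infix 8 _▹_
infix 4 _==_

-- An Iverson bracket times a weight, so that a sum over a subset stays a sum over all of `Fin n`.
_▹_ : Bool → ℕ → ℕ
true  ▹ w = w
false ▹ w = 0

weight : ∀ {n} → (Fin n → Bool) → (Fin n → ℕ) → ℕ
weight χ w = ∑ λ v → χ v ▹ w v

_==_ : ∀ {n} → Fin n → Fin n → Bool
i == j = does (i Fin.≟ j)

==-refl : ∀ {n} (i : Fin n) → (i == i) ≡ true
==-refl i = dec-true (i Fin.≟ i) refl

==⇒≡ : ∀ {n} {i j : Fin n} → (i == j) ≡ true → i ≡ j
==⇒≡ {i = i} {j} p with i Fin.≟ j
... | yes q = q

≡⇒== : ∀ {n} {i j : Fin n} → i ≡ j → (i == j) ≡ true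
≡⇒== {i = i} refl = ==-refl i

≢⇒== : ∀ {n} {i j : Fin n} → i ≢ j → (i == j) ≡ false
≢⇒== {i = i} {j} p = dec-false (i Fin.≟ j) p

==-sym : ∀ {n} (i j : Fin n) → (i == j) ≡ (j == i)
==-sym i j with i Fin.≟ j
... | yes refl = sym (==-refl i)
... | no  i≢j  = sym (≢⇒== (i≢j ∘ sym))

true≢false : true ≢ false
true≢false ()

∑-mono : ∀ {n} {f g : Fin n → ℕ} → (∀ v → f v ≤ g v) → ∑ f ≤ ∑ g
∑-mono {zero}  p = z≤n
∑-mono {suc n} p = +-mono-≤ (p zero) (∑-mono (p ∘ suc))

∑-zero : ∀ {n} {f : Fin n → ℕ} → (∀ v → f v ≡ 0) → ∑ f ≡ 0
∑-zero {zero}  p = refl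
∑-zero {suc n} p = cong₂ _+_ (p zero) (∑-zero (p ∘ suc))

∑-const : ∀ n c → ∑ {n} (λ _ → c) ≡ n * c
∑-const zero    c = refl
∑-const (suc n) c = cong (c +_) (∑-const n c)

∑-term : ∀ {n} (f : Fin n → ℕ) v → f v ≤ ∑ f
∑-term f zero    = m≤m+n _ _
∑-term f (suc v) = ≤-trans (∑-term (f ∘ suc) v) (m≤n+m _ _)

∑≤0⇒ : ∀ {n} (f : Fin n → ℕ) → ∑ f ≤ 0 → ∀ v → f v ≡ 0
∑≤0⇒ f p v = n≤0⇒n≡0 (≤-trans (∑-term f v) p)

∑-positive : ∀ {n} (f : Fin n → ℕ) → 0 < ∑ f → ∃ λ v → 0 < f v
∑-positive {suc n} f p with f zero in eq
... | suc _ = zero , subst (0 <_) (sym eq) (s≤s z≤n)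
... | zero  with ∑-positive (f ∘ suc) p
...   | v , q = suc v , q

-- Equality in the edge count is passed down to single vertices, pairs and classes by this lemma.
∑-rigid : ∀ {n} (f g : Fin n → ℕ) → (∀ v → f v ≤ g v) → ∑ g ≤ ∑ f → ∀ v → f v ≡ g v
∑-rigid f g p q zero    = ≤-antisym (p zero) (+-cancelʳ-≤ (∑ (f ∘ suc)) _ _
  (≤-trans (+-monoʳ-≤ (g zero) (∑-mono (p ∘ suc))) q))
∑-rigid f g p q (suc v) = ∑-rigid (f ∘ suc) (g ∘ suc) (p ∘ suc)
  (+-cancelˡ-≤ (f zero) _ _ (≤-trans (+-monoˡ-≤ _ (p zero)) q)) v

∑-delta : ∀ {n} (i : Fin n) (g : Fin n → ℕ) → ∑ (λ j → (i == j) ▹ g j) ≡ g i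
∑-delta zero    g = trans (cong (g zero +_) (∑-zero {f = λ j → (zero == suc j) ▹ g (suc j)} λ _ → refl)) (+-identityʳ _)
∑-delta (suc i) g = ∑-delta i (g ∘ suc)

∑-delta′ : ∀ {n} (i : Fin n) (g : Fin n → ℕ) → ∑ (λ j → (j == i) ▹ g j) ≡ g i
∑-delta′ i g = trans (sum-cong-≗ λ j → cong (_▹ g j) (==-sym j i)) (∑-delta i g)

∑-split : ∀ m {n} (f : Fin (m + n) → ℕ) →
          ∑ f ≡ ∑ (λ i → f (i ↑ˡ n)) + ∑ (λ j → f (m ↑ʳ j))
∑-split zero    f = refl
∑-split (suc m) f = trans (cong (f zero +_) (∑-split m (f ∘ suc))) (sym (+-assoc (f zero) _ _))

▹-distrib-+ : ∀ c a b → c ▹ (a + b) ≡ c ▹ a + c ▹ b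
▹-distrib-+ true  a b = refl
▹-distrib-+ false a b = refl

▹-∑ : ∀ {n} c (f : Fin n → ℕ) → c ▹ ∑ f ≡ ∑ (λ v → c ▹ f v)
▹-∑     true  f = refl
▹-∑ {n} false f = sym (∑-zero {n} λ _ → refl)

▹-≤ : ∀ c w → c ▹ w ≤ w
▹-≤ true  w = ≤-refl
▹-≤ false w = z≤n

▹-0 : ∀ c → c ▹ 0 ≡ 0
▹-0 true  = refl
▹-0 false = refl

▹-∧ : ∀ c d w → (c ∧ d) ▹ w ≡ c ▹ (d ▹ w)
▹-∧ true  d w = refl
▹-∧ false d w = refl

weight-cong : ∀ {n} {χ ψ : Fin n → Bool} (w : Fin n → ℕ) → (∀ v → χ v ≡ ψ v) → weight χ w ≡ weight ψ w
weight-cong w p = sum-cong-≗ λ v → cong (_▹ w v) (p v)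

weight-fibres : ∀ {n k} (κ : Fin n → Fin k) (w : Fin n → ℕ) →
                ∑ (λ i → weight (λ v → κ v == i) w) ≡ ∑ w
weight-fibres κ w = trans (∑-comm λ i v → (κ v == i) ▹ w v)
                          (sum-cong-≗ λ v → ∑-delta (κ v) λ _ → w v)

odd : ℕ → ℕ
odd n = n % 2

odd≤1 : ∀ n → odd n ≤ 1
odd≤1 n = s≤s⁻¹ (m%n<n n 2)

odd≤ : ∀ n → odd n ≤ n
odd≤ n = m%n≤m n 2

odd-+ : ∀ a b → odd (a + b) ≡ odd (odd a + odd b)
odd-+ a b = %-distribˡ-+ a b 2

odd-odd : ∀ a → odd (odd a) ≡ odd a
odd-odd a = m<n⇒m%n≡m (m%n<n a 2)

odd-+-cong : ∀ {a a′ b b′} → odd a ≡ odd a′ → odd b ≡ odd b′ → odd (a + b) ≡ odd (a′ + b′)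
odd-+-cong {a} {a′} {b} {b′} p q =
  trans (odd-+ a b) (trans (cong₂ (λ x y → odd (x + y)) p q) (sym (odd-+ a′ b′)))

odd-subadd : ∀ a b → odd (a + b) ≤ odd a + odd b
odd-subadd a b = ≤-trans (≤-reflexive (odd-+ a b)) (odd≤ _)

odd-double : ∀ a → odd (a + a) ≡ 0
odd-double a with odd a in eq | odd≤1 a
... | 0 | _ = trans (odd-+ a a) (cong (λ x → odd (x + x)) eq)
... | 1 | _ = trans (odd-+ a a) (cong (λ x → odd (x + x)) eq)
... | suc (suc _) | s≤s ()

odd-∑ : ∀ {n} (f : Fin n → ℕ) → odd (∑ (odd ∘ f)) ≡ odd (∑ f)
odd-∑ {zero}  f = refl
odd-∑ {suc n} f = odd-+-cong {odd (f zero)} {f zero} (odd-odd (f zero)) (odd-∑ (f ∘ suc))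

odd-∑≤ : ∀ {n} (f : Fin n → ℕ) → odd (∑ f) ≤ ∑ (odd ∘ f)
odd-∑≤ {zero}  f = z≤n
odd-∑≤ {suc n} f = ≤-trans (odd-subadd (f zero) _) (+-monoʳ-≤ _ (odd-∑≤ (f ∘ suc)))

odd-suc : ∀ a → odd a + odd (suc a) ≡ 1
odd-suc zero    = refl
odd-suc (suc a) = trans (cong (odd (suc a) +_) (odd-+ 2 a))
                        (trans (cong (odd (suc a) +_) (odd-odd a)) (trans (+-comm (odd (suc a)) _) (odd-suc a)))

even-gap : ∀ {a b} → odd (a + b) ≡ 0 → a < b → 2 + a ≤ b
even-gap {a} {b} p a<b = ≤∧≢⇒< a<b λ { refl →
  contradiction (trans (sym (odd-suc (a + a)))
    (cong₂ _+_ (odd-double a) (trans (cong odd (sym (+-suc a a))) p))) λ () }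

∑-strict : ∀ {n} {f g : Fin n → ℕ} → (∀ v → f v ≤ g v) → ∀ u → f u < g u → ∑ f < ∑ g
∑-strict {f = f} {g} p u q = ≰⇒> λ r → <-irrefl (∑-rigid f g p r u) q

▹-mono : ∀ {c d} → (c ≡ true → d ≡ true) → ∀ w → c ▹ w ≤ d ▹ w
▹-mono {true}  p w rewrite p refl = ≤-refl
▹-mono {false} p w = z≤n

Relation : ℕ → Set
Relation n = Fin n → Fin n → Bool

-- Ordered pairs are counted, hence every edge of a graph twice. The same number bounds the
-- recursions of `assignment` and `parity-factor`.
size : ∀ {n} → Relation n → ℕ
size E = ∑ λ x → ∑ λ y → E x y ▹ 1

size-strict : ∀ {n} {E E′ : Relation n} → (∀ x y → E′ x y ≡ true → E x y ≡ true) →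
              ∀ x y → E x y ≡ true → E′ x y ≡ false → size E′ < size E
size-strict p x y Exy E′xy = ∑-strict (λ x′ → ∑-mono λ y′ → ▹-mono (p x′ y′) 1) x
  (∑-strict (λ y′ → ▹-mono (p x y′) 1) y
    (subst (λ c → c ▹ 1 < _) (sym E′xy) (subst (λ c → 0 < c ▹ 1) (sym Exy) (s≤s z≤n))))

size-delta : ∀ {n} {E : Relation n} x y → (∀ x′ y′ → E x′ y′ ≡ (x′ == x) ∧ (y′ == y)) → size E ≡ 1
size-delta x y p = trans (sum-cong-≗ λ x′ → trans (sum-cong-≗ λ y′ → trans (cong (_▹ 1) (p x′ y′)) (▹-∧ (x′ == x) (y′ == y) 1))
                     (trans (sym (▹-∑ (x′ == x) λ y′ → (y′ == y) ▹ 1)) (cong ((x′ == x) ▹_) (∑-delta′ y λ _ → 1))))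
                   (∑-delta′ x λ _ → 1)

-- y − x = (b − a) + z, with both sides moved so that no subtraction occurs: a linear
-- inequality then follows from a sum a ≤ b of hypotheses by a semiring identity.
certify : ∀ {a b x y} z → a ≤ b → x + b + z ≡ y + a → x ≤ y
certify {a} {b} {x} {y} z a≤b eq = +-cancelʳ-≤ b x y (begin
  x + b      ≤⟨ m≤m+n _ z ⟩
  x + b + z  ≡⟨ eq ⟩
  y + a      ≤⟨ +-monoʳ-≤ y a≤b ⟩
  y + b      ∎)
  where open ≤-Reasoning

∧-elim : ∀ {a b} → a ∧ b ≡ true → a ≡ true × b ≡ true
∧-elim {true} {true} _ = refl , refl

∧-intro : ∀ {a b} → a ≡ true → b ≡ true → a ∧ b ≡ true
∧-intro refl refl = refl

∨-elim : ∀ {a b} → a ∨ b ≡ true → a ≡ true ⊎ b ≡ true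
∨-elim {true}  _ = inj₁ refl
∨-elim {false} p = inj₂ p

∨-intro : ∀ {a b} → a ≡ true ⊎ b ≡ true → a ∨ b ≡ true
∨-intro         (inj₁ refl) = refl
∨-intro {true}  (inj₂ refl) = refl
∨-intro {false} (inj₂ refl) = refl

not-elim : ∀ {a} → not a ≡ true → a ≡ false
not-elim {false} _ = refl

≢true⇒ : ∀ {a} → a ≢ true → a ≡ false
≢true⇒ {true}  p = contradiction refl p
≢true⇒ {false} p = refl

weight-+ : ∀ {m} (χ ψ : Fin m → Bool) (f : Fin m → ℕ) →
           weight χ f + weight ψ f ≡ ∑ λ v → χ v ▹ f v + ψ v ▹ f v
weight-+ χ ψ f = sym (∑-distrib-+ (λ v → χ v ▹ f v) _)

weight-∨∧ : ∀ {m} (χ ψ : Fin m → Bool) (f : Fin m → ℕ) →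
            weight χ f + weight ψ f ≡ weight (λ v → χ v ∨ ψ v) f + weight (λ v → χ v ∧ ψ v) f
weight-∨∧ χ ψ f = trans (weight-+ χ ψ f)
  (trans (sum-cong-≗ λ v → pt (χ v) (ψ v) (f v)) (sym (weight-+ (λ v → χ v ∨ ψ v) _ f)))
  where
  pt : ∀ a b x → a ▹ x + b ▹ x ≡ (a ∨ b) ▹ x + (a ∧ b) ▹ x
  pt true  b     x = refl
  pt false true  x = sym (+-identityʳ x)
  pt false false x = refl

weight-∖ : ∀ {m} (χ ψ : Fin m → Bool) (f : Fin m → ℕ) →
           weight χ f ≡ weight (λ v → χ v ∧ ψ v) f + weight (λ v → χ v ∧ not (ψ v)) f
weight-∖ χ ψ f = trans (sum-cong-≗ λ v → pt (χ v) (ψ v) (f v)) (sym (weight-+ (λ v → χ v ∧ ψ v) _ f))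
  where
  pt : ∀ a b x → a ▹ x ≡ (a ∧ b) ▹ x + (a ∧ not b) ▹ x
  pt true  true  x = sym (+-identityʳ x)
  pt true  false x = refl
  pt false _     x = refl

weight-insert : ∀ {m} (χ : Fin m → Bool) i (f : Fin m → ℕ) → χ i ≡ false →
                weight (λ v → χ v ∨ (v == i)) f ≡ weight χ f + f i
weight-insert χ i f χi = trans (sum-cong-≗ pt) (trans (∑-distrib-+ (λ v → χ v ▹ f v) _)
                                                (cong (weight χ f +_) (∑-delta′ i f)))
  where
  pt : ∀ v → (χ v ∨ (v == i)) ▹ f v ≡ χ v ▹ f v + (v == i) ▹ f v
  pt v with v Fin.≟ i
  ... | yes refl rewrite χi = refl
  ... | no  _    with χ v
  ...   | true  = sym (+-identityʳ _)
  ...   | false = refl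

weight-remove : ∀ {m} (χ : Fin m → Bool) i (f : Fin m → ℕ) → χ i ≡ true →
                weight χ f ≡ weight (λ v → χ v ∧ not (v == i)) f + f i
weight-remove χ i f χi = trans (sum-cong-≗ pt)
  (trans (∑-distrib-+ (λ v → (χ v ∧ not (v == i)) ▹ f v) _)
         (cong (weight (λ v → χ v ∧ not (v == i)) f +_) (∑-delta′ i f)))
  where
  pt : ∀ v → χ v ▹ f v ≡ (χ v ∧ not (v == i)) ▹ f v + (v == i) ▹ f v
  pt v with v Fin.≟ i
  ... | yes refl rewrite χi = refl
  ... | no  _    with χ v
  ...   | true  = sym (+-identityʳ _)
  ...   | false = refl


odd-cancel : ∀ a b → odd (a + b + b) ≡ odd a
odd-cancel a b = trans (cong odd (+-assoc a b b))
  (trans (odd-+-cong {a} {a} {b + b} {0} refl (odd-double b)) (cong odd (+-identityʳ a)))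

odd-flip : ∀ p q → odd (p + q) ≡ 0 → odd p ≡ 1 → odd q ≡ 1
odd-flip p q even p-odd with odd q in eq | odd≤1 q
... | 1 | _ = refl
... | suc (suc _) | s≤s ()
... | 0 | _ with () ← trans (sym even) (trans (odd-+ p q) (cong₂ (λ a b → odd (a + b)) p-odd eq))

odd-pred : ∀ {p q} → p ≡ q + 1 → odd p ≡ 1 → odd q ≡ 0
odd-pred {q = q} refl p-odd = +-cancelʳ-≡ 1 (odd q) 0
  (trans (cong (odd q +_) (sym (trans (cong odd (+-comm 1 q)) p-odd))) (odd-suc q))

T⇒≡ : ∀ {a} → T a → a ≡ true
T⇒≡ {true} _ = refl

≡⇒T : ∀ {a} → a ≡ true → T a
≡⇒T refl = tt

-- Hall-type assignment

delete : ∀ {n} → Fin n → Fin n → Relation n → Relation n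
delete x₀ y₀ E x y = E x y ∧ not ((x == x₀) ∧ (y == y₀))

delete-⊆ : ∀ {n} (x₀ y₀ : Fin n) E x y → delete x₀ y₀ E x y ≡ true → E x y ≡ true
delete-⊆ x₀ y₀ E x y p with E x y
... | true = refl

delete-self : ∀ {n} (x₀ y₀ : Fin n) E → delete x₀ y₀ E x₀ y₀ ≡ false
delete-self x₀ y₀ E rewrite ==-refl x₀ | ==-refl y₀ with E x₀ y₀
... | true  = refl
... | false = refl

delete-cases : ∀ {n} (x₀ y₀ : Fin n) E x y → E x y ≡ true →
               (x ≡ x₀ × y ≡ y₀) ⊎ delete x₀ y₀ E x y ≡ true
delete-cases x₀ y₀ E x y p with x Fin.≟ x₀ | y Fin.≟ y₀
... | yes q | yes r = inj₁ (q , r)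
... | yes q | no  r = inj₂ (cong (_∧ true) p)
... | no  q | _     = inj₂ (cong (_∧ true) p)

module Assignment {n k} (κ : Fin n → Fin k) (w : Fin k → ℕ) (ℓ u : Fin n → ℕ) (ℓ≤u : ∀ s → ℓ s ≤ u s) where

  -- E x s offers item κ x to agent s through x; agent s has to receive between ℓ s and u s
  -- items, and Upper and Lower are the corresponding Hall conditions.
  UpperClosed LowerClosed : Relation n → (Fin k → Bool) → (Fin n → Bool) → Set
  UpperClosed E C Y = ∀ x s → E x s ≡ true → C (κ x) ≡ true → Y s ≡ true
  LowerClosed E C Y = ∀ x s → E x s ≡ true → Y s ≡ true → C (κ x) ≡ true

  Upper Lower UpperViolated LowerViolated : Relation n → Set
  Upper E = ∀ C Y → UpperClosed E C Y → weight C w ≤ weight Y u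
  Lower E = ∀ C Y → LowerClosed E C Y → weight Y ℓ ≤ weight C w
  UpperViolated E = ∃₂ λ C Y → UpperClosed E C Y × weight Y u < weight C w
  LowerViolated E = ∃₂ λ C Y → LowerClosed E C Y × weight C w < weight Y ℓ

  module Uncrossing (E : Relation n) (upper : Upper E) (lower : Lower E)
                    (c : Fin k) (wc : w c ≡ 1) where

    -- A violation that appears only after the deletion has to involve the deleted edge: otherwise
    -- the pair is closed in `E` too, where `upper` holds.
    upper-facts : ∀ {x₁ s₁ C Y} → κ x₁ ≡ c → UpperClosed (delete x₁ s₁ E) C Y → weight Y u < weight C w →
                  C c ≡ true × Y s₁ ≡ false
    upper-facts {x₁} {s₁} {C} {Y} refl cl lt with C (κ x₁) in Cc | Y s₁ in Ys
    ... | true  | false = refl , refl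
    ... | false | _     = contradiction (upper C Y cl′) (<⇒≱ lt)
      where
      cl′ : UpperClosed E C Y
      cl′ x s Exs Cx with delete-cases x₁ s₁ E x s Exs
      ... | inj₁ (refl , refl) = contradiction (trans (sym Cx) Cc) true≢false
      ... | inj₂ E₁xs = cl x s E₁xs Cx
    ... | true | true = contradiction (upper C Y cl′) (<⇒≱ lt)
      where
      cl′ : UpperClosed E C Y
      cl′ x s Exs Cx with delete-cases x₁ s₁ E x s Exs
      ... | inj₁ (refl , refl) = Ys
      ... | inj₂ E₁xs = cl x s E₁xs Cx

    lower-facts : ∀ {x₁ s₁ C Y} → κ x₁ ≡ c → LowerClosed (delete x₁ s₁ E) C Y → weight C w < weight Y ℓ →
                  C c ≡ false × Y s₁ ≡ true
    lower-facts {x₁} {s₁} {C} {Y} refl cl lt with C (κ x₁) in Cc | Y s₁ in Ys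
    ... | false | true  = refl , refl
    ... | true  | _     = contradiction (lower C Y cl′) (<⇒≱ lt)
      where
      cl′ : LowerClosed E C Y
      cl′ x s Exs Yx with delete-cases x₁ s₁ E x s Exs
      ... | inj₁ (refl , refl) = Cc
      ... | inj₂ E₁xs = cl x s E₁xs Yx
    ... | false | false = contradiction (lower C Y cl′) (<⇒≱ lt)
      where
      cl′ : LowerClosed E C Y
      cl′ x s Exs Yx with delete-cases x₁ s₁ E x s Exs
      ... | inj₁ (refl , refl) = contradiction (trans (sym Yx) Ys) true≢false
      ... | inj₂ E₁xs = cl x s E₁xs Yx

    Edge : Fin n → Fin n → Fin n → Fin n → Set
    Edge x₁ s₁ x₂ s₂ = κ x₁ ≡ c × κ x₂ ≡ c × delete x₂ s₂ E x₁ s₁ ≡ true × delete x₁ s₁ E x₂ s₂ ≡ true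

    other-item : ∀ {x s} x₀ {s₀} → κ x₀ ≡ c → (κ x == c) ≡ false → E x s ≡ true → delete x₀ s₀ E x s ≡ true
    other-item {x} {s} x₀ {s₀} κx₀ κx Exs with delete-cases x₀ s₀ E x s Exs
    ... | inj₁ (refl , _) = contradiction (trans (sym (≡⇒== κx₀)) κx) true≢false
    ... | inj₂ p = p

    other-agent : ∀ {x s} x₀ {s₀} {Y : Fin n → Bool} → Y s₀ ≡ false → Y s ≡ true → E x s ≡ true →
                  delete x₀ s₀ E x s ≡ true
    other-agent {x} {s} x₀ {s₀} Ys₀ Ys Exs with delete-cases x₀ s₀ E x s Exs
    ... | inj₁ (_ , refl) = contradiction (trans (sym Ys) Ys₀) true≢false
    ... | inj₂ p = p

    -- Unions are closed in `E`, and so are intersections once `c` is dropped from the items. The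
    -- two strict inequalities give a surplus of two, and dropping `c` costs only `w c`, which is
    -- one.
    upper-upper : ∀ {x₁ s₁ x₂ s₂} → Edge x₁ s₁ x₂ s₂ →
                  UpperViolated (delete x₁ s₁ E) → UpperViolated (delete x₂ s₂ E) → ⊥
    upper-upper {x₁} {s₁} {x₂} {s₂} (κx₁ , κx₂ , E₂x₁ , E₁x₂) (C₁ , Y₁ , cl₁ , lt₁) (C₂ , Y₂ , cl₂ , lt₂) =
      1+n≰n (arith (weight-∨∧ Y₁ Y₂ u) (weight-∨∧ C₁ C₂ w) (weight-remove _ c w (∧-intro C₁c C₂c)) wc
             lt₁ lt₂ (upper _ _ cl∨) (upper _ _ cl∧))
      where
      C₁c = proj₁ (upper-facts κx₁ cl₁ lt₁)
      C₂c = proj₁ (upper-facts κx₂ cl₂ lt₂)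
      Y₁s₂ : Y₁ s₂ ≡ true
      Y₁s₂ = cl₁ x₂ s₂ E₁x₂ (subst (λ i → C₁ i ≡ true) (sym κx₂) C₁c)
      Y₂s₁ : Y₂ s₁ ≡ true
      Y₂s₁ = cl₂ x₁ s₁ E₂x₁ (subst (λ i → C₂ i ≡ true) (sym κx₁) C₂c)
      cl∨ : UpperClosed E (λ i → C₁ i ∨ C₂ i) (λ s → Y₁ s ∨ Y₂ s)
      cl∨ x s Exs C with ∨-elim {C₁ (κ x)} C
      ... | inj₁ C₁x with delete-cases x₁ s₁ E x s Exs
      ...   | inj₁ (refl , refl) = ∨-intro {Y₁ s} (inj₂ Y₂s₁)
      ...   | inj₂ p = ∨-intro (inj₁ (cl₁ x s p C₁x))
      cl∨ x s Exs C | inj₂ C₂x with delete-cases x₂ s₂ E x s Exs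
      ...   | inj₁ (refl , refl) = ∨-intro (inj₁ Y₁s₂)
      ...   | inj₂ p = ∨-intro {Y₁ s} (inj₂ (cl₂ x s p C₂x))
      cl∧ : UpperClosed E (λ i → (C₁ i ∧ C₂ i) ∧ not (i == c)) (λ s → Y₁ s ∧ Y₂ s)
      cl∧ x s Exs C with C₁₂x , x∉c ← ∧-elim {C₁ (κ x) ∧ C₂ (κ x)} C with C₁x , C₂x ← ∧-elim {C₁ (κ x)} C₁₂x =
        ∧-intro (cl₁ x s (other-item x₁ κx₁ (not-elim x∉c) Exs) C₁x)
                (cl₂ x s (other-item x₂ κx₂ (not-elim x∉c) Exs) C₂x)
      arith : ∀ {y₁ y₂ y∨ y∧ c₁ c₂ c∨ c∧ c∧′ z} → y₁ + y₂ ≡ y∨ + y∧ → c₁ + c₂ ≡ c∨ + c∧ → c∧ ≡ c∧′ + z → z ≡ 1 →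
              y₁ < c₁ → y₂ < c₂ → c∨ ≤ y∨ → c∧′ ≤ y∧ → suc (y₁ + y₂) ≤ y₁ + y₂
      arith {y₁} {y₂} {y∨} {y∧} {c₁} {c₂} {c∨} {c∧′ = c∧′} e₁ e₂ refl refl p q r t =
        certify 0 (+-mono-≤ (≤-reflexive e₂) (+-mono-≤ (≤-reflexive (sym e₁)) (+-mono-≤ p (+-mono-≤ q (+-mono-≤ r t)))))
          (solve (y₁ ∷ y₂ ∷ y∨ ∷ y∧ ∷ c₁ ∷ c₂ ∷ c∨ ∷ c∧′ ∷ []))

    -- Dual to `upper-upper`: both item sets miss `c`, so `c` is added to the union, again at a cost
    -- of one out of two.
    lower-lower : ∀ {x₁ s₁ x₂ s₂} → Edge x₁ s₁ x₂ s₂ →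
                  LowerViolated (delete x₁ s₁ E) → LowerViolated (delete x₂ s₂ E) → ⊥
    lower-lower {x₁} {s₁} {x₂} {s₂} (κx₁ , κx₂ , E₂x₁ , E₁x₂) (C₁ , Y₁ , cl₁ , lt₁) (C₂ , Y₂ , cl₂ , lt₂) =
      1+n≰n (arith (weight-∨∧ Y₁ Y₂ ℓ) (weight-∨∧ C₁ C₂ w)
                   (weight-insert _ c w (≢true⇒ λ p → C∌c (∨-elim {C₁ c} p))) wc
             lt₁ lt₂ (lower _ _ cl∨) (lower _ _ cl∧))
      where
      C₁c = proj₁ (lower-facts κx₁ cl₁ lt₁)
      C₂c = proj₁ (lower-facts κx₂ cl₂ lt₂)
      C∌c : ¬ (C₁ c ≡ true ⊎ C₂ c ≡ true)
      C∌c (inj₁ p) = true≢false (trans (sym p) C₁c)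
      C∌c (inj₂ p) = true≢false (trans (sym p) C₂c)
      Y₁s₂ : Y₁ s₂ ≡ false
      Y₁s₂ = ≢true⇒ λ p → C∌c (inj₁ (subst (λ i → C₁ i ≡ true) κx₂ (cl₁ x₂ s₂ E₁x₂ p)))
      Y₂s₁ : Y₂ s₁ ≡ false
      Y₂s₁ = ≢true⇒ λ p → C∌c (inj₂ (subst (λ i → C₂ i ≡ true) κx₁ (cl₂ x₁ s₁ E₂x₁ p)))
      cl∨ : LowerClosed E (λ i → (C₁ i ∨ C₂ i) ∨ (i == c)) (λ s → Y₁ s ∨ Y₂ s)
      cl∨ x s Exs Y with ∨-elim {Y₁ s} Y
      ... | inj₁ Y₁s with delete-cases x₁ s₁ E x s Exs
      ...   | inj₁ (refl , refl) = ∨-intro {C₁ (κ x) ∨ C₂ (κ x)} (inj₂ (≡⇒== κx₁))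
      ...   | inj₂ p = ∨-intro (inj₁ (∨-intro (inj₁ (cl₁ x s p Y₁s))))
      cl∨ x s Exs Y | inj₂ Y₂s with delete-cases x₂ s₂ E x s Exs
      ...   | inj₁ (refl , refl) = ∨-intro {C₁ (κ x) ∨ C₂ (κ x)} (inj₂ (≡⇒== κx₂))
      ...   | inj₂ p = ∨-intro (inj₁ (∨-intro {C₁ (κ x)} (inj₂ (cl₂ x s p Y₂s))))
      cl∧ : LowerClosed E (λ i → C₁ i ∧ C₂ i) (λ s → Y₁ s ∧ Y₂ s)
      cl∧ x s Exs Y with Y₁s , Y₂s ← ∧-elim {Y₁ s} Y =
        ∧-intro (cl₁ x s (other-agent x₁ {Y = Y₂} Y₂s₁ Y₂s Exs) Y₁s)
                (cl₂ x s (other-agent x₂ {Y = Y₁} Y₁s₂ Y₁s Exs) Y₂s)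
      arith : ∀ {y₁ y₂ y∨ y∧ c₁ c₂ c∨ c∧ c∨′ z} → y₁ + y₂ ≡ y∨ + y∧ → c₁ + c₂ ≡ c∨ + c∧ → c∨′ ≡ c∨ + z → z ≡ 1 →
              c₁ < y₁ → c₂ < y₂ → y∨ ≤ c∨′ → y∧ ≤ c∧ → suc (c₁ + c₂) ≤ c₁ + c₂
      arith {y₁} {y₂} {y∨} {y∧} {c₁} {c₂} {c∨} {c∧} e₁ e₂ refl refl p q r t =
        certify 0 (+-mono-≤ (≤-reflexive (sym e₂)) (+-mono-≤ (≤-reflexive e₁) (+-mono-≤ p (+-mono-≤ q (+-mono-≤ r t)))))
          (solve (y₁ ∷ y₂ ∷ y∨ ∷ y∧ ∷ c₁ ∷ c₂ ∷ c∨ ∷ c∧ ∷ []))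

    -- Differences replace union and intersection: the part of `C₁` outside `C₂`, without `c`, goes
    -- with the part of `Y₁` outside `Y₂`, and vice versa. Agents in both sets are compared by
    -- `ℓ≤u`.
    upper-lower : ∀ {x₁ s₁ x₂ s₂} → Edge x₁ s₁ x₂ s₂ →
                  UpperViolated (delete x₁ s₁ E) → LowerViolated (delete x₂ s₂ E) → ⊥
    upper-lower {x₁} {s₁} {x₂} {s₂} (κx₁ , κx₂ , E₂x₁ , E₁x₂) (C₁ , Y₁ , cl₁ , lt₁) (C₂ , Y₂ , cl₂ , lt₂) =
      1+n≰n (arith (weight-∖ Y₁ Y₂ u) (weight-∖ Y₂ Y₁ ℓ)
                   (∑-mono λ s → cap-mono (Y₁ s) (Y₂ s) (ℓ≤u s))
                   (weight-∖ C₁ C₂ w) (weight-∖ C₂ C₁ w)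
                   (weight-remove _ c w (∧-intro C₁c (cong not C₂c))) wc
                   (sum-cong-≗ λ i → cong (_▹ w i) (∧-comm (C₁ i) (C₂ i)))
                   lt₁ lt₂ (upper _ _ cl₁₂) (lower _ _ cl₂₁))
      where
      C₁c = proj₁ (upper-facts κx₁ cl₁ lt₁)
      C₂c = proj₁ (lower-facts κx₂ cl₂ lt₂)
      cap-mono : ∀ a b {x y} → x ≤ y → (b ∧ a) ▹ x ≤ (a ∧ b) ▹ y
      cap-mono true  true  p = p
      cap-mono true  false p = z≤n
      cap-mono false true  p = z≤n
      cap-mono false false p = z≤n
      Y₁s₂ : Y₁ s₂ ≡ true
      Y₁s₂ = cl₁ x₂ s₂ E₁x₂ (subst (λ i → C₁ i ≡ true) (sym κx₂) C₁c)
      Y₂s₁ : Y₂ s₁ ≡ false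
      Y₂s₁ = ≢true⇒ λ p → true≢false (trans (sym (subst (λ i → C₂ i ≡ true) κx₁ (cl₂ x₁ s₁ E₂x₁ p))) C₂c)
      cl₁₂ : UpperClosed E (λ i → (C₁ i ∧ not (C₂ i)) ∧ not (i == c)) (λ s → Y₁ s ∧ not (Y₂ s))
      cl₁₂ x s Exs C with C₁₂x , x∉c ← ∧-elim {C₁ (κ x) ∧ not (C₂ (κ x))} C
                     with C₁x , C₂x ← ∧-elim {C₁ (κ x)} C₁₂x =
        ∧-intro (cl₁ x s (other-item x₁ κx₁ (not-elim x∉c) Exs) C₁x)
          (cong not (≢true⇒ λ Y₂s → true≢false
            (trans (sym (cl₂ x s (other-item x₂ κx₂ (not-elim x∉c) Exs) Y₂s)) (not-elim C₂x))))
      cl₂₁ : LowerClosed E (λ i → C₂ i ∧ not (C₁ i)) (λ s → Y₂ s ∧ not (Y₁ s))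
      cl₂₁ x s Exs Y with Y₂s , ¬Y₁s ← ∧-elim {Y₂ s} Y =
        ∧-intro (cl₂ x s E₂xs Y₂s)
          (cong not (≢true⇒ λ C₁x → true≢false
            (trans (sym (cl₁ x s (other-agent x₁ {Y = Y₂} Y₂s₁ Y₂s Exs) C₁x)) (not-elim ¬Y₁s))))
        where
        E₂xs : delete x₂ s₂ E x s ≡ true
        E₂xs = other-agent x₂ {Y = λ s → not (Y₁ s)} (cong not Y₁s₂) ¬Y₁s Exs
      arith : ∀ {y₁ ℓ₂ y∧ y∖ ℓ∧ ℓ∖ c₁ c₂ c∧ c∧′ c∖₁ c∖₁′ c∖₂ z} → y₁ ≡ y∧ + y∖ → ℓ₂ ≡ ℓ∧ + ℓ∖ → ℓ∧ ≤ y∧ →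
              c₁ ≡ c∧ + c∖₁ → c₂ ≡ c∧′ + c∖₂ → c∖₁ ≡ c∖₁′ + z → z ≡ 1 → c∧ ≡ c∧′ →
              y₁ < c₁ → c₂ < ℓ₂ → c∖₁′ ≤ y∖ → ℓ∖ ≤ c∖₂ → suc 0 ≤ 0
      arith {y∧ = y∧} {y∖} {ℓ∧} {ℓ∖} {c∧ = c∧} {c∖₁′ = c∖₁′} {c∖₂} refl refl g refl refl refl refl refl p q r t =
        certify 0 (+-mono-≤ g (+-mono-≤ p (+-mono-≤ q (+-mono-≤ r t))))
          (solve (y∧ ∷ y∖ ∷ ℓ∧ ∷ ℓ∖ ∷ c∧ ∷ c∖₁′ ∷ c∖₂ ∷ []))

  record Assigned (E : Relation n) : Set where
    field
      chosen   : Relation n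
      chosen⊆  : ∀ x s → chosen x s ≡ true → E x s ≡ true
      per-item : ∀ i → weight (λ x → κ x == i) (λ x → ∑ λ s → chosen x s ▹ 1) ≡ w i
      load-≥   : ∀ s → ℓ s ≤ ∑ λ x → chosen x s ▹ 1
      load-≤   : ∀ s → ∑ (λ x → chosen x s ▹ 1) ≤ u s

  TwoEdges : Relation n → Set
  TwoEdges E = ∃₂ λ x₁ s₁ → ∃₂ λ x₂ s₂ →
    κ x₁ ≡ κ x₂ × E x₁ s₁ ≡ true × E x₂ s₂ ≡ true × ¬ (x₁ ≡ x₂ × s₁ ≡ s₂)

  module _ (E : Relation n) (active : ∀ x s → E x s ≡ true → w (κ x) ≡ 1)
           (upper : Upper E) (lower : Lower E) (unique : ¬ TwoEdges E) where

    private
      unique-edge : ∀ {x s x′ s′} → κ x ≡ κ x′ → E x s ≡ true → E x′ s′ ≡ true → x ≡ x′ × s ≡ s′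
      unique-edge {x} {s} {x′} {s′} κxx′ Exs Ex′s′ with x Fin.≟ x′ | s Fin.≟ s′
      ... | yes p | yes q = p , q
      ... | yes p | no  q = contradiction (_ , _ , _ , _ , κxx′ , Exs , Ex′s′ , q ∘ proj₂) unique
      ... | no  p | _     = contradiction (_ , _ , _ , _ , κxx′ , Exs , Ex′s′ , p ∘ proj₁) unique

      joins? : ∀ s i → Dec (∃ λ x → κ x ≡ i × E x s ≡ true)
      joins? s i = Fin.any? λ x → (κ x Fin.≟ i) ×-dec (E x s Bool.≟ true)

      item-edges : ∀ i → size (λ x s → (κ x == i) ∧ E x s) ≡ w i
      item-edges i with Fin.any? (λ s → joins? s i)
      ... | yes (s₀ , x₀ , refl , E₀) = trans (size-delta x₀ s₀ pt) (sym (active x₀ s₀ E₀))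
        where
        pt : ∀ x s → (κ x == κ x₀) ∧ E x s ≡ (x == x₀) ∧ (s == s₀)
        pt x s with κ x Fin.≟ κ x₀ | E x s in Exs
        ... | yes p | true  with refl , refl ← unique-edge p Exs E₀ =
          sym (∧-intro (==-refl x) (==-refl s))
        ... | yes p | false = sym (≢true⇒ λ q → true≢false (trans (sym
          (subst (λ { (x , s) → E x s ≡ true }) (sym (cong₂ _,_ (==⇒≡ (proj₁ (∧-elim {x == x₀} q))) (==⇒≡ (proj₂ (∧-elim {x == x₀} q))))) E₀)) Exs))
        ... | no  p | _     = sym (≢true⇒ λ q → p (cong κ (==⇒≡ (proj₁ (∧-elim {x == x₀} q)))))
      -- Without an edge at item `i`, the singleton of `i` with no agents is closed, so `upper`
      -- makes its weight 0.
      ... | no ¬p = ≤-antisym (≤-trans (≤-reflexive no-edges) z≤n)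
          (≤-trans (≤-reflexive (sym (∑-delta′ i w)))
            (≤-trans (upper (λ j → j == i) (λ _ → false) λ x s Exs κx → contradiction (s , x , ==⇒≡ κx , Exs) ¬p)
                     (≤-reflexive (trans (∑-zero {n} λ _ → refl) (sym no-edges)))))
        where
        no-edges : size (λ x s → (κ x == i) ∧ E x s) ≡ 0
        no-edges = ∑-zero λ x → ∑-zero λ s → cong (_▹ 1) (≢true⇒ λ q →
          ¬p (s , x , ==⇒≡ (proj₁ (∧-elim {κ x == i} q)) , proj₂ (∧-elim {κ x == i} q)))

      joined : Fin n → Fin k → Bool
      joined s i = does (joins? s i)

      joined-true : ∀ s i → joined s i ≡ true → ∃ λ x → κ x ≡ i × E x s ≡ true
      joined-true s i p with joins? s i
      ... | yes q = q

      load-at : ∀ s i → ∑ (λ x → ((κ x == i) ∧ E x s) ▹ 1) ≡ joined s i ▹ w i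
      load-at s i with joins? s i
      ... | yes (x₀ , refl , E₀) = trans (sum-cong-≗ λ x → cong (_▹ 1) (pt x))
                                         (trans (∑-delta′ x₀ λ _ → 1) (sym (active x₀ s E₀)))
        where
        pt : ∀ x → (κ x == κ x₀) ∧ E x s ≡ (x == x₀)
        pt x with x Fin.≟ x₀
        ... | yes refl = ∧-intro (==-refl (κ x)) E₀
        ... | no  x≢x₀ = ≢true⇒ λ q → x≢x₀ (proj₁ (unique-edge
          (==⇒≡ (proj₁ (∧-elim {κ x == κ x₀} q))) (proj₂ (∧-elim {κ x == κ x₀} q)) E₀))
      ... | no ¬p = ∑-zero λ x → cong (_▹ 1) (≢true⇒ λ q →
          ¬p (x , ==⇒≡ (proj₁ (∧-elim {κ x == i} q)) , proj₂ (∧-elim {κ x == i} q)))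

      load : ∀ s → ∑ (λ x → E x s ▹ 1) ≡ weight (joined s) w
      load s = trans (sym (weight-fibres κ λ x → E x s ▹ 1))
        (sum-cong-≗ λ i → trans (sum-cong-≗ λ x → sym (▹-∧ (κ x == i) (E x s) 1)) (load-at s i))

    -- With one edge per item nothing is left to choose: the items joined to `s`, taken with the
    -- single agent `s`, are closed both ways, and the Hall conditions for this pair are the load
    -- bounds.
    assigned-unique : Assigned E
    assigned-unique = record
      { chosen   = E
      ; chosen⊆  = λ _ _ p → p
      ; per-item = λ i → trans (sum-cong-≗ λ x → trans (▹-∑ (κ x == i) λ s → E x s ▹ 1)
                     (sum-cong-≗ λ s → sym (▹-∧ (κ x == i) (E x s) 1))) (item-edges i)
      ; load-≥   = λ s → subst₂ _≤_ (∑-delta′ s ℓ) (sym (load s))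
                     (lower (joined s) (λ t → t == s) λ x t Ext t≡s →
                       dec-true (joins? s (κ x)) (x , refl , subst (λ t → E x t ≡ true) (==⇒≡ t≡s) Ext))
      ; load-≤   = λ s → subst₂ _≤_ (sym (load s)) (∑-delta′ s u)
                     (upper (joined s) (λ t → t == s) λ x t Ext Jx →
                       let x₀ , κx₀ , E₀ = joined-true s (κ x) Jx
                       in ≡⇒== (sym (proj₂ (unique-edge κx₀ E₀ Ext))))
      }

  assigned-⊆ : ∀ {E E′} → (∀ x s → E′ x s ≡ true → E x s ≡ true) → Assigned E′ → Assigned E
  assigned-⊆ E′⊆E a = record
    { chosen   = chosen
    ; chosen⊆  = λ x s p → E′⊆E x s (chosen⊆ x s p)
    ; per-item = per-item
    ; load-≥   = load-≥
    ; load-≤   = load-≤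
    }
    where open Assigned a

  -- A Hall-type theorem. As long as some item has two edges, one of them can be
  -- deleted: otherwise the sets obstructing the two deletions could be uncrossed.
  assignment : ∀ N (E : Relation n) → size E ≤ N → (∀ x s → E x s ≡ true → w (κ x) ≡ 1) →
               Upper E → Lower E → ¬ ¬ Assigned E
  assignment N E size≤N active upper lower ¬a = ¬¬-excluded-middle λ where
      (no unique) → ¬a (assigned-unique E active upper lower unique)
      (yes (x₁ , s₁ , x₂ , s₂ , κ₁₂ , E₁ , E₂ , e₁≢e₂)) → step N size≤N x₁ s₁ x₂ s₂ κ₁₂ E₁ E₂ e₁≢e₂
    where
    step : ∀ N → size E ≤ N → ∀ x₁ s₁ x₂ s₂ → κ x₁ ≡ κ x₂ → E x₁ s₁ ≡ true → E x₂ s₂ ≡ true →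
           ¬ (x₁ ≡ x₂ × s₁ ≡ s₂) → ⊥
    step N size≤N x₁ s₁ x₂ s₂ κ₁₂ E₁ E₂ e₁≢e₂ =
      keep x₁ s₁ E₁ N size≤N λ obstruction₁ → keep x₂ s₂ E₂ N size≤N λ obstruction₂ → uncross obstruction₁ obstruction₂
      where
      Obstructed : Fin n → Fin n → Set
      Obstructed x s = UpperViolated (delete x s E) ⊎ LowerViolated (delete x s E)
      keep : ∀ x s → E x s ≡ true → ∀ N → size E ≤ N → ¬ ¬ Obstructed x s
      keep x s Exs N size≤N ok with ≤-trans (size-strict (delete-⊆ x s E) x s Exs (delete-self x s E)) size≤N
      keep x s Exs (suc N) size≤N ok | s≤s size′≤N =
        assignment N (delete x s E) size′≤N (λ y t p → active y t (delete-⊆ x s E y t p))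
          (λ C Y cl → ≮⇒≥ λ lt → ok (inj₁ (C , Y , cl , lt)))
          (λ C Y cl → ≮⇒≥ λ lt → ok (inj₂ (C , Y , cl , lt)))
          λ a → ¬a (assigned-⊆ (delete-⊆ x s E) a)
      open Uncrossing E upper lower (κ x₂) (active x₂ s₂ E₂)
      remaining : ∀ {x s x′ s′} → ¬ (x ≡ x′ × s ≡ s′) → E x s ≡ true → delete x′ s′ E x s ≡ true
      remaining {x} {s} {x′} {s′} ≢ Exs with delete-cases x′ s′ E x s Exs
      ... | inj₁ p = contradiction p ≢
      ... | inj₂ p = p
      E₂x₁ = remaining e₁≢e₂ E₁
      E₁x₂ = remaining (λ { (p , q) → e₁≢e₂ (sym p , sym q) }) E₂
      uncross : Obstructed x₁ s₁ → Obstructed x₂ s₂ → ⊥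
      uncross (inj₁ p) (inj₁ q) = upper-upper (κ₁₂ , refl , E₂x₁ , E₁x₂) p q
      uncross (inj₁ p) (inj₂ q) = upper-lower (κ₁₂ , refl , E₂x₁ , E₁x₂) p q
      uncross (inj₂ p) (inj₁ q) = upper-lower (refl , κ₁₂ , E₁x₂ , E₂x₁) q p
      uncross (inj₂ p) (inj₂ q) = lower-lower (κ₁₂ , refl , E₂x₁ , E₁x₂) p q

-- Colourings and barriers

deg : ∀ {n} → Graph n → Fin n → ℕ
deg G v = ∑ λ u → adj G v u ▹ 1

-- Colour zero marks a removed set S of vertices; the other colour classes are
-- unions of components of G − S.
Proper : ∀ {n m} → Graph n → (Fin n → Fin (suc m)) → Set
Proper G κ = ∀ u v → adj G u v ≡ true → κ u ≢ zero → κ v ≢ zero → κ u ≡ κ v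

mass : ∀ {n k} → (Fin n → ℕ) → (Fin n → Fin k) → Fin k → ℕ
mass f κ i = weight (λ v → κ v == i) f

#odd : ∀ {n m} → (Fin n → ℕ) → (Fin n → Fin (suc m)) → ℕ
#odd f κ = ∑ λ i → odd (mass f κ (suc i))

-- All colourings with any number of colours are allowed. The one by components is the strongest
-- instance, since an odd union of components contains an odd component.
Condition : ∀ {n} → Graph n → (f g : Fin n → ℕ) → Set
Condition {n} G f g = ∀ {m} (κ : Fin n → Fin (suc m)) → Proper G κ → #odd f κ ≤ mass g κ zero

DegreeAllowed : (f g d : ℕ) → Set
DegreeAllowed f g d = (odd d ≡ odd f × d ≤ f) ⊎ (f ≤ d × d ≤ g)

degree-exact : ∀ {a d} → DegreeAllowed a a d → odd d ≡ odd a × d ≤ a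
degree-exact (inj₁ p) = p
degree-exact (inj₂ (p , q)) with refl ← ≤-antisym p q = refl , ≤-refl

record Factor {n} (G : Graph n) (f g : Fin n → ℕ) : Set where
  field
    graph    : Graph n
    subgraph : ∀ u v → adj graph u v ≡ true → adj G u v ≡ true
    degrees  : ∀ v → DegreeAllowed (f v) (g v) (deg graph v)

-- Weights S against the number of classes of positive mass, so that a colouring
-- maximal for it has as large an S and as fine classes as possible.
potential : ∀ {n m} → (Fin n → ℕ) → (Fin n → Fin (suc m)) → ℕ
potential f κ = 2 * mass f κ zero + ∑ λ i → 1 ⊓ mass f κ (suc i)

-- Class `i` is cut up along `μ`, its part of `μ`-colour zero joining S. The pieces get new colours
-- and slot `i` stays empty, which spares a renumbering.
module Refinement {n m m′} (κ : Fin n → Fin (suc m)) (i : Fin m) (μ : Fin n → Fin (suc m′)) where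

  lift : Fin (suc m′) → Fin (suc (m + m′))
  lift zero    = zero
  lift (suc j) = suc (m ↑ʳ j)

  code : Fin (suc m) → Fin (suc m′) → Fin (suc (m + m′))
  code zero    c = zero
  code (suc k) c = if k == i then lift c else suc (k ↑ˡ m′)

  refined : Fin n → Fin (suc (m + m′))
  refined v = code (κ v) (μ v)

  cell : (Fin n → ℕ) → Fin (suc m′) → ℕ
  cell f j = weight (λ v → (κ v == suc i) ∧ (μ v == j)) f

  private
    ↑ʳ≢↑ˡ : ∀ {k : Fin m} {j : Fin m′} → (m ↑ʳ j == k ↑ˡ m′) ≡ false
    ↑ʳ≢↑ˡ {k} {j} = ≢⇒== λ p → contradiction
      (trans (sym (Fin.splitAt-↑ʳ m m′ j)) (trans (cong (Fin.splitAt m) p) (Fin.splitAt-↑ˡ m k m′))) λ ()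

    code-zero : ∀ a c x → (code a c == zero) ▹ x ≡ (a == zero) ▹ x + ((a == suc i) ∧ (c == zero)) ▹ x
    code-zero zero    c x = sym (+-identityʳ x)
    code-zero (suc k) c x with k Fin.≟ i
    code-zero (suc k) zero    x | yes _ = refl
    code-zero (suc k) (suc _) x | yes _ = refl
    code-zero (suc k) c       x | no  _ = refl

    ==-clash : ∀ (l k : Fin m) → (l == k) ∧ not (k == l) ≡ false
    ==-clash l k rewrite ==-sym k l with l == k
    ... | true  = refl
    ... | false = refl

    code-↑ˡ : ∀ k a c → (code a c == suc (k ↑ˡ m′)) ≡ (a == suc k) ∧ not (k == i)
    code-↑ˡ k zero    c = refl
    code-↑ˡ k (suc l) c with l Fin.≟ i
    code-↑ˡ k (suc l) zero    | yes refl = sym (==-clash l k)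
    code-↑ˡ k (suc l) (suc j) | yes refl = trans ↑ʳ≢↑ˡ (sym (==-clash l k))
    ... | no l≢i with l Fin.≟ k
    ...   | yes refl = trans (==-refl (k ↑ˡ m′)) (sym (cong not (≢⇒== l≢i)))
    ...   | no  l≢k  = ≢⇒== (l≢k ∘ Fin.↑ˡ-injective m′ l k)

    code-↑ʳ : ∀ j a c → (code a c == suc (m ↑ʳ j)) ≡ (a == suc i) ∧ (c == suc j)
    code-↑ʳ j zero    c = refl
    code-↑ʳ j (suc l) c with l Fin.≟ i
    code-↑ʳ j (suc l) zero     | yes _ = refl
    code-↑ʳ j (suc l) (suc j′) | yes _ with j′ Fin.≟ j
    ... | yes refl = ==-refl (m ↑ʳ j)
    ... | no  j′≢j = ≢⇒== (j′≢j ∘ Fin.↑ʳ-injective m j′ j)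
    code-↑ʳ j (suc l) c        | no  _ = trans (==-sym (l ↑ˡ m′) (m ↑ʳ j)) ↑ʳ≢↑ˡ

  mass-zero : ∀ f → mass f refined zero ≡ mass f κ zero + cell f zero
  mass-zero f = trans (sum-cong-≗ λ v → code-zero (κ v) (μ v) (f v)) (∑-distrib-+ (λ v → (κ v == zero) ▹ f v) _)

  -- Applied with `odd` for the excess and with `1 ⊓_` for the potential; `φ 0 ≡ 0` silences the
  -- emptied slot `i`.
  ∑-refined : ∀ (φ : ℕ → ℕ) → φ 0 ≡ 0 → ∀ f →
              ∑ (λ k → φ (mass f refined (suc k))) + φ (mass f κ (suc i)) ≡
              ∑ (λ k → φ (mass f κ (suc k))) + ∑ (λ j → φ (cell f (suc j)))
  ∑-refined φ φ0 f = begin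
    ∑ (λ k → φ (mass f refined (suc k))) + φ (mass f κ (suc i))
      ≡⟨ cong (_+ φ (mass f κ (suc i))) (∑-split m _) ⟩
    ∑ (λ k → φ (mass f refined (suc (k ↑ˡ m′)))) + ∑ (λ j → φ (mass f refined (suc (m ↑ʳ j)))) + φ (mass f κ (suc i))
      ≡⟨ cong₂ (λ x y → x + y + φ (mass f κ (suc i))) (sum-cong-≗ left) (sum-cong-≗ right) ⟩
    ∑ (λ k → not (k == i) ▹ φ (mass f κ (suc k))) + ∑ (λ j → φ (cell f (suc j))) + φ (mass f κ (suc i))
      ≡⟨ rearr (∑ (λ k → not (k == i) ▹ φ (mass f κ (suc k)))) _ _ ⟩
    ∑ (λ k → not (k == i) ▹ φ (mass f κ (suc k))) + φ (mass f κ (suc i)) + ∑ (λ j → φ (cell f (suc j)))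
      ≡⟨ cong (λ x → x + ∑ (λ j → φ (cell f (suc j)))) (sym (weight-remove (λ _ → true) i (λ k → φ (mass f κ (suc k))) refl)) ⟩
    ∑ (λ k → φ (mass f κ (suc k))) + ∑ (λ j → φ (cell f (suc j))) ∎
    where
    open ≡.≡-Reasoning
    rearr : ∀ a b c → a + b + c ≡ a + c + b
    rearr a b c = solve (a ∷ b ∷ c ∷ [])
    left : ∀ k → φ (mass f refined (suc (k ↑ˡ m′))) ≡ not (k == i) ▹ φ (mass f κ (suc k))
    left k = trans (cong φ (weight-cong f λ v → code-↑ˡ k (κ v) (μ v))) (case (k == i))
      where
      case : ∀ b → φ (weight (λ v → (κ v == suc k) ∧ not b) f) ≡ not b ▹ φ (mass f κ (suc k))
      case true  = trans (cong φ (∑-zero λ v → cong (_▹ f v) (∧-zeroʳ (κ v == suc k)))) φ0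
      case false = cong φ (weight-cong f λ v → ∧-identityʳ (κ v == suc k))
    right : ∀ j → φ (mass f refined (suc (m ↑ʳ j))) ≡ φ (cell f (suc j))
    right j = cong φ (weight-cong f λ v → code-↑ʳ j (κ v) (μ v))

  ∑-cell : ∀ f → ∑ (cell f) ≡ mass f κ (suc i)
  ∑-cell f = trans (∑-comm λ j v → ((κ v == suc i) ∧ (μ v == j)) ▹ f v)
    (sum-cong-≗ λ v → trans (sum-cong-≗ λ j → ▹-∧ (κ v == suc i) (μ v == j) (f v))
      (trans (sym (▹-∑ (κ v == suc i) λ j → (μ v == j) ▹ f v))
             (cong ((κ v == suc i) ▹_) (∑-delta (μ v) λ _ → f v))))

-- G - S with the vertices of S kept as isolated ones, so that the vertex set remains `Fin n`.
restrict : ∀ {n m} → Graph n → (Fin n → Fin (suc m)) → Graph n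
restrict G κ = record
  { adj    = λ u v → adj G u v ∧ (not (κ u == zero) ∧ not (κ v == zero))
  ; sym    = λ u v → cong₂ _∧_ (Graph.sym G u v) (∧-comm (not (κ u == zero)) _)
  ; irrefl = λ v → cong (_∧ _) (irrefl G v)
  }

≢zero⇒ : ∀ {m} {i : Fin (suc m)} → i ≢ zero → not (i == zero) ≡ true
≢zero⇒ p = cong not (≢⇒== p)

restrict-adj : ∀ {n m} (G : Graph n) (κ : Fin n → Fin (suc m)) u v → adj (restrict G κ) u v ≡ true →
               adj G u v ≡ true × κ u ≢ zero × κ v ≢ zero
restrict-adj G κ u v p with a , b ← ∧-elim {adj G u v} p with c , d ← ∧-elim {not (κ u == zero)} b =
  a , (λ { q → true≢false (trans (sym (≡⇒== q)) (not-elim c)) })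
    , (λ { q → true≢false (trans (sym (≡⇒== q)) (not-elim d)) })

-- Shared by the exact case `f = g` and the general one. `max-excess` is maximality of #odd - f(S)
-- in additive form, and `max-potential` breaks its ties among colourings whose f(S) is no smaller.
module Step {n m} (G : Graph n) (f g : Fin n → ℕ) (f≤g : ∀ v → f v ≤ g v)
  (κ : Fin n → Fin (suc m)) (proper : Proper G κ)
  (condition : Condition G f g)
  (f>0 : ∀ u v → adj G u v ≡ true → 0 < f u)
  (max-excess : ∀ {m′} (κ′ : Fin n → Fin (suc m′)) → Proper G κ′ →
                #odd f κ′ + mass f κ zero ≤ #odd f κ + mass f κ′ zero)
  (max-potential : ∀ {m′} (κ′ : Fin n → Fin (suc m′)) → Proper G κ′ →
                   #odd f κ + mass f κ′ zero ≤ #odd f κ′ + mass f κ zero →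
                   mass f κ zero ≤ mass f κ′ zero → potential f κ′ ≤ potential f κ)
  where

  oddity : Fin (suc m) → ℕ
  oddity zero    = 0
  oddity (suc i) = odd (mass f κ (suc i))

  oddity≤1 : ∀ i → oddity i ≤ 1
  oddity≤1 zero    = z≤n
  oddity≤1 (suc i) = odd≤1 (mass f κ (suc i))

  active : Fin (suc m) → Bool
  active i = oddity i ≡ᵇ 1

  links : Relation n
  links x s = adj G x s ∧ ((κ s == zero) ∧ active (κ x))

  links-elim : ∀ {x s} → links x s ≡ true → adj G x s ≡ true × κ s ≡ zero × oddity (κ x) ≡ 1
  links-elim {x} {s} p with a , b ← ∧-elim {adj G x s} p with c , d ← ∧-elim {κ s == zero} b =
    a , ==⇒≡ c , ≡ᵇ⇒≡ (oddity (κ x)) 1 (subst T (sym d) tt)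

  links-intro : ∀ {x s} → adj G x s ≡ true → κ s ≡ zero → active (κ x) ≡ true → links x s ≡ true
  links-intro a b c = ∧-intro a (∧-intro (≡⇒== b) c)

  -- Both vanish outside S, so every vertex can serve as an agent and only those in S receive
  -- anything.
  lower upper : Fin n → ℕ
  lower s = (κ s == zero) ▹ f s
  upper s = (κ s == zero) ▹ g s

  lower≤upper : ∀ s → lower s ≤ upper s
  lower≤upper s with κ s == zero
  ... | true  = f≤g s
  ... | false = z≤n

  open Assignment κ oddity lower upper lower≤upper

  -- Keeps the odd classes in C and the vertices of S in Y; everything else becomes one class.
  module Keep (C : Fin (suc m) → Bool) (Y : Fin n → Bool) (closed : UpperClosed links C Y) where

    code : Fin (suc m) → Bool → Fin (suc (suc m))
    code zero    y = if y then zero else suc zero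
    code (suc i) y = if C (suc i) ∧ active (suc i) then suc (suc i) else suc zero

    kept : Fin n → Fin (suc (suc m))
    kept v = code (κ v) (Y v)

    private
      S-class : ∀ {u v} → adj G u v ≡ true → κ u ≡ zero → ∀ {i} → κ v ≡ suc i → kept u ≢ zero → kept u ≡ kept v
      S-class {u} {v} Guv κu {i} κv ku rewrite κu | κv with Y u in Yu | C (suc i) ∧ active (suc i) in eq
      ... | true  | _     = contradiction refl ku
      ... | false | false = refl
      ... | false | true  = contradiction (trans (sym (closed v u
              (links-intro (trans (Graph.sym G v u) Guv) κu (subst (λ k → active k ≡ true) (sym κv) (proj₂ (∧-elim {C (suc i)} eq))))
              (subst (λ k → C k ≡ true) (sym κv) (proj₁ (∧-elim eq))))) Yu) true≢false

    -- By `closed`, an odd class in `C` sees no vertex of S outside `Y`. Those in `Y` are removed,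
    -- so the class does not touch the merged one.
    kept-proper : Proper G kept
    kept-proper u v Guv ku kv with κ u in κu | κ v in κv
    ... | zero  | zero  with Y u | Y v
    ...   | true  | _     = contradiction refl ku
    ...   | false | true  = contradiction refl kv
    ...   | false | false = refl
    kept-proper u v Guv ku kv | zero  | suc i = subst₂ _≡_ (cong (λ k → code k (Y u)) κu) (cong (λ k → code k (Y v)) κv)
      (S-class Guv κu κv (subst (λ k → code k (Y u) ≢ zero) (sym κu) ku))
    kept-proper u v Guv ku kv | suc i | zero  = subst₂ _≡_ (cong (λ k → code k (Y u)) κu) (cong (λ k → code k (Y v)) κv)
      (sym (S-class (trans (Graph.sym G v u) Guv) κv κu (subst (λ k → code k (Y v) ≢ zero) (sym κv) kv)))
    kept-proper u v Guv ku kv | suc i | suc j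
      with refl ← trans (sym κu) (trans (proper u v Guv (λ p → contradiction (trans (sym κu) p) λ ())
                                                      (λ p → contradiction (trans (sym κv) p) λ ())) κv) = refl

    kept-zero : ∀ h → mass h kept zero ≡ weight Y (λ s → (κ s == zero) ▹ h s)
    kept-zero h = sum-cong-≗ λ v → pt (κ v) (Y v) (h v)
      where
      pt : ∀ k y x → (code k y == zero) ▹ x ≡ y ▹ ((k == zero) ▹ x)
      pt zero    true  x = refl
      pt zero    false x = refl
      pt (suc i) y     x with C (suc i) ∧ active (suc i)
      ... | true  = sym (▹-0 y)
      ... | false = sym (▹-0 y)

    kept-odd : weight C oddity ≤ #odd f kept
    kept-odd = ≤-trans (≤-reflexive (cong (_+ ∑ (λ i → C (suc i) ▹ oddity (suc i))) (▹-0 (C zero))))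
      (≤-trans (∑-mono pt) (m≤n+m _ (odd (mass f kept (suc zero)))))
      where
      pt : ∀ i → C (suc i) ▹ oddity (suc i) ≤ odd (mass f kept (suc (suc i)))
      pt i with C (suc i) in Ci | oddity (suc i) in pi | oddity≤1 (suc i)
      ... | false | _ | _ = z≤n
      ... | true  | 0 | _ = z≤n
      ... | true  | suc (suc _) | s≤s ()
      ... | true  | 1 | _ = ≤-reflexive (trans (sym pi) (cong odd (weight-cong f λ v → pt′ (κ v) (Y v))))
        where
        kept-i : C (suc i) ∧ active (suc i) ≡ true
        kept-i = ∧-intro Ci (cong (_≡ᵇ 1) pi)
        pt′ : ∀ k y → (k == suc i) ≡ (code k y == suc (suc i))
        pt′ zero    true  = refl
        pt′ zero    false = refl
        pt′ (suc j) y with j Fin.≟ i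
        ... | yes refl rewrite kept-i = sym (==-refl i)
        ... | no  j≢i with C (suc j) ∧ active (suc j)
        ...   | true  = sym (≢⇒== j≢i)
        ...   | false = refl

  -- The odd classes in `C` survive as odd classes of `kept`, whose removed set is the part of S in
  -- `Y`; this is an instance of `condition`.
  links-upper : Upper links
  links-upper C Y closed = ≤-trans kept-odd (≤-trans (condition kept kept-proper) (≤-reflexive (kept-zero g)))
    where open Keep C Y closed

  -- Complements turn lower closed pairs into upper closed ones. If the agents in `Y` demanded more
  -- than `C` offers, returning them from S to the rest would lose fewer odd classes than weight and
  -- so raise the excess.
  links-lower : Lower links
  links-lower C Y closed = arith (weight-∖ (λ _ → true) C oddity) (weight-∖ (λ _ → true) Y lower)
      (≤-trans (+-monoˡ-≤ _ kept-odd) (≤-trans (max-excess kept kept-proper) (≤-reflexive (cong (#odd f κ +_) (kept-zero f)))))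
    where
    open Keep (not ∘ C) (not ∘ Y) (λ x s l ¬Cx → cong not (≢true⇒ λ Ys →
      true≢false (trans (sym (closed x s l Ys)) (not-elim ¬Cx))))
    arith : ∀ {q c c′ s y y′} → q ≡ c + c′ → s ≡ y + y′ → c′ + s ≤ q + y′ → y ≤ c
    arith {c = c} {c′} {y = y} {y′} refl refl p = certify 0 p (solve (c ∷ c′ ∷ y ∷ y′ ∷ []))

  assigned : ¬ ¬ Assigned links
  assigned = assignment (size links) links ≤-refl (λ x s l → proj₂ (proj₂ (links-elim l))) links-upper links-lower

  module Finish (a : Assigned links) where
    open Assigned a

    chosen-elim : ∀ {x s} → chosen x s ≡ true → adj G x s ≡ true × κ s ≡ zero × oddity (κ x) ≡ 1
    chosen-elim p = links-elim (chosen⊆ _ _ p)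

    chosen-nonzero : ∀ {x s} → chosen x s ≡ true → κ x ≢ zero
    chosen-nonzero p q with () ← trans (sym (cong oddity q)) (proj₂ (proj₂ (chosen-elim p)))

    joins : Fin n → ℕ
    joins x = ∑ λ s → chosen x s ▹ 1

    residual : Fin n → ℕ
    residual v = not (κ v == zero) ▹ (f v ∸ joins v)

    joins≤1 : ∀ v → joins v ≤ 1
    joins≤1 v = ≤-trans (≤-reflexive (cong (_▹ joins v) (sym (==-refl (κ v)))))
      (≤-trans (∑-term (λ x → (κ x == κ v) ▹ joins x) v)
               (≤-trans (≤-reflexive (per-item (κ v))) (oddity≤1 (κ v))))

    joins≤f : ∀ v → joins v ≤ f v
    joins≤f v with joins v in eq | joins≤1 v
    ... | 0 | _ = z≤n
    ... | suc (suc _) | s≤s ()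
    ... | 1 | _ with s , q ← ∑-positive (λ s → chosen v s ▹ 1) (subst (0 <_) (sym eq) (s≤s z≤n)) with chosen v s in p
    ...   | true = f>0 v s (proj₁ (chosen-elim p))

    residual-+ : ∀ v → κ v ≢ zero → residual v + joins v ≡ f v
    residual-+ v κv rewrite ≢⇒== κv = m∸n+n≡m (joins≤f v)

    module Class {m′} (i : Fin m) (μ : Fin n → Fin (suc m′)) (μ-proper : Proper (restrict G κ) μ) where
      open Refinement κ i μ

      refined-proper : Proper G refined
      refined-proper u v Guv ru rv = go (κ u) (κ v) refl refl
        where
        go : ∀ a b → κ u ≡ a → κ v ≡ b → refined u ≡ refined v
        go zero    b    p q = contradiction (cong (λ k → code k (μ u)) p) ru
        go (suc a) zero p q = contradiction (cong (λ k → code k (μ v)) q) rv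
        go (suc a) (suc b) p q
          with refl ← trans (sym p) (trans (proper u v Guv (λ r → contradiction (trans (sym p) r) λ ())
                                                          (λ r → contradiction (trans (sym q) r) λ ())) q)
          = subst₂ _≡_ (cong (λ k → code k (μ u)) (sym p)) (cong (λ k → code k (μ v)) (sym q))
              (same (subst (λ k → code k (μ u) ≢ zero) p ru) (subst (λ k → code k (μ v) ≢ zero) q rv))
          where
          G′uv : adj (restrict G κ) u v ≡ true
          G′uv = ∧-intro Guv (∧-intro (≢zero⇒ λ r → contradiction (trans (sym p) r) λ ())
                                      (≢zero⇒ λ r → contradiction (trans (sym q) r) λ ()))
          same : code (suc a) (μ u) ≢ zero → code (suc a) (μ v) ≢ zero → code (suc a) (μ u) ≡ code (suc a) (μ v)
          same cu cv with a == i
          ... | false = refl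
          ... | true  = cong lift (μ-proper u v G′uv (λ r → cu (cong lift r)) (λ r → cv (cong lift r)))

      W W′ J : Fin (suc m′) → ℕ
      W  = cell f
      W′ = cell residual
      J  = cell joins

      W-split : ∀ j → W′ j + J j ≡ W j
      W-split j = trans (sym (∑-distrib-+ (λ v → ((κ v == suc i) ∧ (μ v == j)) ▹ residual v) _)) (sum-cong-≗ pt)
        where
        pt : ∀ v → ((κ v == suc i) ∧ (μ v == j)) ▹ residual v + ((κ v == suc i) ∧ (μ v == j)) ▹ joins v
                   ≡ ((κ v == suc i) ∧ (μ v == j)) ▹ f v
        pt v with κ v Fin.≟ suc i | μ v == j
        ... | no  _ | _     = refl
        ... | yes _ | false = refl
        ... | yes p | true  = residual-+ v λ q → contradiction (trans (sym p) q) λ ()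

      ∑J : J zero + ∑ (λ j → J (suc j)) ≡ oddity (suc i)
      ∑J = trans (∑-cell joins) (per-item (suc i))

      Q P : ℕ
      Q = ∑ λ j → odd (W (suc j))
      P = ∑ λ j → 1 ⊓ W (suc j)

      odd-refined : #odd f refined + oddity (suc i) ≡ #odd f κ + Q
      odd-refined = ∑-refined odd refl f

      -- Refining trades the oddity of the class for `Q` odd pieces and adds `W zero` to f(S);
      -- maximal excess forbids a gain.
      excess : Q ≤ W zero + oddity (suc i)
      excess = arith {#odd f refined} {mass f κ zero} {#odd f κ} {w = W zero} {oddity (suc i)} (max-excess refined refined-proper) (mass-zero f) odd-refined
        where
        arith : ∀ {q′ s q s′ w o r} → q′ + s ≤ q + s′ → s′ ≡ s + w → q′ + o ≡ q + r → r ≤ w + o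
        arith {q′} {s} {q} {_} {w} {o} {r} p refl e = certify 0 (+-mono-≤ p (≤-reflexive (sym e)))
          (solve (q′ ∷ s ∷ q ∷ w ∷ o ∷ r ∷ []))

      odd-W′ : ∀ j → odd (W′ j) ≡ odd (W j + J j)
      odd-W′ j = trans (sym (odd-cancel (W′ j) (J j))) (cong (λ x → odd (x + J j)) (W-split j))

      ∑-odd-W′ : ∑ (λ j → odd (W′ (suc j))) ≤ Q + ∑ (λ j → J (suc j))
      ∑-odd-W′ = ≤-trans (∑-mono λ j → ≤-trans (≤-reflexive (odd-W′ (suc j)))
                   (≤-trans (odd-subadd (W (suc j)) (J (suc j))) (+-monoʳ-≤ _ (odd≤ (J (suc j))))))
                 (≤-reflexive (∑-distrib-+ (λ j → odd (W (suc j))) _))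

      parity-Q : odd (Q + W zero) ≡ odd (oddity (suc i))
      parity-Q = trans (odd-+-cong {Q} {∑ λ j → W (suc j)} {W zero} (odd-∑ λ j → W (suc j)) refl)
        (trans (cong odd (trans (+-comm (∑ λ j → W (suc j)) (W zero)) (∑-cell f))) (sym (odd-odd (mass f κ (suc i)))))

      -- When Q = f(U) + 1, refining the class leaves the excess unchanged; maximality of
      -- the potential then forces f(U) = 0 and a single class of positive mass.
      module Tie (o≡1 : oddity (suc i) ≡ 1) (Q≡ : Q ≡ suc (W zero)) where

        bound : 2 * W zero + P ≤ 1
        bound = arith {mass f κ zero} {p = ∑ λ k → 1 ⊓ mass f κ (suc k)} {w = W zero} {P} (max-potential refined refined-proper tie (≤-trans (m≤m+n _ _) (≤-reflexive (sym (mass-zero f)))))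
                      (mass-zero f) (∑-refined (1 ⊓_) refl f) (m⊓n≤m 1 (mass f κ (suc i)))
          where
          tie : #odd f κ + mass f refined zero ≤ #odd f refined + mass f κ zero
          tie = arith′ {#odd f κ} {mass f κ zero} {w = W zero} {#odd f refined} (mass-zero f) odd-refined o≡1 Q≡
            where
            arith′ : ∀ {q s s′ w q′ o r} → s′ ≡ s + w → q′ + o ≡ q + r → o ≡ 1 → r ≡ suc w → q + s′ ≤ q′ + s
            arith′ {q} {s} {_} {w} {q′} refl e refl refl = certify 0 (≤-reflexive (sym e)) (solve (q ∷ s ∷ w ∷ q′ ∷ []))
          arith : ∀ {s s′ p p′ w t x} → 2 * s′ + p′ ≤ 2 * s + p → s′ ≡ s + w → p′ + x ≡ p + t → x ≤ 1 → 2 * w + t ≤ 1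
          arith {s} {_} {p} {p′} {w} {t} {x} h refl e x≤1 = certify 0 (+-mono-≤ h (+-mono-≤ (≤-reflexive (sym e)) x≤1))
            (solve (s ∷ p ∷ p′ ∷ w ∷ t ∷ x ∷ []))

        -- The factor 2 in `potential` pays off: `2 * W zero ≤ 1` leaves only 0.
        W0≡0 : W zero ≡ 0
        W0≡0 with W zero | bound
        ... | zero  | _ = refl
        ... | suc x | s≤s h with () ← ≤-trans (≤-reflexive (sym (+-suc x (x + 0)))) (≤-trans (m≤m+n _ P) h)

        P≤1 : P ≤ 1
        P≤1 = ≤-trans (m≤n+m P (2 * W zero)) bound

        ∑J≡1 : ∑ (λ j → J (suc j)) ≡ 1
        ∑J≡1 = trans (cong (_+ ∑ (λ j → J (suc j))) (sym J0≡0)) (trans ∑J o≡1)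
          where
          J0≡0 : J zero ≡ 0
          J0≡0 = n≤0⇒n≡0 (≤-trans (m≤n+m (J zero) (W′ zero)) (≤-reflexive (trans (W-split zero) W0≡0)))

        odd≡⊓ : ∀ j → odd (W (suc j)) ≡ 1 ⊓ W (suc j)
        odd≡⊓ = ∑-rigid (λ j → odd (W (suc j))) _ (λ j → ⊓-glb (odd≤1 (W (suc j))) (odd≤ (W (suc j))))
          (≤-trans P≤1 (≤-reflexive (sym (trans Q≡ (cong suc W0≡0)))))

        -- As U has weight 0, the attached vertex must lie in the only piece of positive mass,
        -- whichever vertex the assignment chose.
        J≡⊓ : ∀ j → J (suc j) ≡ 1 ⊓ W (suc j)
        J≡⊓ = ∑-rigid (λ j → J (suc j)) _
          (λ j → ⊓-glb (≤-trans (∑-term (λ j → J (suc j)) j) (≤-reflexive ∑J≡1))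
                       (≤-trans (m≤n+m (J (suc j)) (W′ (suc j))) (≤-reflexive (W-split (suc j)))))
          (≤-trans P≤1 (≤-reflexive (sym ∑J≡1)))

        all-even : ∀ j → odd (W′ (suc j)) ≡ 0
        all-even j = trans (odd-W′ (suc j)) (trans (odd-+-cong {W (suc j)} {1 ⊓ W (suc j)} {J (suc j)}
          (trans (sym (odd-odd (W (suc j)))) (cong odd (odd≡⊓ j))) (cong odd (J≡⊓ j))) (odd-double (1 ⊓ W (suc j))))

      -- If `Q` plus the oddity is at most f(U), the bound survives lowering one weight, wherever it
      -- happens. Otherwise `excess` and `parity-Q` leave only an odd class with `Q = f(U) + 1`,
      -- which is the tie.
      class-bound : ∑ (λ j → odd (W′ (suc j))) ≤ W′ zero
      class-bound with Q + oddity (suc i) ≤? W zero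
      ... | yes p = arith ∑-odd-W′ p ∑J (W-split zero)
        where
        arith : ∀ {r q j w o j₀ w′} → r ≤ q + j → q + o ≤ w → j₀ + j ≡ o → w′ + j₀ ≡ w → r ≤ w′
        arith {r} {q} {j} {j₀ = j₀} {w′} a b refl refl = certify 0 (+-mono-≤ a b) (solve (r ∷ q ∷ j ∷ j₀ ∷ w′ ∷ []))
      ... | no ¬p = case (oddity (suc i)) refl (oddity≤1 (suc i))
        where
        case : ∀ o → oddity (suc i) ≡ o → o ≤ 1 → ∑ (λ j → odd (W′ (suc j))) ≤ W′ zero
        case 0 eq _ = contradiction (≤-trans (+-monoʳ-≤ Q (≤-reflexive eq))
          (≤-trans (≤-reflexive (+-identityʳ Q)) (≤-trans excess
            (≤-trans (+-monoʳ-≤ (W zero) (≤-reflexive eq)) (≤-reflexive (+-identityʳ _)))))) ¬p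
        case (suc (suc _)) _ (s≤s ())
        case 1 eq _ = ≤-trans (≤-reflexive (∑-zero (Tie.all-even eq Q≡))) z≤n
          where
          Q≤ : Q ≤ suc (W zero)
          Q≤ = ≤-trans excess (≤-reflexive (trans (cong (W zero +_) eq) (+-comm (W zero) 1)))
          Q≢W : Q ≢ W zero
          Q≢W p with () ← trans (sym (cong odd eq)) (trans (sym parity-Q)
            (trans (cong (λ x → odd (x + W zero)) p) (odd-double (W zero))))
          Q≡ : Q ≡ suc (W zero)
          Q≡ = ≤-antisym Q≤ (≤∧≢⇒< (s≤s⁻¹ (≤-trans (≰⇒> ¬p)
            (≤-reflexive (trans (cong (Q +_) eq) (+-comm Q 1))))) (Q≢W ∘ sym))

    -- Every `μ`-class is cut by the classes of `κ`, where `class-bound` applies; oddness is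
    -- subadditive, and the vertices of S have residual weight 0.
    residual-condition : Condition (restrict G κ) residual residual
    residual-condition μ μ-proper = begin
      ∑ (λ j → odd (mass residual μ (suc j)))
        ≤⟨ ∑-mono (λ j → ≤-trans (≤-reflexive (cong odd (by-class (suc j)))) (odd-∑≤ λ i → cell i residual (suc j))) ⟩
      ∑ (λ j → ∑ λ i → odd (cell i residual (suc j)))
        ≡⟨ ∑-comm (λ j i → odd (cell i residual (suc j))) ⟩
      ∑ (λ i → ∑ λ j → odd (cell i residual (suc j)))
        ≤⟨ ∑-mono (λ i → Class.class-bound i μ μ-proper) ⟩
      ∑ (λ i → cell i residual zero)
        ≡⟨ sym (by-class zero) ⟩
      mass residual μ zero ∎
      where
      open ≤-Reasoning
      cell = λ i → Refinement.cell κ i μ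
      by-class : ∀ j → mass residual μ j ≡ ∑ λ i → cell i residual j
      by-class j = trans (sum-cong-≗ pt) (∑-comm λ v i → ((κ v == suc i) ∧ (μ v == j)) ▹ residual v)
        where
        pt : ∀ v → (μ v == j) ▹ residual v ≡ ∑ λ i → ((κ v == suc i) ∧ (μ v == j)) ▹ residual v
        pt v with κ v
        ... | zero  = trans (▹-0 (μ v == j)) (sym (∑-zero {m} λ _ → refl))
        ... | suc k = sym (trans (sum-cong-≗ λ i → ▹-∧ (k == i) (μ v == j) (f v ∸ joins v))
                                 (∑-delta k λ _ → (μ v == j) ▹ (f v ∸ joins v)))

    -- A vertex of S has only chosen links, and the loads lie between `f` and `g`. Elsewhere a link
    -- gives back the unit by which the weight was lowered, so the parity of `f` is restored.
    combined : Factor (restrict G κ) residual residual → Factor G f g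
    combined R = record
      { graph    = H
      ; subgraph = subgraph-H
      ; degrees  = degrees-H
      }
      where
      open Factor R
      H : Graph n
      H = record
        { adj    = λ u v → adj graph u v ∨ (chosen u v ∨ chosen v u)
        ; sym    = λ u v → cong₂ _∨_ (Graph.sym graph u v) (∨-comm (chosen u v) _)
        ; irrefl = λ v → cong₂ _∨_ (irrefl graph v)
                     (cong₂ _∨_ (no-loop v) (no-loop v))
        }
        where
        no-loop : ∀ v → chosen v v ≡ false
        no-loop v = ≢true⇒ λ p → chosen-nonzero p (proj₁ (proj₂ (chosen-elim p)))
      subgraph-H : ∀ u v → adj H u v ≡ true → adj G u v ≡ true
      subgraph-H u v p with ∨-elim {adj graph u v} p
      ... | inj₁ q = proj₁ (restrict-adj G κ u v (subgraph u v q))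
      ... | inj₂ q with ∨-elim {chosen u v} q
      ...   | inj₁ r = proj₁ (chosen-elim r)
      ...   | inj₂ r = trans (Graph.sym G u v) (proj₁ (chosen-elim r))
      load : Fin n → ℕ
      load s = ∑ λ x → chosen x s ▹ 1
      graph-zero : ∀ v → κ v ≡ zero → ∀ u → adj graph v u ≡ false
      graph-zero v κv u = ≢true⇒ λ p → proj₁ (proj₂ (restrict-adj G κ v u (subgraph v u p))) κv
      deg-S : ∀ v → κ v ≡ zero → deg H v ≡ load v
      deg-S v κv = sum-cong-≗ λ u → cong (_▹ 1) (cong₂ _∨_ (graph-zero v κv u)
        (cong (_∨ chosen u v) (≢true⇒ λ p → chosen-nonzero p κv)))
      deg-rest : ∀ v → κ v ≢ zero → deg H v ≡ deg graph v + joins v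
      deg-rest v κv = trans (sum-cong-≗ pt) (∑-distrib-+ (λ u → adj graph v u ▹ 1) _)
        where
        pt : ∀ u → (adj graph v u ∨ (chosen v u ∨ chosen u v)) ▹ 1 ≡ adj graph v u ▹ 1 + chosen v u ▹ 1
        pt u with chosen u v in uv
        ... | true = contradiction (proj₁ (proj₂ (chosen-elim uv))) κv
        ... | false with adj graph v u in gvu | chosen v u in vu
        ...   | true  | true  = contradiction (proj₁ (proj₂ (chosen-elim vu)))
                                  (proj₂ (proj₂ (restrict-adj G κ v u (subgraph v u gvu))))
        ...   | true  | false = refl
        ...   | false | true  = refl
        ...   | false | false = refl
      degrees-H : ∀ v → DegreeAllowed (f v) (g v) (deg H v)
      degrees-H v with κ v Fin.≟ zero
      ... | yes κv = inj₂ (subst (λ d → f v ≤ d × d ≤ g v) (sym (deg-S v κv))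
              ( ≤-trans (≤-reflexive (cong (_▹ f v) (sym (≡⇒== κv)))) (load-≥ v)
              , ≤-trans (load-≤ v) (≤-reflexive (cong (_▹ g v) (≡⇒== κv)))))
      ... | no  κv = inj₁ (subst₂ (λ d a → odd d ≡ odd a × d ≤ a) (sym (deg-rest v κv)) (residual-+ v κv)
              ( odd-+-cong {deg graph v} {residual v} {joins v} (proj₁ (degree-exact (degrees v))) refl
              , +-monoˡ-≤ (joins v) (proj₂ (degree-exact (degrees v)))))

    finish : ((f′ : Fin n → ℕ) → Condition (restrict G κ) f′ f′ → ¬ ¬ Factor (restrict G κ) f′ f′) → ¬ ¬ Factor G f g
    finish rec ¬F = rec residual residual-condition (¬F ∘ combined)

-- Existence of factors

-- Whether a better element exists is settled only under double negation; each improvement consumes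
-- one unit of the distance to `B`.
¬¬-maximum : ∀ {A : Set} (P : A → Set) (μ : A → ℕ) B → (∀ a → P a → μ a ≤ B) → ∀ a → P a →
             ¬ ¬ ∃ λ a → P a × (∀ a′ → P a′ → μ a′ ≤ μ a)
¬¬-maximum P μ B bounded a Pa = climb B a Pa (m≤m+n B (μ a))
  where
  climb : ∀ k a → P a → B ≤ k + μ a → ¬ ¬ ∃ λ a → P a × (∀ a′ → P a′ → μ a′ ≤ μ a)
  climb zero    a Pa B≤ none = none (a , Pa , λ a′ Pa′ → ≤-trans (bounded a′ Pa′) B≤)
  climb (suc k) a Pa B≤ none = ¬¬-excluded-middle λ where
    (no  ¬better) → none (a , Pa , λ a′ Pa′ → ≮⇒≥ λ lt → ¬better (a′ , Pa′ , lt))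
    (yes (a′ , Pa′ , lt)) → climb k a′ Pa′
      (≤-trans B≤ (≤-trans (≤-reflexive (sym (+-suc k (μ a)))) (+-monoʳ-≤ k lt))) none

Colouring : ℕ → Set
Colouring n = Σ ℕ λ m → Fin n → Fin (suc m)

mass-total : ∀ {n m} (f : Fin n → ℕ) (κ : Fin n → Fin (suc m)) → mass f κ zero + ∑ (λ i → mass f κ (suc i)) ≡ ∑ f
mass-total f κ = weight-fibres κ f

#odd≤ : ∀ {n m} (f : Fin n → ℕ) (κ : Fin n → Fin (suc m)) → #odd f κ ≤ ∑ (λ i → mass f κ (suc i))
#odd≤ f κ = ∑-mono λ i → odd≤ (mass f κ (suc i))

potential≤ : ∀ {n m} (f : Fin n → ℕ) (κ : Fin n → Fin (suc m)) → potential f κ ≤ 2 * ∑ f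
potential≤ f κ = arith (mass-total f κ) (∑-mono {f = λ i → 1 ⊓ mass f κ (suc i)} λ i → m⊓n≤n 1 (mass f κ (suc i)))
  where
  arith : ∀ {a b t p} → a + b ≡ t → p ≤ b → 2 * a + p ≤ 2 * t
  arith {a} {b} {p = p} refl h = certify b h (solve (a ∷ b ∷ p ∷ []))

#odd-parity : ∀ {n m} (f : Fin n → ℕ) (κ : Fin n → Fin (suc m)) → odd (#odd f κ + mass f κ zero) ≡ odd (∑ f)
#odd-parity f κ = trans (odd-+-cong {#odd f κ} {∑ λ i → mass f κ (suc i)} {mass f κ zero} (odd-∑ λ i → mass f κ (suc i)) refl)
  (cong odd (trans (+-comm (∑ λ i → mass f κ (suc i)) _) (mass-total f κ)))

pair : ∀ {n} → Fin n → Fin n → Relation n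
pair x y u v = ((u == x) ∧ (v == y)) ∨ ((u == y) ∧ (v == x))

pair-sym : ∀ {n} (x y u v : Fin n) → pair x y u v ≡ pair x y v u
pair-sym x y u v = trans (∨-comm ((u == x) ∧ (v == y)) _) (cong₂ _∨_ (∧-comm (u == y) _) (∧-comm (u == x) _))

pair-elim : ∀ {n} {x y u v : Fin n} → pair x y u v ≡ true → (u ≡ x × v ≡ y) ⊎ (u ≡ y × v ≡ x)
pair-elim {x = x} {y} {u} {v} p with ∨-elim {(u == x) ∧ (v == y)} p
... | inj₁ q = inj₁ (==⇒≡ (proj₁ (∧-elim {u == x} q)) , ==⇒≡ (proj₂ (∧-elim {u == x} q)))
... | inj₂ q = inj₂ (==⇒≡ (proj₁ (∧-elim {u == y} q)) , ==⇒≡ (proj₂ (∧-elim {u == y} q)))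

pair-refl : ∀ {n} (x y : Fin n) → pair x y x y ≡ true
pair-refl x y = ∨-intro (inj₁ (∧-intro (==-refl x) (==-refl y)))

remove : ∀ {n} → Graph n → Fin n → Fin n → Graph n
remove G x y = record
  { adj    = λ u v → adj G u v ∧ not (pair x y u v)
  ; sym    = λ u v → cong₂ (λ a b → a ∧ not b) (Graph.sym G u v) (pair-sym x y u v)
  ; irrefl = λ v → cong (_∧ not (pair x y v v)) (irrefl G v)
  }

remove-⊆ : ∀ {n} (G : Graph n) x y u v → adj (remove G x y) u v ≡ true → adj G u v ≡ true
remove-⊆ G x y u v p = proj₁ (∧-elim p)

remove-cases : ∀ {n} (G : Graph n) x y u v → adj G u v ≡ true →
               ((u ≡ x × v ≡ y) ⊎ (u ≡ y × v ≡ x)) ⊎ adj (remove G x y) u v ≡ true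
remove-cases G x y u v p with pair x y u v in eq
... | true  = inj₁ (pair-elim eq)
... | false = inj₂ (∧-intro p refl)

remove-smaller : ∀ {n} (G : Graph n) x y → adj G x y ≡ true → size (adj (remove G x y)) < size (adj G)
remove-smaller G x y p = size-strict (remove-⊆ G x y) x y p
  (≢true⇒ λ q → true≢false (trans (sym (pair-refl x y)) (not-elim (proj₂ (∧-elim {adj G x y} q)))))

edge-≢ : ∀ {n} (G : Graph n) {x y} → adj G x y ≡ true → x ≢ y
edge-≢ G p refl = true≢false (trans (sym p) (irrefl G _))

Closed : ∀ {n} → Graph n → (Fin n → Bool) → Set
Closed G X = ∀ u v → adj G u v ≡ true → X u ≡ X v

module _ {n} (G : Graph n) (f : Fin n → ℕ) (condition : Condition G f f) where

  -- Colour `X` and its complement with two nonzero colours. S is then empty, so no class may be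
  -- odd.
  closed-even : ∀ X → Closed G X → odd (weight X f) ≡ 0
  closed-even X closed = trans (cong odd (sum-cong-≗ λ v → cong (_▹ f v) (pt (X v))))
    (∑≤0⇒ (λ i → odd (mass f κ (suc i))) (≤-trans (condition κ (λ u v p _ _ → cong side (closed u v p)))
      (≤-reflexive (∑-zero λ v → cong (_▹ f v) (pt₀ (X v))))) zero)
    where
    side : Bool → Fin 3
    side true  = suc zero
    side false = suc (suc zero)
    κ : Fin n → Fin 3
    κ v = side (X v)
    pt : ∀ b → b ≡ (side b == suc zero)
    pt true  = refl
    pt false = refl
    pt₀ : ∀ b → (side b == zero) ≡ false
    pt₀ true  = refl
    pt₀ false = refl

  total-even : odd (∑ f) ≡ 0
  total-even = closed-even (λ _ → true) (λ _ _ _ → refl)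

  -- Putting `x` into S changes no mass, as `f x ≡ 0`, and makes the edge irrelevant.
  remove-zero : ∀ x y → f x ≡ 0 → Condition (remove G x y) f f
  remove-zero x y fx κ proper = subst₂ _≤_ (sum-cong-≗ λ i → cong odd (mass≡ (suc i))) (mass≡ zero)
    (condition κ° proper°)
    where
    κ° : Fin n → Fin _
    κ° v = if v == x then zero else κ v
    mass≡ : ∀ i → mass f κ° i ≡ mass f κ i
    mass≡ i = sum-cong-≗ pt
      where
      pt : ∀ v → (κ° v == i) ▹ f v ≡ (κ v == i) ▹ f v
      pt v with v Fin.≟ x
      ... | yes refl rewrite fx = trans (▹-0 (zero == i)) (sym (▹-0 (κ v == i)))
      ... | no  _ = refl
    proper° : Proper G κ°
    proper° u v Guv κu κv with u Fin.≟ x | v Fin.≟ x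
    ... | yes _   | _       = contradiction refl κu
    ... | no _    | yes _   = contradiction refl κv
    ... | no u≢x  | no v≢x  with remove-cases G x y u v Guv
    ...   | inj₁ (inj₁ (u≡x , _)) = contradiction u≡x u≢x
    ...   | inj₁ (inj₂ (_ , v≡x)) = contradiction v≡x v≢x
    ...   | inj₂ p = proper u v p κu κv

factor-⊆ : ∀ {n} {G H : Graph n} {f g} → (∀ u v → adj H u v ≡ true → adj G u v ≡ true) → Factor H f g → Factor G f g
factor-⊆ H⊆G F = record { graph = graph ; subgraph = λ u v p → H⊆G u v (subgraph u v p) ; degrees = degrees }
  where open Factor F

-- Repairs a colouring that is proper only without the edge `xy`: joining the classes of its two
-- ends makes it proper for the full graph.
module Merge {n m} (κ : Fin n → Fin (suc m)) (a b : Fin m) (a≢b : a ≢ b) where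

  code : Fin (suc m) → Fin (suc m)
  code c = if c == suc b then suc a else c

  merged : Fin n → Fin (suc m)
  merged v = code (κ v)

  code-a : code (suc a) ≡ suc a
  code-a rewrite ≢⇒== a≢b = refl

  code-b : code (suc b) ≡ suc a
  code-b rewrite ==-refl b = refl

  merged-zero : ∀ f → mass f merged zero ≡ mass f κ zero
  merged-zero f = sum-cong-≗ λ v → cong (_▹ f v) (pt (κ v))
    where
    pt : ∀ c → (code c == zero) ≡ (c == zero)
    pt zero = refl
    pt (suc k) with k == b
    ... | true  = refl
    ... | false = refl

  merged-other : ∀ f i → i ≢ a → i ≢ b → mass f merged (suc i) ≡ mass f κ (suc i)
  merged-other f i i≢a i≢b = sum-cong-≗ λ v → cong (_▹ f v) (pt (κ v))
    where
    pt : ∀ c → (code c == suc i) ≡ (c == suc i)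
    pt zero = refl
    pt (suc k) with k Fin.≟ b
    ... | yes refl = trans (≢⇒== (i≢a ∘ sym)) (sym (≢⇒== (i≢b ∘ sym)))
    ... | no  _    = refl

  merged-a : ∀ f → mass f merged (suc a) ≡ mass f κ (suc a) + mass f κ (suc b)
  merged-a f = trans (sum-cong-≗ λ v → pt (κ v) (f v)) (∑-distrib-+ (λ v → (κ v == suc a) ▹ f v) _)
    where
    pt : ∀ c x → (code c == suc a) ▹ x ≡ (c == suc a) ▹ x + (c == suc b) ▹ x
    pt zero    x = refl
    pt (suc k) x with k Fin.≟ b
    ... | yes refl rewrite ==-refl a | ≢⇒== (a≢b ∘ sym) = refl
    ... | no  _    = sym (+-identityʳ _)

  #odd≤merged : ∀ f g → (∀ i → i ≢ a → i ≢ b → mass g κ (suc i) ≡ mass f κ (suc i)) → #odd g κ ≤ #odd f merged + 2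
  #odd≤merged f g same = begin
    #odd g κ                                                               ≤⟨ ∑-mono pt ⟩
    ∑ (λ i → odd (mass f merged (suc i)) + ((i == a) ▹ 1 + (i == b) ▹ 1))  ≡⟨ ∑-distrib-+ (λ i → odd (mass f merged (suc i))) _ ⟩
    #odd f merged + ∑ (λ i → (i == a) ▹ 1 + (i == b) ▹ 1)
      ≡⟨ cong (#odd f merged +_) (trans (∑-distrib-+ (λ i → (i == a) ▹ 1) _) (cong₂ _+_ (∑-delta′ a λ _ → 1) (∑-delta′ b λ _ → 1))) ⟩
    #odd f merged + 2                                                      ∎
    where
    open ≤-Reasoning
    pt : ∀ i → odd (mass g κ (suc i)) ≤ odd (mass f merged (suc i)) + ((i == a) ▹ 1 + (i == b) ▹ 1)
    pt i with i Fin.≟ a | i Fin.≟ b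
    ... | yes _ | _     = ≤-trans (odd≤1 (mass g κ (suc i))) (≤-trans (m≤m+n 1 _) (m≤n+m _ (odd (mass f merged (suc i)))))
    ... | no _  | yes _ = ≤-trans (odd≤1 (mass g κ (suc i))) (m≤n+m _ (odd (mass f merged (suc i))))
    ... | no p  | no q  = ≤-trans (≤-reflexive (cong odd (trans (same i p q) (sym (merged-other f i p q))))) (m≤m+n _ 0)

module EdgeStep {n} (G : Graph n) (f : Fin n → ℕ) (condition : Condition G f f)
  (f>0 : ∀ u v → adj G u v ≡ true → 0 < f u)
  (slack : ∀ {m} (κ : Fin n → Fin (suc m)) → Proper G κ → 0 < mass f κ zero → 2 + #odd f κ ≤ mass f κ zero)
  (x y : Fin n) (Gxy : adj G x y ≡ true) where

  G⁻ : Graph n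
  G⁻ = remove G x y

  x≢y : x ≢ y
  x≢y = edge-≢ G Gxy

  Splits : ∀ {m} → (Fin n → Fin (suc m)) → Set
  Splits {m} κ = ∃₂ λ (a b : Fin m) → κ x ≡ suc a × κ y ≡ suc b × a ≢ b

  agrees : ∀ {m} (κ : Fin n → Fin (suc m)) → Proper G⁻ κ →
           (κ x ≢ zero → κ y ≢ zero → κ x ≡ κ y) → Proper G κ
  agrees κ proper xy u v Guv κu κv with remove-cases G x y u v Guv
  ... | inj₁ (inj₁ (refl , refl)) = xy κu κv
  ... | inj₁ (inj₂ (refl , refl)) = sym (xy κv κu)
  ... | inj₂ p = proper u v p κu κv

  splits? : ∀ {m} (κ : Fin n → Fin (suc m)) → Proper G⁻ κ → Proper G κ ⊎ Splits κ
  splits? κ proper with κ x in κx | κ y in κy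
  ... | zero  | _    = inj₁ (agrees κ proper λ p → contradiction κx p)
  ... | suc a | zero = inj₁ (agrees κ proper λ _ p → contradiction κy p)
  ... | suc a | suc b with a Fin.≟ b
  ...   | yes refl = inj₁ (agrees κ proper λ _ _ → trans κx (sym κy))
  ...   | no  a≢b  = inj₂ (a , b , refl , refl , a≢b)

  module Split {m} (κ : Fin n → Fin (suc m)) (proper : Proper G⁻ κ)
               (a b : Fin m) (κx : κ x ≡ suc a) (κy : κ y ≡ suc b) (a≢b : a ≢ b) where
    open Merge κ a b a≢b public

    merged-proper : Proper G merged
    merged-proper = agrees merged
      (λ u v p κu κv → cong code (proper u v p (λ q → κu (cong code q)) (λ q → κv (cong code q))))
      (λ _ _ → trans (cong code κx) (trans code-a (trans (sym code-b) (cong code (sym κy)))))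

    -- Merging can hide at most two odd classes, which is exactly the slack.
    slack-positive : ∀ g → (∀ i → i ≢ a → i ≢ b → mass g κ (suc i) ≡ mass f κ (suc i)) →
                     0 < mass f κ zero → #odd g κ ≤ mass f κ zero
    slack-positive g same pos = begin
      #odd g κ            ≤⟨ #odd≤merged f g same ⟩
      #odd f merged + 2   ≡⟨ +-comm (#odd f merged) 2 ⟩
      2 + #odd f merged   ≤⟨ slack merged merged-proper (subst (0 <_) (sym (merged-zero f)) pos) ⟩
      mass f merged zero  ≡⟨ merged-zero f ⟩
      mass f κ zero       ∎
      where open ≤-Reasoning

    module _ (S≡0 : mass f κ zero ≡ 0) where

      merged-even : ∀ i → odd (mass f merged (suc i)) ≡ 0
      merged-even = ∑≤0⇒ (λ i → odd (mass f merged (suc i)))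
        (≤-trans (condition merged merged-proper) (≤-reflexive (trans (merged-zero f) S≡0)))

      -- When f(S) = 0 the vertices of S have weight 0, and by `f>0` no edge meets them; all edges
      -- then stay within a class.
      class-closed : Closed G⁻ (λ v → κ v == suc a)
      class-closed u v p = cong (_== suc a) (proper u v p (nonzero u v (remove-⊆ G x y u v p))
        (nonzero v u (trans (Graph.sym G v u) (remove-⊆ G x y u v p))))
        where
        nonzero : ∀ u v → adj G u v ≡ true → κ u ≢ zero
        nonzero u v Guv κu = contradiction (f>0 u v Guv) (≤⇒≯ (≤-trans
          (≤-reflexive (sym (cong (_▹ f u) (≡⇒== κu))))
          (≤-trans (∑-term (λ w → (κ w == zero) ▹ f w) u) (≤-reflexive S≡0))))

      sum-even : odd (mass f κ (suc a) + mass f κ (suc b)) ≡ 0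
      sum-even = trans (cong odd (sym (merged-a f))) (merged-even a)

  -- Deleting xy fails only if such an X exists, and then xy can be put into the factor.
  Separates : (Fin n → Bool) → Set
  Separates X = Closed G⁻ X × X x ≡ true × X y ≡ false × odd (weight X f) ≡ 1

  -- For f(S) = 0 the merged class is even, so its two parts have the same parity; if both were odd,
  -- the part of `x` would separate.
  delete-condition : ¬ ∃ Separates → Condition G⁻ f f
  delete-condition ¬sep κ proper with splits? κ proper
  ... | inj₁ proper′ = condition κ proper′
  ... | inj₂ (a , b , κx , κy , a≢b) = case (mass f κ zero) refl
    where
    open Split κ proper a b κx κy a≢b
    case : ∀ s → mass f κ zero ≡ s → #odd f κ ≤ mass f κ zero
    case (suc s) eq = slack-positive f (λ _ _ _ → refl) (subst (0 <_) (sym eq) (s≤s z≤n))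
    case zero    eq = ≤-trans (≤-reflexive (∑-zero even)) z≤n
      where
      even-a : odd (mass f κ (suc a)) ≡ 0
      even-a with odd (mass f κ (suc a)) in o | odd≤1 (mass f κ (suc a))
      ... | 0 | _ = refl
      ... | 1 | _ = contradiction ((λ v → κ v == suc a) , class-closed eq , ≡⇒== κx
                      , ≢⇒== (λ p → a≢b (Fin.suc-injective (trans (sym p) κy))) , o) ¬sep
      ... | suc (suc _) | s≤s ()
      even : ∀ i → odd (mass f κ (suc i)) ≡ 0
      even i with i Fin.≟ a | i Fin.≟ b
      ... | yes refl | _        = even-a
      ... | no _     | yes refl = trans (sym (odd-+-cong {mass f κ (suc a)} {0} {mass f κ (suc b)} {mass f κ (suc b)} even-a refl)) (sum-even eq)
      ... | no p     | no q     = trans (cong odd (sym (merged-other f i p q))) (merged-even eq i)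

  taken : Fin n → ℕ
  taken v = (v == x) ▹ 1 + (v == y) ▹ 1

  reduced : Fin n → ℕ
  reduced v = f v ∸ taken v

  reduced-+ : ∀ v → reduced v + taken v ≡ f v
  reduced-+ v = m∸n+n≡m (taken≤f v)
    where
    taken≤f : ∀ v → taken v ≤ f v
    taken≤f v with v Fin.≟ x | v Fin.≟ y
    ... | yes refl | yes refl = contradiction refl x≢y
    ... | yes refl | no _     = f>0 x y Gxy
    ... | no _     | yes refl = f>0 y x (trans (Graph.sym G y x) Gxy)
    ... | no _     | no _     = z≤n

  mass-taken : ∀ {k} (κ : Fin n → Fin k) c → mass f κ c ≡ mass reduced κ c + ((κ x == c) ▹ 1 + (κ y == c) ▹ 1)
  mass-taken κ c = trans (sum-cong-≗ λ v → trans (cong ((κ v == c) ▹_) (sym (reduced-+ v))) (▹-distrib-+ (κ v == c) _ _))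
    (trans (∑-distrib-+ (λ v → (κ v == c) ▹ reduced v) _)
      (cong (mass reduced κ c +_) (trans (sum-cong-≗ λ v → trans (▹-distrib-+ (κ v == c) _ _)
                                                       (cong₂ _+_ (swap (κ v == c) (v == x)) (swap (κ v == c) (v == y))))
        (trans (∑-distrib-+ (λ v → (v == x) ▹ ((κ v == c) ▹ 1)) _)
               (cong₂ _+_ (∑-delta′ x λ v → (κ v == c) ▹ 1) (∑-delta′ y λ v → (κ v == c) ▹ 1))))))
    where
    swap : ∀ p q → p ▹ (q ▹ 1) ≡ q ▹ (p ▹ 1)
    swap true  q = refl
    swap false q = sym (▹-0 q)

  weight-xor : ∀ (X Y : Fin n → Bool) → odd (weight (λ v → X v xor Y v) f) ≡ odd (weight X f + weight Y f)
  weight-xor X Y = trans (sym (odd-cancel (weight (λ v → X v xor Y v) f) A)) (cong odd (begin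
    weight (λ v → X v xor Y v) f + A + A
      ≡⟨ cong (_+ A) (sym (∑-distrib-+ (λ v → (X v xor Y v) ▹ f v) _)) ⟩
    ∑ (λ v → (X v xor Y v) ▹ f v + (X v ∧ Y v) ▹ f v) + A
      ≡⟨ cong (_+ A) (sum-cong-≗ λ v → pt (X v) (Y v) (f v)) ⟩
    weight (λ v → X v ∨ Y v) f + A
      ≡⟨ sym (weight-∨∧ X Y f) ⟩
    weight X f + weight Y f ∎))
    where
    open ≡.≡-Reasoning
    A = weight (λ v → X v ∧ Y v) f
    pt : ∀ p q w → (p xor q) ▹ w + (p ∧ q) ▹ w ≡ (p ∨ q) ▹ w
    pt true  true  w = refl
    pt true  false w = +-identityʳ w
    pt false q     w = +-identityʳ _

  module _ (X : Fin n → Bool) (separates : Separates X) where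

    -- For a colouring proper in `G` the slack pays if `xy` meets S, and otherwise one class loses
    -- two units. For ends in different classes the slack pays again if f(S) > 0; if f(S) = 0, the
    -- set `X` shows both classes to be odd, and lowering makes them even.
    take-condition : Condition G⁻ reduced reduced
    take-condition κ proper with splits? κ proper
    ... | inj₂ (a , b , κx , κy , a≢b) = subst (#odd reduced κ ≤_) same-zero (case (mass f κ zero) refl)
      where
      open Split κ proper a b κx κy a≢b
      taken-at : ∀ c {d e} → (κ x == c) ≡ d → (κ y == c) ≡ e → mass f κ c ≡ mass reduced κ c + (d ▹ 1 + e ▹ 1)
      taken-at c refl refl = mass-taken κ c
      same-zero : mass f κ zero ≡ mass reduced κ zero
      same-zero = trans (taken-at zero (cong (_== zero) κx) (cong (_== zero) κy)) (+-identityʳ _)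
      same : ∀ i → i ≢ a → i ≢ b → mass reduced κ (suc i) ≡ mass f κ (suc i)
      same i p q = sym (trans (taken-at (suc i) (trans (cong (_== suc i) κx) (≢⇒== (p ∘ sym)))
                                        (trans (cong (_== suc i) κy) (≢⇒== (q ∘ sym)))) (+-identityʳ _))
      case : ∀ s → mass f κ zero ≡ s → #odd reduced κ ≤ mass f κ zero
      case (suc s) eq = slack-positive reduced same (subst (0 <_) (sym eq) (s≤s z≤n))
      case zero    eq = ≤-trans (≤-reflexive (∑-zero even)) z≤n
        where
        -- Both `x` and `y` lie outside `Z`, so `Z` is closed even in `G` and has even weight. As
        -- `X` is odd, class `a` is odd as well.
        Z : Fin n → Bool
        Z v = X v xor (κ v == suc a)
        Z-closed : Closed G Z
        Z-closed u v Guv with remove-cases G x y u v Guv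
        ... | inj₂ p = cong₂ _xor_ (proj₁ separates u v p) (class-closed eq u v p)
        ... | inj₁ q = same-side q
          where
          Zx : Z x ≡ false
          Zx = cong₂ _xor_ (proj₁ (proj₂ separates)) (≡⇒== κx)
          Zy : Z y ≡ false
          Zy = cong₂ _xor_ (proj₁ (proj₂ (proj₂ separates))) (≢⇒== (λ p → a≢b (Fin.suc-injective (trans (sym p) κy))))
          same-side : (u ≡ x × v ≡ y) ⊎ (u ≡ y × v ≡ x) → Z u ≡ Z v
          same-side (inj₁ (refl , refl)) = trans Zx (sym Zy)
          same-side (inj₂ (refl , refl)) = trans Zy (sym Zx)
        odd-a : odd (mass f κ (suc a)) ≡ 1
        odd-a = odd-flip (weight X f) (mass f κ (suc a))
          (trans (sym (weight-xor X (λ v → κ v == suc a))) (closed-even G f condition Z Z-closed))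
          (proj₂ (proj₂ (proj₂ separates)))
        even : ∀ i → odd (mass reduced κ (suc i)) ≡ 0
        even i with i Fin.≟ a | i Fin.≟ b
        ... | no p     | no q     = trans (cong odd (trans (same i p q) (sym (merged-other f i p q)))) (merged-even eq i)
        ... | yes refl | _        = odd-pred (taken-at (suc a) (trans (cong (_== suc a) κx) (==-refl a))
                                      (trans (cong (_== suc a) κy) (≢⇒== (a≢b ∘ sym)))) odd-a
        ... | no _     | yes refl = odd-pred (taken-at (suc b) (trans (cong (_== suc b) κx) (≢⇒== a≢b))
                                      (trans (cong (_== suc b) κy) (==-refl b)))
                                      (odd-flip (mass f κ (suc a)) (mass f κ (suc b)) (sum-even eq) odd-a)
    ... | inj₁ proper′ = case (κ x Fin.≟ zero) (κ y Fin.≟ zero)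
      where
      at : Fin n → Fin _ → ℕ
      at v c = (κ v == c) ▹ 1
      -- Each end of `xy` either takes one unit from S or flips one class; the slack of two covers
      -- both ends.
      touched : 0 < mass f κ zero → #odd reduced κ ≤ mass reduced κ zero
      touched pos = arith {α = at x zero} {∑ λ i → at x (suc i)} {at y zero} {∑ λ i → at y (suc i)} (slack κ proper′ pos) bound (mass-taken κ zero) (∑-delta (κ x) λ _ → 1) (∑-delta (κ y) λ _ → 1)
        where
        bound : #odd reduced κ ≤ #odd f κ + (∑ (λ i → at x (suc i)) + ∑ (λ i → at y (suc i)))
        bound = ≤-trans (∑-mono pt) (≤-reflexive (trans (∑-distrib-+ (λ i → odd (mass f κ (suc i))) _)
                                                       (cong (#odd f κ +_) (∑-distrib-+ (λ i → at x (suc i)) _))))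
          where
          pt : ∀ i → odd (mass reduced κ (suc i)) ≤ odd (mass f κ (suc i)) + (at x (suc i) + at y (suc i))
          pt i = ≤-trans (≤-reflexive (trans (sym (odd-cancel (mass reduced κ (suc i)) t))
                                             (cong (λ z → odd (z + t)) (sym (mass-taken κ (suc i))))))
                         (≤-trans (odd-subadd (mass f κ (suc i)) t) (+-monoʳ-≤ _ (odd≤ t)))
            where t = at x (suc i) + at y (suc i)
        arith : ∀ {q q′ s s′ α α′ β β′} → 2 + q ≤ s → q′ ≤ q + (α′ + β′) → s ≡ s′ + (α + β) →
                α + α′ ≡ 1 → β + β′ ≡ 1 → q′ ≤ s′
        arith {q} {q′} {s} {s′} {α} {α′} {β} {β′} h₁ h₂ h₃ h₄ h₅ =
          certify 0 (+-mono-≤ h₁ (+-mono-≤ h₂ (+-mono-≤ (≤-reflexive h₃) (+-mono-≤ (≤-reflexive h₄) (≤-reflexive h₅)))))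
            (solve (q ∷ q′ ∷ s ∷ s′ ∷ α ∷ α′ ∷ β ∷ β′ ∷ []))
      positive : ∀ v → 0 < f v → κ v ≡ zero → 0 < mass f κ zero
      positive v fv κv = ≤-trans fv (≤-trans (≤-reflexive (sym (cong (_▹ f v) (≡⇒== κv))))
                                              (∑-term (λ w → (κ w == zero) ▹ f w) v))
      case : Dec (κ x ≡ zero) → Dec (κ y ≡ zero) → #odd reduced κ ≤ mass reduced κ zero
      case (yes κx) _        = touched (positive x (f>0 x y Gxy) κx)
      case (no _)   (yes κy) = touched (positive y (f>0 y x (trans (Graph.sym G y x) Gxy)) κy)
      case (no κx)  (no κy)  = subst₂ _≤_ (sum-cong-≗ λ i → sym (same (suc i)))
          (trans (mass-taken κ zero) (trans (cong (mass reduced κ zero +_)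
            (cong₂ (λ p q → p ▹ 1 + q ▹ 1) (≢⇒== κx) (≢⇒== κy))) (+-identityʳ _)))
          (condition κ proper′)
        where
        -- Properness puts `x` and `y` into one class, so a class loses two units or none.
        same : ∀ c → odd (mass reduced κ c) ≡ odd (mass f κ c)
        same c = trans (sym (odd-cancel (mass reduced κ c) (at y c))) (cong odd (trans (+-assoc (mass reduced κ c) (at y c) (at y c))
          (trans (cong (λ z → mass reduced κ c + (((z == c) ▹ 1) + at y c)) (sym (proper′ x y Gxy κx κy)))
                 (sym (mass-taken κ c)))))

  take : Factor G⁻ reduced reduced → Factor G f f
  take F = record { graph = H ; subgraph = subgraph-H ; degrees = degrees-H }
    where
    open Factor F
    H : Graph n
    H = record
      { adj    = λ u v → adj graph u v ∨ pair x y u v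
      ; sym    = λ u v → cong₂ _∨_ (Graph.sym graph u v) (pair-sym x y u v)
      ; irrefl = λ v → cong₂ _∨_ (irrefl graph v) (≢true⇒ λ p → no-loop (pair-elim {x = x} {y} {v} {v} p))
      }
      where
      no-loop : ∀ {v} → ¬ ((v ≡ x × v ≡ y) ⊎ (v ≡ y × v ≡ x))
      no-loop (inj₁ (p , q)) = x≢y (trans (sym p) q)
      no-loop (inj₂ (p , q)) = x≢y (trans (sym q) p)
    subgraph-H : ∀ u v → adj H u v ≡ true → adj G u v ≡ true
    subgraph-H u v p with ∨-elim {adj graph u v} p
    ... | inj₁ q = remove-⊆ G x y u v (subgraph u v q)
    ... | inj₂ q with pair-elim {x = x} {y} {u} {v} q
    ...   | inj₁ (refl , refl) = Gxy
    ...   | inj₂ (refl , refl) = trans (Graph.sym G y x) Gxy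
    deg-H : ∀ v → deg H v ≡ deg graph v + taken v
    deg-H v = trans (sum-cong-≗ pt) (trans (∑-distrib-+ (λ u → adj graph v u ▹ 1) _) (cong (deg graph v +_)
      (trans (sum-cong-≗ λ u → trans (or (v == x) (v == y) (u == y) (u == x) (λ p q → x≢y (trans (sym (==⇒≡ {i = v} p)) (==⇒≡ {i = v} q))))
                                     (cong₂ _+_ (▹-∧ (v == x) (u == y) 1) (▹-∧ (v == y) (u == x) 1)))
        (trans (∑-distrib-+ (λ u → (v == x) ▹ ((u == y) ▹ 1)) _)
               (cong₂ _+_ (trans (sym (▹-∑ (v == x) λ u → (u == y) ▹ 1)) (cong ((v == x) ▹_) (∑-delta′ y λ _ → 1)))
                          (trans (sym (▹-∑ (v == y) λ u → (u == x) ▹ 1)) (cong ((v == y) ▹_) (∑-delta′ x λ _ → 1))))))))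
      where
      or : ∀ p q r s → (p ≡ true → q ≡ true → ⊥) → ((p ∧ r) ∨ (q ∧ s)) ▹ 1 ≡ (p ∧ r) ▹ 1 + (q ∧ s) ▹ 1
      or true  true  r s ⊥ = ⊥-elim (⊥ refl refl)
      or true  false true  s _ = refl
      or true  false false s _ = refl
      or false q     r s _ = refl
      pt : ∀ u → (adj graph v u ∨ pair x y v u) ▹ 1 ≡ adj graph v u ▹ 1 + pair x y v u ▹ 1
      pt u with adj graph v u in p
      ... | false = refl
      ... | true  = sym (cong (λ b → 1 + b ▹ 1) (not-elim (proj₂ (∧-elim {adj G v u} (subgraph v u p)))))
    degrees-H : ∀ v → DegreeAllowed (f v) (f v) (deg H v)
    degrees-H v = inj₁ (subst₂ (λ d a → odd d ≡ odd a × d ≤ a) (sym (deg-H v)) (reduced-+ v)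
      ( odd-+-cong {deg graph v} {reduced v} {taken v} (proj₁ (degree-exact (degrees v))) refl
      , +-monoˡ-≤ (taken v) (proj₂ (degree-exact (degrees v)))))

-- Edges at vertices of weight 0 are discarded before anything else. Afterwards every vertex on an
-- edge can spare a unit, as `joins≤f` and `reduced-+` demand.
parity-factor : ∀ {n} N (G : Graph n) → size (adj G) ≤ N → ∀ f → Condition G f f → ¬ ¬ Factor G f f
parity-factor {n} N G size≤N f condition ¬F = ¬¬-excluded-middle {A = ∃₂ λ x y → adj G x y ≡ true × f x ≡ 0} λ where
    (yes (x , y , Gxy , fx)) → smaller N size≤N (remove G x y) (remove-smaller G x y Gxy) f
      (remove-zero G f condition x y fx) (¬F ∘ factor-⊆ (remove-⊆ G x y))
    (no ¬zero) → nonzero λ u v Guv → n≢0⇒n>0 λ fu → ¬zero (u , v , Guv , fu)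
  where
  smaller : ∀ N → size (adj G) ≤ N → ∀ H → size (adj H) < size (adj G) → ∀ f → Condition H f f → ¬ ¬ Factor H f f
  smaller zero    size≤N H lt with () ← ≤-trans lt size≤N
  smaller (suc N) size≤N H lt = parity-factor N H (s≤s⁻¹ (≤-trans lt size≤N))

  Tight : Colouring n → Set
  Tight (m , κ) = Proper G κ × mass f κ zero ≤ #odd f κ × 0 < mass f κ zero

  nonzero : (∀ u v → adj G u v ≡ true → 0 < f u) → ⊥
  nonzero f>0 = ¬¬-excluded-middle {A = ∃ Tight} λ where
      (yes (a , tight)) → ¬¬-maximum Tight (λ (_ , κ) → potential f κ) (2 * ∑ f) (λ (_ , κ) _ → potential≤ f κ) a tight
        λ { ((m , κ) , (proper , tight , pos) , best) → barrier κ proper tight pos λ κ′ p q r → best (_ , κ′) (p , q , r) }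
      (no ¬tight) → loose λ κ proper pos → even-gap
        (trans (#odd-parity f κ) (total-even G f condition)) (≰⇒> λ le → ¬tight ((_ , κ) , proper , le , pos))
    where
    barrier : ∀ {m} (κ : Fin n → Fin (suc m)) → Proper G κ → mass f κ zero ≤ #odd f κ → 0 < mass f κ zero →
              (∀ {m′} (κ′ : Fin n → Fin (suc m′)) → Proper G κ′ → mass f κ′ zero ≤ #odd f κ′ → 0 < mass f κ′ zero →
                potential f κ′ ≤ potential f κ) → ⊥
    barrier κ proper tight pos best = assigned λ a → Finish.finish a
        (smaller N size≤N (restrict G κ) (restrict-smaller a)) ¬F
      where
      open Step G f f (λ _ → ≤-refl) κ proper condition f>0
        (λ κ′ proper′ → ≤-trans (+-mono-≤ (condition κ′ proper′) tight) (≤-reflexive (+-comm (mass f κ′ zero) _)))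
        (λ κ′ proper′ p q → best κ′ proper′
          (+-cancelʳ-≤ (mass f κ zero) _ _ (≤-trans (≤-reflexive (+-comm (mass f κ′ zero) _)) (≤-trans (+-monoˡ-≤ _ tight) p)))
          (≤-trans pos q))
      -- Positivity in `Tight` ensures the decrease: a vertex of S with positive weight receives a
      -- chosen edge, and deleting S destroys it.
      restrict-smaller : Assignment.Assigned κ oddity lower upper lower≤upper links → size (adj (restrict G κ)) < size (adj G)
      restrict-smaller a with ∑-positive (λ v → (κ v == zero) ▹ f v) pos
      ... | s , p with ∑-positive (λ x → Assignment.Assigned.chosen a x s ▹ 1) (≤-trans p (Assignment.Assigned.load-≥ a s))
      ...   | x , q with Assignment.Assigned.chosen a x s in eq
      ...     | true with Gxs , κs , _ ← Finish.chosen-elim a eq =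
        size-strict (λ u v r → proj₁ (restrict-adj G κ u v r)) x s Gxs
          (≢true⇒ λ r → proj₂ (proj₂ (restrict-adj G κ x s r)) κs)

    loose : (∀ {m} (κ : Fin n → Fin (suc m)) → Proper G κ → 0 < mass f κ zero → 2 + #odd f κ ≤ mass f κ zero) → ⊥
    loose slack = ¬¬-excluded-middle λ where
        (no ¬edge) → ¬F (edgeless λ u v → ≢true⇒ λ p → ¬edge (u , v , p))
        (yes (x , y , Gxy)) → edge x y Gxy
      where
      edgeless : (∀ u v → adj G u v ≡ false) → Factor G f f
      edgeless none = record
        { graph    = G
        ; subgraph = λ _ _ p → p
        ; degrees  = λ v → inj₁ (subst (λ d → odd d ≡ odd (f v) × d ≤ f v) (sym (no-degree v)) (sym (f-even v) , z≤n))
        }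
        where
        no-degree : ∀ v → deg G v ≡ 0
        no-degree v = ∑-zero λ u → cong (_▹ 1) (none v u)
        f-even : ∀ v → odd (f v) ≡ 0
        -- Without edges each vertex may form a class of its own, with S empty; hence every weight
        -- is even and the empty factor will do.
        f-even v = trans (cong odd (sym (∑-delta′ v f))) (∑≤0⇒ (λ i → odd (mass f suc (suc i)))
          (≤-trans (condition suc λ u v p → contradiction (trans (sym p) (none u v)) true≢false)
                   (≤-reflexive (∑-zero {n} λ _ → refl))) v)
      edge : ∀ x y → adj G x y ≡ true → ⊥
      edge x y Gxy = ¬¬-excluded-middle {A = ∃ Separates} λ where
          (yes (X , separates)) → smaller N size≤N G⁻ (remove-smaller G x y Gxy) reduced (take-condition X separates) (¬F ∘ take)
          (no ¬separates) → smaller N size≤N G⁻ (remove-smaller G x y Gxy) f (delete-condition ¬separates)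
            (¬F ∘ factor-⊆ (remove-⊆ G x y))
        where open EdgeStep G f condition f>0 slack x y Gxy

-- Maximising the excess #odd − f(S), which may be positive here, gives a barrier for which
-- all vertices of S end up with degrees between f and g.
bounded-factor : ∀ {n} (G : Graph n) (f g : Fin n → ℕ) → (∀ v → f v ≤ g v) → (∀ v → 0 < f v) →
                 Condition G f g → ¬ ¬ Factor G f g
bounded-factor {n} G f g f≤g f>0 condition ¬F =
  ¬¬-maximum (λ (_ , κ) → Proper G κ) (λ (_ , κ) → excess κ) (∑ f + ∑ f) (λ (_ , κ) _ → excess≤ κ)
    (0 , λ _ → zero) (λ _ _ _ _ _ → refl) λ { ((m₁ , κ₁) , proper₁ , best₁) →
  ¬¬-maximum (λ (_ , κ) → Proper G κ × excess κ₁ ≤ excess κ) (λ (_ , κ) → potential f κ) (2 * ∑ f)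
    (λ (_ , κ) _ → potential≤ f κ) (m₁ , κ₁) (proper₁ , ≤-refl) λ { ((m , κ) , (proper , κ₁≤κ) , best) →
  let open Step G f g f≤g κ proper condition (λ u _ _ → f>0 u)
        (λ {m′} κ′ proper′ → excess⇒ κ′ κ (≤-trans (best₁ (m′ , κ′) proper′) κ₁≤κ))
        (λ {m′} κ′ proper′ p _ → best (m′ , κ′) (proper′ , ≤-trans κ₁≤κ (⇒excess κ κ′ p)))
  in assigned λ a → Finish.finish a (λ f′ c → parity-factor (size (adj (restrict G κ))) (restrict G κ) ≤-refl f′ c) ¬F } }
  where
  -- `rest` is ∑ f - f(S), so `excess` is #odd - f(S) shifted by the constant ∑ f to stay in ℕ.
  rest excess : ∀ {m} → (Fin n → Fin (suc m)) → ℕ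
  rest κ = ∑ λ i → mass f κ (suc i)
  excess κ = #odd f κ + rest κ
  excess≤ : ∀ {m} (κ : Fin n → Fin (suc m)) → excess κ ≤ ∑ f + ∑ f
  excess≤ κ = +-mono-≤ (≤-trans (#odd≤ f κ) rest≤) rest≤
    where
    rest≤ : rest κ ≤ ∑ f
    rest≤ = ≤-trans (m≤n+m (rest κ) (mass f κ zero)) (≤-reflexive (mass-total f κ))
  excess⇒ : ∀ {m m′} (κ : Fin n → Fin (suc m)) (κ′ : Fin n → Fin (suc m′)) → excess κ ≤ excess κ′ →
            #odd f κ + mass f κ′ zero ≤ #odd f κ′ + mass f κ zero
  excess⇒ κ κ′ p = arith (#odd f κ) (rest κ) (mass f κ zero) (#odd f κ′) (rest κ′) (mass f κ′ zero) p
    (trans (mass-total f κ) (sym (mass-total f κ′)))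
    where
    arith : ∀ q r s q′ r′ s′ → q + r ≤ q′ + r′ → s + r ≡ s′ + r′ → q + s′ ≤ q′ + s
    arith q r s q′ r′ s′ h e = certify 0 (+-mono-≤ h (≤-reflexive (sym e))) (solve (q ∷ r ∷ s ∷ q′ ∷ r′ ∷ s′ ∷ []))
  ⇒excess : ∀ {m m′} (κ : Fin n → Fin (suc m)) (κ′ : Fin n → Fin (suc m′)) →
            #odd f κ + mass f κ′ zero ≤ #odd f κ′ + mass f κ zero → excess κ ≤ excess κ′
  ⇒excess κ κ′ p = arith (#odd f κ) (rest κ) (mass f κ zero) (#odd f κ′) (rest κ′) (mass f κ′ zero) p
    (trans (mass-total f κ) (sym (mass-total f κ′)))
    where
    arith : ∀ q r s q′ r′ s′ → q + s′ ≤ q′ + s → s + r ≡ s′ + r′ → q + r ≤ q′ + r′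
    arith q r s q′ r′ s′ h e = certify 0 (+-mono-≤ h (≤-reflexive e)) (solve (q ∷ r ∷ s ∷ q′ ∷ r′ ∷ s′ ∷ []))

-- Class sizes and edge counts

-- Twice the number of edges plus the order of K_δ ∨ (K_M ∪ bδ K₁).
extremalSize : (b δ M : ℕ) → ℕ
extremalSize b δ M = δ * δ + M * M + b * δ + 2 * δ * (M + b * δ)

-- An upper bound for twice the number of edges plus the order when S has s vertices and the
-- other classes have sizes at least t, with M left over for the largest one.
classBound : (b s t M : ℕ) → ℕ
classBound b s t M = s * (s + (M + b * s * t)) + s * (M + b * s * t) + (M * M + b * s * (t * t))

m≤m*m : ∀ m → m ≤ m * m
m≤m*m zero    = z≤n
m≤m*m (suc m) = m≤m*n (suc m) (suc m)

-- The two terms of threshold with the denominators cleared; in the first, b = suc b′.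
FirstBound : (b′ δ n : ℕ) → Set
FirstBound b′ δ n = (suc b′ * suc b′ + 2 * suc b′) * δ ≤ b′ * n + δ + 1

SecondBound : (b δ n : ℕ) → Set
SecondBound b δ n = b * b * (δ * δ) + (4 * (b * b) + 5 * b) * δ + b * b + 4 * b + 1 ≤ 6 * b * n

module _ (b′ δ r′ M′ : ℕ) where
  private
    b r s M n X : ℕ
    b = suc b′
    r = suc r′
    s = δ + r
    M = suc M′
    n = s + (M + b * s * 1)
    X = (b + 2) * (2 * δ + r)

    -- Write `2bn = (b − 1)n + (b + 1)n`. The first bound for one part and `n = (b + 1)s + M` for
    -- the other give `2bn − bX ≥ r + (b + 1)M − 1`, which exceeds `b`.
    X+2≤2n : FirstBound b′ δ n → 2 + X ≤ 2 * n
    X+2≤2n T₁ = ≰⇒> λ 2n≤ → 1+n≰n {0} (certify ((b + 1) * M′ + r′) (+-mono-≤ T₁ (*-monoʳ-≤ b 2n≤)) (identity b′ δ r′ M′))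
      where
      identity : ∀ b′ δ r′ M′ →
        1 + (b′ * (δ + suc r′ + (suc M′ + suc b′ * (δ + suc r′) * 1)) + δ + 1 + suc b′ * (1 + (suc b′ + 2) * (2 * δ + suc r′)))
          + ((suc b′ + 1) * M′ + r′) ≡
        0 + ((suc b′ * suc b′ + 2 * suc b′) * δ + suc b′ * (2 * (δ + suc r′ + (suc M′ + suc b′ * (δ + suc r′) * 1))))
      identity b′ δ r′ M′ = solve (b′ ∷ δ ∷ r′ ∷ M′ ∷ [])

  -- The right side minus `classBound` is `b r (2n − 1 − X)`.
  classBound-> : FirstBound b′ δ n → classBound b s 1 M < extremalSize b δ ((b + 1) * r + M)
  classBound-> T₁ = certify (b′ + r′ + b′ * r′) (*-monoʳ-≤ (b * r) (X+2≤2n T₁)) (identity b′ δ r′ M′)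
    where
    identity : ∀ b′ δ r′ M′ →
      suc ((δ + suc r′) * (δ + suc r′ + (suc M′ + suc b′ * (δ + suc r′) * 1)) + (δ + suc r′) * (suc M′ + suc b′ * (δ + suc r′) * 1)
             + (suc M′ * suc M′ + suc b′ * (δ + suc r′) * 1))
        + suc b′ * suc r′ * (2 * (δ + suc r′ + (suc M′ + suc b′ * (δ + suc r′) * 1))) + (b′ + r′ + b′ * r′) ≡
      δ * δ + ((suc b′ + 1) * suc r′ + suc M′) * ((suc b′ + 1) * suc r′ + suc M′) + suc b′ * δ
        + 2 * δ * ((suc b′ + 1) * suc r′ + suc M′ + suc b′ * δ)
        + suc b′ * suc r′ * (2 + (suc b′ + 2) * (2 * δ + suc r′))
    identity b′ δ r′ M′ = solve (b′ ∷ δ ∷ r′ ∷ M′ ∷ [])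

-- Adding `3b (2n + 1) ≤ 3b X` to the hypothesis leaves `b² (a² − ad + d²) + b (2d − a + 6) + 1 ≤
-- 0`. The quadratic form is nonnegative, and in the case `d ≤ a` it also absorbs the negative
-- linear term.
second-bound : ∀ b a d n → let s = suc a ; δ = s + d ; X = b * (s * suc d + δ) + δ + s in
               SecondBound b δ n → X ≤ 2 * n
second-bound b a d n T₂ = ≮⇒≥ λ 2n<X → 1+n≰n (contra (≤-total a d) (+-mono-≤ T₂ (*-monoʳ-≤ (3 * b) 2n<X)))
  where
  contra : a ≤ d ⊎ d ≤ a →
           b * b * ((suc a + d) * (suc a + d)) + (4 * (b * b) + 5 * b) * (suc a + d) + b * b + 4 * b + 1 + 3 * b * suc (2 * n)
           ≤ 6 * b * n + 3 * b * (b * (suc a * suc d + (suc a + d)) + (suc a + d) + suc a) → 1 ≤ 0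
  contra (inj₁ a≤d) h with p , refl ← m≤n⇒∃[o]m+o≡n a≤d =
    certify (b * b * (a * a + a * p + p * p) + b * (a + 2 * p + 6)) h (solve (a ∷ p ∷ b ∷ n ∷ []))
  contra (inj₂ d≤a) h with p , refl ← m≤n⇒∃[o]m+o≡n d≤a =
    certify (b * b * (d * d + d * p) + b * (d + 6)) (+-mono-≤ h (*-mono-≤ (m≤m*m b) (m≤m*m p)))
      (solve (d ∷ p ∷ b ∷ n ∷ []))

-- The right side minus `classBound` is `b d (a (2n − X) + d + 1)` with the `X` of `second-bound`;
-- `slack + 1` is `b d (d + 1)`.
classBound-< : ∀ b′ a d′ y → let b = suc b′ ; s = suc a ; d = suc d′ ; δ = s + d ; t = suc d ; M = t + y ; n = s + (M + b * s * t) in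
               SecondBound b δ n → classBound b s t M < extremalSize b δ (1 + y + b * a * d)
classBound-< b′ a d′ y T₂ = certify slack
    (*-monoʳ-≤ (suc b′ * suc d′ * a) (second-bound (suc b′) a (suc d′) _ T₂)) (identity b′ a d′ y)
  where
  slack = b′ * d′ * d′ + 3 * b′ * d′ + 2 * b′ + d′ * d′ + 3 * d′ + 1
  identity : ∀ b′ a d′ y →
    suc (suc a * (suc a + (suc (suc d′) + y + suc b′ * suc a * suc (suc d′)))
         + suc a * (suc (suc d′) + y + suc b′ * suc a * suc (suc d′))
         + ((suc (suc d′) + y) * (suc (suc d′) + y) + suc b′ * suc a * (suc (suc d′) * suc (suc d′))))
      + suc b′ * suc d′ * a * (2 * (suc a + (suc (suc d′) + y + suc b′ * suc a * suc (suc d′))))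
      + (b′ * d′ * d′ + 3 * b′ * d′ + 2 * b′ + d′ * d′ + 3 * d′ + 1) ≡
    (suc a + suc d′) * (suc a + suc d′) + (1 + y + suc b′ * a * suc d′) * (1 + y + suc b′ * a * suc d′)
      + suc b′ * (suc a + suc d′) + 2 * (suc a + suc d′) * (1 + y + suc b′ * a * suc d′ + suc b′ * (suc a + suc d′))
      + suc b′ * suc d′ * a * (suc b′ * (suc a * suc (suc d′) + (suc a + suc d′)) + (suc a + suc d′) + suc a)
  identity b′ a d′ y = solve (b′ ∷ a ∷ d′ ∷ y ∷ [])

module Squares {m} (c : Fin m → ℕ) (t k : ℕ) (0<t : 0 < t) (c≥t : ∀ i → 0 < c i → t ≤ c i)
               (k<support : k < ∑ λ i → 1 ⊓ c i) where

  support M : ℕ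
  support = ∑ λ i → 1 ⊓ c i
  M = ∑ c ∸ k * t

  private
    base : ∀ i → t * (1 ⊓ c i) ≤ c i
    base i with c i | c≥t i
    ... | zero  | _ = ≤-reflexive (*-zeroʳ t)
    ... | suc x | p = ≤-trans (≤-reflexive (*-identityʳ t)) (p (s≤s z≤n))

    extra : ∀ i → t * support + (c i ∸ t) ≤ ∑ c
    extra i = begin
      t * support + (c i ∸ t)
        ≡⟨ cong₂ _+_ (*-distribˡ-sum t (λ j → 1 ⊓ c j)) (sym (∑-delta i λ j → c j ∸ t)) ⟩
      ∑ (λ j → t * (1 ⊓ c j)) + ∑ (λ j → (i == j) ▹ (c j ∸ t))
        ≡⟨ sym (∑-distrib-+ (λ j → t * (1 ⊓ c j)) _) ⟩
      ∑ (λ j → t * (1 ⊓ c j) + (i == j) ▹ (c j ∸ t))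
        ≤⟨ ∑-mono pt ⟩
      ∑ c ∎
      where
      open ≤-Reasoning
      pt : ∀ j → t * (1 ⊓ c j) + (i == j) ▹ (c j ∸ t) ≤ c j
      pt j with i == j
      ... | false = ≤-trans (≤-reflexive (+-identityʳ _)) (base j)
      ... | true  with c j | c≥t j
      ...   | zero  | _ = ≤-reflexive (cong₂ _+_ (*-zeroʳ t) (0∸n≡0 t))
      ...   | suc x | p = ≤-reflexive (trans (cong (_+ (suc x ∸ t)) (*-identityʳ t)) (m+[n∸m]≡n (p (s≤s z≤n))))

    support-t : t + k * t ≤ t * support
    support-t = ≤-trans (*-monoˡ-≤ t k<support) (≤-reflexive (*-comm support t))

    kt≤∑ : t + k * t ≤ ∑ c
    kt≤∑ = ≤-trans support-t (≤-trans (≤-reflexive (*-distribˡ-sum t (λ j → 1 ⊓ c j))) (∑-mono base))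

  ∑c : ∑ c ≡ M + k * t
  ∑c = sym (m∸n+n≡m (≤-trans (m≤n+m (k * t) t) kt≤∑))

  t≤M : t ≤ M
  t≤M = +-cancelʳ-≤ (k * t) t M (≤-trans kt≤∑ (≤-reflexive ∑c))

  -- At least `k` further nonempty classes take up `k * t` of the total.
  c≤M : ∀ i → c i ≤ M
  c≤M i with c i | c≥t i | extra i
  ... | zero  | _ | _ = z≤n
  ... | suc x | p | q = +-cancelʳ-≤ (k * t) (suc x) M (begin
    suc x + k * t                ≡⟨ cong (_+ k * t) (sym (m+[n∸m]≡n (p (s≤s z≤n)))) ⟩
    t + (suc x ∸ t) + k * t      ≡⟨ rearr t (suc x ∸ t) (k * t) ⟩
    t + k * t + (suc x ∸ t)      ≤⟨ +-monoˡ-≤ (suc x ∸ t) support-t ⟩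
    t * support + (suc x ∸ t)    ≤⟨ q ⟩
    ∑ c                          ≡⟨ ∑c ⟩
    M + k * t                    ∎)
    where
    open ≤-Reasoning
    rearr : ∀ x y z → x + y + z ≡ x + z + y
    rearr x y z = solve (x ∷ y ∷ z ∷ [])

  -- (c i − t)(M − c i) ≥ 0 for a nonempty class.
  chord : ∀ i → c i * c i + t * M * (1 ⊓ c i) ≤ (M + t) * c i
  chord i with c i | c≥t i | c≤M i
  ... | zero  | _ | _ = ≤-reflexive (trans (*-zeroʳ (t * M)) (sym (*-zeroʳ (M + t))))
  ... | suc x | p | q = nonneg (m≤n⇒∃[o]m+o≡n (p (s≤s z≤n))) (m≤n⇒∃[o]m+o≡n q)
    where
    nonneg : ∀ {y M} → (∃ λ u → t + u ≡ y) → (∃ λ v → y + v ≡ M) → y * y + t * M * 1 ≤ (M + t) * y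
    nonneg (u , refl) (v , refl) = certify {0} {0} (u * v) z≤n (solve (t ∷ u ∷ v ∷ []))

  ∑-chord : ∑ (λ i → c i * c i) + t * M * support ≤ (M + t) * (M + k * t)
  ∑-chord = begin
    ∑ (λ i → c i * c i) + t * M * support
      ≡⟨ cong (∑ (λ i → c i * c i) +_) (*-distribˡ-sum (t * M) λ i → 1 ⊓ c i) ⟩
    ∑ (λ i → c i * c i) + ∑ (λ i → t * M * (1 ⊓ c i))
      ≡⟨ sym (∑-distrib-+ (λ i → c i * c i) _) ⟩
    ∑ (λ i → c i * c i + t * M * (1 ⊓ c i))  ≤⟨ ∑-mono chord ⟩
    ∑ (λ i → (M + t) * c i)                  ≡⟨ sym (*-distribˡ-sum (M + t) c) ⟩
    (M + t) * ∑ c                            ≡⟨ cong ((M + t) *_) ∑c ⟩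
    (M + t) * (M + k * t)                    ∎
    where open ≤-Reasoning

  -- The right side is the value for one class of size `M` and `k` of size `t`. It follows from the
  -- summed chords, since at least `k + 1` classes contribute the term `t * M`.
  ∑-squares : ∑ (λ i → c i * c i) ≤ M * M + k * (t * t)
  ∑-squares = arith (∑ λ i → c i * c i) M ∑-chord (*-monoʳ-≤ (t * M) k<support)
    where
    arith : ∀ q M → q + t * M * support ≤ (M + t) * (M + k * t) → t * M * suc k ≤ t * M * support → q ≤ M * M + k * (t * t)
    arith q M = lin q M t k support
      where
      lin : ∀ q M t k S → q + t * M * S ≤ (M + t) * (M + k * t) → t * M * suc k ≤ t * M * S → q ≤ M * M + k * (t * t)
      lin q M t k S h₁ h₂ = certify 0 (+-mono-≤ h₁ h₂) (solve (q ∷ M ∷ t ∷ k ∷ S ∷ []))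

module SquaresTight {m} (c : Fin m → ℕ) (k : ℕ) (k<support : k < ∑ λ i → 1 ⊓ c i) where
  open Squares c 1 k (s≤s z≤n) (λ _ p → p) k<support

  module _ (tight : M * M + k ≤ ∑ λ i → c i * c i) where

    private
      total : (M + 1) * ∑ c ≤ ∑ λ i → c i * c i + 1 * M * (1 ⊓ c i)
      total = begin
        (M + 1) * ∑ c                             ≡⟨ cong ((M + 1) *_) ∑c ⟩
        (M + 1) * (M + k * 1)                     ≡⟨ expand M k ⟩
        M * M + k + 1 * M * suc k                 ≤⟨ +-mono-≤ tight (*-monoʳ-≤ (1 * M) k<support) ⟩
        ∑ (λ i → c i * c i) + 1 * M * support     ≡⟨ cong (∑ (λ i → c i * c i) +_) (*-distribˡ-sum (1 * M) λ i → 1 ⊓ c i) ⟩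
        ∑ (λ i → c i * c i) + ∑ (λ i → 1 * M * (1 ⊓ c i))  ≡⟨ sym (∑-distrib-+ (λ i → c i * c i) _) ⟩
        ∑ (λ i → c i * c i + 1 * M * (1 ⊓ c i))   ∎
        where
        open ≤-Reasoning
        expand : ∀ M k → (M + 1) * (M + k * 1) ≡ M * M + k + 1 * M * suc k
        expand M k = solve (M ∷ k ∷ [])

      -- For a nonempty class this says `(c i − 1)(M − c i) = 0`, from which `sizes` is read off.
      on-chord : ∀ i → c i * c i + 1 * M * (1 ⊓ c i) ≡ (M + 1) * c i
      on-chord = ∑-rigid (λ i → c i * c i + 1 * M * (1 ⊓ c i)) (λ i → (M + 1) * c i) chord
        (≤-trans (≤-reflexive (sym (*-distribˡ-sum (M + 1) c))) total)

    support≡ : support ≡ suc k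
    support≡ = ≤-antisym (*-cancelˡ-≤ M {{>-nonZero t≤M}} (lin M k support (∑ λ i → c i * c i) ∑-chord tight)) k<support
      where
      lin : ∀ M k S q → q + 1 * M * S ≤ (M + 1) * (M + k * 1) → M * M + k ≤ q → M * S ≤ M * suc k
      lin M k S q h₁ h₂ = certify 0 (+-mono-≤ h₁ h₂) (solve (M ∷ k ∷ S ∷ q ∷ []))

    sizes : ∀ i → c i ≤ 1 ⊎ c i ≡ M
    sizes i with c i | on-chord i | c≤M i
    ... | zero        | _ | _ = inj₁ z≤n
    ... | suc zero    | _ | _ = inj₁ (s≤s z≤n)
    ... | suc (suc p) | h | q = inj₂ (root (m≤n⇒∃[o]m+o≡n q) h)
      where
      root : ∀ {M} → (∃ λ v → suc (suc p) + v ≡ M) → suc (suc p) * suc (suc p) + 1 * M * 1 ≡ (M + 1) * suc (suc p) → suc (suc p) ≡ M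
      root (zero  , refl) h = sym (+-identityʳ _)
      root (suc v , refl) h with () ← 1+n≰n {0} (certify (v + p + p * v) (≤-reflexive (sym h)) (solve (p ∷ v ∷ [])))

    -- If every size were at most 1, the total would be the support `k + 1`, whence `M ≡ 1`, a size
    -- that does occur.
    large : ∃ λ i → c i ≡ M
    large with Fin.any? (λ i → c i ℕ.≟ M)
    ... | yes p = p
    ... | no ¬p with ∑-positive c (≤-trans (≤-trans t≤M (m≤m+n M _)) (≤-reflexive (sym ∑c)))
    ...   | i , 0<c = contradiction (i , trans (≤-antisym (small i) 0<c) (sym M≡1)) ¬p
      where
      small : ∀ i → c i ≤ 1
      small i with sizes i
      ... | inj₁ q = q
      ... | inj₂ q = contradiction (i , q) ¬p
      M≡1 : M ≡ 1
      M≡1 = ≤-antisym (+-cancelʳ-≤ (k * 1) M 1 (begin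
        M + k * 1  ≡⟨ sym ∑c ⟩
        ∑ c        ≤⟨ ∑-mono (λ i → ⊓-glb (small i) ≤-refl) ⟩
        support    ≡⟨ support≡ ⟩
        1 + k      ≡⟨ cong suc (sym (*-identityʳ k)) ⟩
        1 + k * 1  ∎)) t≤M
        where open ≤-Reasoning

    -- Outside class `i` only `k` vertices remain, and at least `k` classes are nonempty there.
    others-small : ∀ i → c i ≡ M → ∀ j → j ≢ i → c j ≤ 1
    others-small i ci j j≢i = ≤-trans (≤-reflexive (sym (subst (λ b → not b ▹ (1 ⊓ c j) ≡ not b ▹ c j) (≢⇒== j≢i) (rigid j))))
                                      (m⊓n≤m 1 (c j))
      where
      rigid : ∀ j → not (j == i) ▹ (1 ⊓ c j) ≡ not (j == i) ▹ c j
      rigid = ∑-rigid (λ j → not (j == i) ▹ (1 ⊓ c j)) (λ j → not (j == i) ▹ c j)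
        (λ j → ▹-monoʳ (not (j == i)) (m⊓n≤n 1 (c j)))
        (lin (weight-remove (λ _ → true) i c refl) (weight-remove (λ _ → true) i (λ j → 1 ⊓ c j) refl)
             (≤-reflexive ∑c) (≤-reflexive (sym support≡)) (≤-reflexive (sym ci)) (m⊓n≤m 1 (c i)))
        where
        ▹-monoʳ : ∀ b {x y} → x ≤ y → b ▹ x ≤ b ▹ y
        ▹-monoʳ true  p = p
        ▹-monoʳ false p = z≤n
        lin : ∀ {Σc Σs r r′ x x′} → Σc ≡ r + x → Σs ≡ r′ + x′ → Σc ≤ M + k * 1 → suc k ≤ Σs → M ≤ x → x′ ≤ 1 → r ≤ r′
        lin {r = r} {r′} {x} {x′} refl refl h₁ h₂ h₃ h₄ = go M r r′ x x′ h₁ h₂ h₃ h₄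
          where
          go : ∀ M r r′ x x′ → r + x ≤ M + k * 1 → suc k ≤ r′ + x′ → M ≤ x → x′ ≤ 1 → r ≤ r′
          go M r r′ x x′ h₁ h₂ h₃ h₄ = certify 0 (+-mono-≤ h₁ (+-mono-≤ h₂ (+-mono-≤ h₃ h₄))) (solve (M ∷ k ∷ r ∷ r′ ∷ x ∷ x′ ∷ []))

-- Degrees and sizes of graphs

degree≡deg : ∀ {n} (G : Graph n) v → degree G v ≡ deg G v
degree≡deg G v = count-tabulate (adj G v)
  where
  count-tabulate : ∀ {n} (χ : Fin n → Bool) → ∣ tabulate χ ∣ ≡ ∑ λ u → χ u ▹ 1
  count-tabulate {zero}  χ = refl
  count-tabulate {suc n} χ with χ zero
  ... | true  = cong suc (count-tabulate (χ ∘ suc))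
  ... | false = count-tabulate (χ ∘ suc)

module _ {A B : Set} {P : A × B → Set} (P? : ∀ p → Dec (P p)) where

  length-filter-row : ∀ {n} x (h : Fin n → B) →
                      length (filter P? (List.map (x ,_) (List.tabulate h))) ≡ ∑ λ j → does (P? (x , h j)) ▹ 1
  length-filter-row {zero}  x h = refl
  length-filter-row {suc n} x h with does (P? (x , h zero))
  ... | true  = cong suc (length-filter-row x (h ∘ suc))
  ... | false = length-filter-row x (h ∘ suc)

  length-filter-product : ∀ {m n} (g : Fin m → A) (h : Fin n → B) →
    length (filter P? (cartesianProduct (List.tabulate g) (List.tabulate h))) ≡ ∑ λ i → ∑ λ j → does (P? (g i , h j)) ▹ 1
  length-filter-product {zero}  g h = refl
  length-filter-product {suc m} g h = trans
    (cong length (filter-++ P? (List.map (g zero ,_) (List.tabulate h)) _))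
    (trans (length-++ (filter P? (List.map (g zero ,_) (List.tabulate h))))
           (cong₂ _+_ (length-filter-row (g zero) h) (length-filter-product (g ∘ suc) h)))

handshake : ∀ {n} (G : Graph n) → e G + e G ≡ size (adj G)
handshake {n} G = begin
  e G + e G                                                       ≡⟨ cong₂ _+_ e≡ (trans e≡ (∑-comm λ u v → ordered u v ▹ 1)) ⟩
  ∑ (λ u → ∑ λ v → ordered u v ▹ 1) + ∑ (λ u → ∑ λ v → ordered v u ▹ 1)
    ≡⟨ sym (∑-distrib-+ (λ u → ∑ λ v → ordered u v ▹ 1) _) ⟩
  ∑ (λ u → ∑ (λ v → ordered u v ▹ 1) + ∑ λ v → ordered v u ▹ 1)
    ≡⟨ sum-cong-≗ (λ u → trans (sym (∑-distrib-+ (λ v → ordered u v ▹ 1) _)) (sum-cong-≗ (pt u))) ⟩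
  size (adj G)                                                    ∎
  where
  open ≡.≡-Reasoning
  ordered : Fin n → Fin n → Bool
  ordered u v = does (u Fin.<? v) ∧ adj G u v
  e≡ : e G ≡ ∑ λ u → ∑ λ v → ordered u v ▹ 1
  e≡ = length-filter-product (λ (u , v) → (u Fin.<? v) ×-dec T? (adj G u v)) (λ i → i) (λ i → i)
  pt : ∀ u v → ordered u v ▹ 1 + ordered v u ▹ 1 ≡ adj G u v ▹ 1
  pt u v rewrite Graph.sym G v u with Fin.<-cmp u v
  ... | tri< p _ q rewrite dec-true (u Fin.<? v) p | dec-false (v Fin.<? u) q = +-identityʳ _
  ... | tri> p _ q rewrite dec-false (u Fin.<? v) p | dec-true (v Fin.<? u) q = refl
  ... | tri≈ p refl _ rewrite irrefl G u | ∧-zeroʳ (does (u Fin.<? u)) = refl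

K-adj : ∀ m u v → adj (K m) u v ≡ not (u == v)
K-adj m u v with u Fin.≟ v
... | yes _ = refl
... | no  _ = refl

size-K : ∀ m → size (adj (K m)) + m ≡ m * m
size-K m = trans (cong (size (adj (K m)) +_) (sym (trans (∑-const m 1) (*-identityʳ m))))
  (trans (sym (∑-distrib-+ (λ u → ∑ λ v → adj (K m) u v ▹ 1) _)) (trans (sum-cong-≗ row) (∑-const m m)))
  where
  row : ∀ u → ∑ (λ v → adj (K m) u v ▹ 1) + 1 ≡ m
  row u = trans (cong (∑ (λ v → adj (K m) u v ▹ 1) +_) (sym (∑-delta u λ _ → 1)))
    (trans (sym (∑-distrib-+ (λ v → adj (K m) u v ▹ 1) _))
      (trans (sum-cong-≗ pt) (trans (∑-const m 1) (*-identityʳ m))))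
    where
    pt : ∀ v → adj (K m) u v ▹ 1 + (u == v) ▹ 1 ≡ 1
    pt v rewrite K-adj m u v with u == v
    ... | true  = refl
    ... | false = refl

size-combine : ∀ {m n} c (G : Graph m) (H : Graph n) →
               size (adj (combine c G H)) ≡ size (adj G) + size (adj H) + 2 * (c ▹ 1) * (m * n)
size-combine {m} {n} c G H = begin
  size (adj (combine c G H))
    ≡⟨ ∑-split m _ ⟩
  ∑ (λ i → ∑ λ y → A (i ↑ˡ n) y ▹ 1) + ∑ (λ j → ∑ λ y → A (m ↑ʳ j) y ▹ 1)
    ≡⟨ cong₂ _+_ (sum-cong-≗ λ i → trans (∑-split m _) (cong₂ _+_ (sum-cong-≗ λ j → cong (_▹ 1) (ll i j)) (sum-cong-≗ λ j → cong (_▹ 1) (lr i j))))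
                 (sum-cong-≗ λ i → trans (∑-split m _) (cong₂ _+_ (sum-cong-≗ λ j → cong (_▹ 1) (rl i j)) (sum-cong-≗ λ j → cong (_▹ 1) (rr i j)))) ⟩
  ∑ (λ i → deg G i + ∑ {n} (λ j → c ▹ 1)) + ∑ (λ i → ∑ {m} (λ j → c ▹ 1) + deg H i)
    ≡⟨ cong₂ _+_ (∑-distrib-+ (deg G) _) (∑-distrib-+ (λ _ → ∑ {m} λ j → c ▹ 1) (deg H)) ⟩
  size (adj G) + ∑ {m} (λ i → ∑ {n} (λ j → c ▹ 1)) + (∑ {n} (λ i → ∑ {m} (λ j → c ▹ 1)) + size (adj H))
    ≡⟨ cong₂ (λ x y → size (adj G) + x + (y + size (adj H)))
         (trans (sum-cong-≗ {m} λ _ → ∑-const n (c ▹ 1)) (∑-const m _)) (trans (sum-cong-≗ {n} λ _ → ∑-const m (c ▹ 1)) (∑-const n _)) ⟩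
  size (adj G) + m * (n * (c ▹ 1)) + (n * (m * (c ▹ 1)) + size (adj H))
    ≡⟨ rearr (size (adj G)) (size (adj H)) m n (c ▹ 1) ⟩
  size (adj G) + size (adj H) + 2 * (c ▹ 1) * (m * n) ∎
  where
  open ≡.≡-Reasoning
  A = adj (combine c G H)
  rearr : ∀ g h m n c → g + m * (n * c) + (n * (m * c) + h) ≡ g + h + 2 * c * (m * n)
  rearr g h m n c = solve (g ∷ h ∷ m ∷ n ∷ c ∷ [])
  ll : ∀ i j → A (i ↑ˡ n) (j ↑ˡ n) ≡ adj G i j
  ll i j rewrite Fin.splitAt-↑ˡ m i n | Fin.splitAt-↑ˡ m j n = refl
  lr : ∀ i j → A (i ↑ˡ n) (m ↑ʳ j) ≡ c
  lr i j rewrite Fin.splitAt-↑ˡ m i n | Fin.splitAt-↑ʳ m n j = refl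
  rl : ∀ i j → A (m ↑ʳ i) (j ↑ˡ n) ≡ c
  rl i j rewrite Fin.splitAt-↑ʳ m n i | Fin.splitAt-↑ˡ m j n = refl
  rr : ∀ i j → A (m ↑ʳ i) (m ↑ʳ j) ≡ adj H i j
  rr i j rewrite Fin.splitAt-↑ʳ m n i | Fin.splitAt-↑ʳ m n j = refl

size-copies : ∀ k → size (adj (copies k (K 1))) ≡ 0
size-copies zero    = refl
size-copies (suc k) = trans (size-combine false (K 1) (copies k (K 1))) (trans (+-identityʳ _) (size-copies k))

size-extremal : ∀ n b δ → let M = n ∸ (b + 1) * δ in
                size (adj (extremal n b δ)) + (δ + (M + b * δ)) ≡ extremalSize b δ M
size-extremal n b δ = arith {k₁ = size (adj (K δ))} {size (adj (K M))} {δ} {M} {b * δ} (size-combine true (K δ) (K M ∪ copies (b * δ) (K 1))) (size-combine false (K M) (copies (b * δ) (K 1)))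
    (size-copies (b * δ)) (size-K δ) (size-K M)
  where
  M = n ∸ (b + 1) * δ
  arith : ∀ {x y z k₁ k₂ δ M p} → x ≡ k₁ + y + 2 * 1 * (δ * (M + p * 1)) → y ≡ k₂ + z + 2 * 0 * (M * (p * 1)) → z ≡ 0 →
          k₁ + δ ≡ δ * δ → k₂ + M ≡ M * M → x + (δ + (M + p)) ≡ δ * δ + M * M + p + 2 * δ * (M + p)
  arith {k₁ = k₁} {k₂} {δ} {M} {p} refl refl refl e₁ e₂ = trans (collect k₁ k₂ δ M p)
    (cong₂ (λ x y → x + y + p + 2 * δ * (M + p)) e₁ e₂)
    where
    collect : ∀ k₁ k₂ δ M p → k₁ + (k₂ + 0 + 2 * 0 * (M * (p * 1))) + 2 * 1 * (δ * (M + p * 1)) + (δ + (M + p)) ≡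
                              (k₁ + δ) + (k₂ + M) + p + 2 * δ * (M + p)
    collect k₁ k₂ δ M p = solve (k₁ ∷ k₂ ∷ δ ∷ M ∷ p ∷ [])

-- Recognising the extremal graph

-- An interleaving of three blocks. Unlike an equation `a + b + c ≡ n` it carries a bijection, given
-- by `deal` and `collect`.
data Shuffle : ℕ → ℕ → ℕ → ℕ → Set where
  []   : Shuffle 0 0 0 0
  fst∷ : ∀ {a b c n} → Shuffle a b c n → Shuffle (suc a) b c (suc n)
  snd∷ : ∀ {a b c n} → Shuffle a b c n → Shuffle a (suc b) c (suc n)
  trd∷ : ∀ {a b c n} → Shuffle a b c n → Shuffle a b (suc c) (suc n)

Triple : ℕ → ℕ → ℕ → Set
Triple a b c = Fin a ⊎ (Fin b ⊎ Fin c)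

deal : ∀ {a b c n} → Shuffle a b c n → Fin n → Triple a b c
deal (fst∷ p) zero    = inj₁ zero
deal (fst∷ p) (suc v) = Sum.map₁ suc (deal p v)
deal (snd∷ p) zero    = inj₂ (inj₁ zero)
deal (snd∷ p) (suc v) = Sum.map₂ (Sum.map₁ suc) (deal p v)
deal (trd∷ p) zero    = inj₂ (inj₂ zero)
deal (trd∷ p) (suc v) = Sum.map₂ (Sum.map₂ suc) (deal p v)

collect : ∀ {a b c n} → Shuffle a b c n → Triple a b c → Fin n
collect (fst∷ p) (inj₁ zero)           = zero
collect (fst∷ p) (inj₁ (suc i))        = suc (collect p (inj₁ i))
collect (fst∷ p) (inj₂ (inj₁ i))       = suc (collect p (inj₂ (inj₁ i)))
collect (fst∷ p) (inj₂ (inj₂ i))       = suc (collect p (inj₂ (inj₂ i)))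
collect (snd∷ p) (inj₁ i)              = suc (collect p (inj₁ i))
collect (snd∷ p) (inj₂ (inj₁ zero))    = zero
collect (snd∷ p) (inj₂ (inj₁ (suc i))) = suc (collect p (inj₂ (inj₁ i)))
collect (snd∷ p) (inj₂ (inj₂ i))       = suc (collect p (inj₂ (inj₂ i)))
collect (trd∷ p) (inj₁ i)              = suc (collect p (inj₁ i))
collect (trd∷ p) (inj₂ (inj₁ i))       = suc (collect p (inj₂ (inj₁ i)))
collect (trd∷ p) (inj₂ (inj₂ zero))    = zero
collect (trd∷ p) (inj₂ (inj₂ (suc i))) = suc (collect p (inj₂ (inj₂ i)))

deal-collect : ∀ {a b c n} (p : Shuffle a b c n) x → deal p (collect p x) ≡ x
deal-collect (fst∷ p) (inj₁ zero)           = refl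
deal-collect (fst∷ p) (inj₁ (suc i))        = cong (Sum.map₁ suc) (deal-collect p (inj₁ i))
deal-collect (fst∷ p) (inj₂ (inj₁ i))       = cong (Sum.map₁ suc) (deal-collect p (inj₂ (inj₁ i)))
deal-collect (fst∷ p) (inj₂ (inj₂ i))       = cong (Sum.map₁ suc) (deal-collect p (inj₂ (inj₂ i)))
deal-collect (snd∷ p) (inj₁ i)              = cong (Sum.map₂ (Sum.map₁ suc)) (deal-collect p (inj₁ i))
deal-collect (snd∷ p) (inj₂ (inj₁ zero))    = refl
deal-collect (snd∷ p) (inj₂ (inj₁ (suc i))) = cong (Sum.map₂ (Sum.map₁ suc)) (deal-collect p (inj₂ (inj₁ i)))
deal-collect (snd∷ p) (inj₂ (inj₂ i))       = cong (Sum.map₂ (Sum.map₁ suc)) (deal-collect p (inj₂ (inj₂ i)))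
deal-collect (trd∷ p) (inj₁ i)              = cong (Sum.map₂ (Sum.map₂ suc)) (deal-collect p (inj₁ i))
deal-collect (trd∷ p) (inj₂ (inj₁ i))       = cong (Sum.map₂ (Sum.map₂ suc)) (deal-collect p (inj₂ (inj₁ i)))
deal-collect (trd∷ p) (inj₂ (inj₂ zero))    = refl
deal-collect (trd∷ p) (inj₂ (inj₂ (suc i))) = cong (Sum.map₂ (Sum.map₂ suc)) (deal-collect p (inj₂ (inj₂ i)))

collect-deal : ∀ {a b c n} (p : Shuffle a b c n) v → collect p (deal p v) ≡ v
collect-deal (fst∷ p) zero    = refl
collect-deal (fst∷ p) (suc v) with deal p v in eq
... | inj₁ i        = cong suc (trans (cong (collect p) (sym eq)) (collect-deal p v))
... | inj₂ (inj₁ i) = cong suc (trans (cong (collect p) (sym eq)) (collect-deal p v))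
... | inj₂ (inj₂ i) = cong suc (trans (cong (collect p) (sym eq)) (collect-deal p v))
collect-deal (snd∷ p) zero    = refl
collect-deal (snd∷ p) (suc v) with deal p v in eq
... | inj₁ i        = cong suc (trans (cong (collect p) (sym eq)) (collect-deal p v))
... | inj₂ (inj₁ i) = cong suc (trans (cong (collect p) (sym eq)) (collect-deal p v))
... | inj₂ (inj₂ i) = cong suc (trans (cong (collect p) (sym eq)) (collect-deal p v))
collect-deal (trd∷ p) zero    = refl
collect-deal (trd∷ p) (suc v) with deal p v in eq
... | inj₁ i        = cong suc (trans (cong (collect p) (sym eq)) (collect-deal p v))
... | inj₂ (inj₁ i) = cong suc (trans (cong (collect p) (sym eq)) (collect-deal p v))
... | inj₂ (inj₂ i) = cong suc (trans (cong (collect p) (sym eq)) (collect-deal p v))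

in₁ in₂ : ∀ {a b c} → Triple a b c → Bool
in₁ (inj₁ _) = true
in₁ (inj₂ _) = false
in₂ (inj₁ _)        = false
in₂ (inj₂ (inj₁ _)) = true
in₂ (inj₂ (inj₂ _)) = false

cons : ∀ {a b c n} (x y : Bool) → Shuffle a b c n →
       Shuffle (x ▹ 1 + a) ((not x ∧ y) ▹ 1 + b) ((not x ∧ not y) ▹ 1 + c) (suc n)
cons true  _     p = fst∷ p
cons false true  p = snd∷ p
cons false false p = trd∷ p

shuffle : ∀ {n} (σ τ : Fin n → Bool) →
          Shuffle (∑ λ v → σ v ▹ 1) (∑ λ v → (not (σ v) ∧ τ v) ▹ 1) (∑ λ v → (not (σ v) ∧ not (τ v)) ▹ 1) n
shuffle {zero}  σ τ = []
shuffle {suc n} σ τ = cons (σ zero) (τ zero) (shuffle (σ ∘ suc) (τ ∘ suc))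

module _ {a b c : ℕ} where

  private
    in-fst : (x : Triple a b c) → in₁ (Sum.map₁ suc x) ≡ in₁ x × in₂ (Sum.map₁ suc x) ≡ in₂ x
    in-fst (inj₁ _)        = refl , refl
    in-fst (inj₂ (inj₁ _)) = refl , refl
    in-fst (inj₂ (inj₂ _)) = refl , refl

    in-snd : (x : Triple a b c) → in₁ (Sum.map₂ (Sum.map₁ suc) x) ≡ in₁ x × in₂ (Sum.map₂ (Sum.map₁ suc) x) ≡ in₂ x
    in-snd (inj₁ _)        = refl , refl
    in-snd (inj₂ (inj₁ _)) = refl , refl
    in-snd (inj₂ (inj₂ _)) = refl , refl

    in-trd : (x : Triple a b c) → in₁ (Sum.map₂ (Sum.map₂ suc) x) ≡ in₁ x × in₂ (Sum.map₂ (Sum.map₂ suc) x) ≡ in₂ x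
    in-trd (inj₁ _)        = refl , refl
    in-trd (inj₂ (inj₁ _)) = refl , refl
    in-trd (inj₂ (inj₂ _)) = refl , refl

  cons-zero : ∀ {n} x y (p : Shuffle a b c n) →
              in₁ (deal (cons x y p) zero) ≡ x × in₂ (deal (cons x y p) zero) ≡ not x ∧ y
  cons-zero true  y     p = refl , refl
  cons-zero false true  p = refl , refl
  cons-zero false false p = refl , refl

  cons-suc : ∀ {n} x y (p : Shuffle a b c n) v →
             in₁ (deal (cons x y p) (suc v)) ≡ in₁ (deal p v) × in₂ (deal (cons x y p) (suc v)) ≡ in₂ (deal p v)
  cons-suc true  y     p v = in-fst (deal p v)
  cons-suc false true  p v = in-snd (deal p v)
  cons-suc false false p v = in-trd (deal p v)

deal-shuffle : ∀ {n} (σ τ : Fin n → Bool) v →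
               in₁ (deal (shuffle σ τ) v) ≡ σ v × in₂ (deal (shuffle σ τ) v) ≡ not (σ v) ∧ τ v
deal-shuffle σ τ zero    = cons-zero (σ zero) (τ zero) (shuffle (σ ∘ suc) (τ ∘ suc))
deal-shuffle σ τ (suc v) with p , q ← cons-suc (σ zero) (τ zero) (shuffle (σ ∘ suc) (τ ∘ suc)) v
                         with r , s ← deal-shuffle (σ ∘ suc) (τ ∘ suc) v = trans p r , trans q s

-- The shape K_a ∨ (K_b ∪ cK₁) expressed through two vertex sets: `σ` is the joined part and `τ`
-- outside `σ` the clique. Subsets can be searched directly, and `shuffle` supplies the isomorphism
-- afterwards.
record Extremal {n} (G : Graph n) (a b c : ℕ) (σ τ : Fin n → Bool) : Set where
  constructor mkExtremal
  field
    #σ    : ∑ (λ v → σ v ▹ 1) ≡ a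
    #τ    : ∑ (λ v → (not (σ v) ∧ τ v) ▹ 1) ≡ b
    #rest : ∑ (λ v → (not (σ v) ∧ not (τ v)) ▹ 1) ≡ c
    edges : ∀ u v → adj G u v ≡ not (u == v) ∧ ((σ u ∨ σ v) ∨ ((not (σ u) ∧ τ u) ∧ (not (σ v) ∧ τ v)))

module _ {a b : ℕ} {c} (H : Graph c) (empty : ∀ i j → adj H i j ≡ false) where

  private
    J : Triple a b c → Fin (a + (b + c))
    J x = Fin.join a (b + c) (Sum.map₂ (Fin.join b c) x)

    J⁻¹ : Fin (a + (b + c)) → Triple a b c
    J⁻¹ i = Sum.map₂ (Fin.splitAt b) (Fin.splitAt a i)

    J⁻¹-J : ∀ x → J⁻¹ (J x) ≡ x
    J⁻¹-J (inj₁ i) rewrite Fin.splitAt-join a (b + c) (inj₁ i) = refl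
    J⁻¹-J (inj₂ y) rewrite Fin.splitAt-join a (b + c) (inj₂ (Fin.join b c y)) = cong inj₂ (Fin.splitAt-join b c y)

    J-J⁻¹ : ∀ i → J (J⁻¹ i) ≡ i
    J-J⁻¹ i with Fin.splitAt a i in eq
    ... | inj₁ x = trans (cong (Fin.join a (b + c)) (sym eq)) (Fin.join-splitAt a (b + c) i)
    ... | inj₂ y = trans (cong (λ z → Fin.join a (b + c) (inj₂ z)) (Fin.join-splitAt b c y))
                         (trans (cong (Fin.join a (b + c)) (sym eq)) (Fin.join-splitAt a (b + c) i))

    adj-J : ∀ x y → x ≢ y → adj (combine true (K a) (combine false (K b) H)) (J x) (J y) ≡ (in₁ x ∨ in₁ y) ∨ (in₂ x ∧ in₂ y)
    adj-J x y x≢y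
      rewrite Fin.splitAt-join a (b + c) (Sum.map₂ (Fin.join b c) x) | Fin.splitAt-join a (b + c) (Sum.map₂ (Fin.join b c) y)
      with x | y
    ... | inj₁ i | inj₁ j = trans (K-adj a i j) (cong not (≢⇒== (x≢y ∘ cong inj₁)))
    ... | inj₁ i | inj₂ j = refl
    ... | inj₂ i | inj₁ j = refl
    ... | inj₂ i | inj₂ j rewrite Fin.splitAt-join b c i | Fin.splitAt-join b c j with i | j
    ...   | inj₁ i | inj₁ j = trans (K-adj b i j) (cong not (≢⇒== (x≢y ∘ cong (inj₂ ∘ inj₁))))
    ...   | inj₁ i | inj₂ j = refl
    ...   | inj₂ i | inj₁ j = refl
    ...   | inj₂ i | inj₂ j = empty i j

  extremal-≅ : ∀ {n} {G : Graph n} {σ τ} → Extremal G a b c σ τ → G ≅ combine true (K a) (combine false (K b) H)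
  extremal-≅ {n} {G} {σ} {τ} (mkExtremal refl refl refl edges) =
      mk↔ₛ′ (J ∘ deal p) (collect p ∘ J⁻¹)
        (λ i → trans (cong J (deal-collect p (J⁻¹ i))) (J-J⁻¹ i))
        (λ v → trans (cong (collect p) (J⁻¹-J (deal p v))) (collect-deal p v))
    , same
    where
    p = shuffle σ τ
    A = adj (combine true (K a) (combine false (K b) H))
    same : ∀ u v → adj G u v ≡ A (J (deal p u)) (J (deal p v))
    same u v with u Fin.≟ v
    ... | yes refl = trans (irrefl G u) (sym (irrefl (combine true (K a) (combine false (K b) H)) (J (deal p u))))
    ... | no  u≢v  = trans (edges u v) (trans (cong (_∧ _) (cong not (≢⇒== u≢v)))
      (sym (trans (adj-J (deal p u) (deal p v) λ q → u≢v (trans (sym (collect-deal p u)) (trans (cong (collect p) q) (collect-deal p v))))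
        (cong₂ _∨_ (cong₂ _∨_ (proj₁ (deal-shuffle σ τ u)) (proj₁ (deal-shuffle σ τ v)))
                   (cong₂ _∧_ (proj₂ (deal-shuffle σ τ u)) (proj₂ (deal-shuffle σ τ v)))))))

-- A single adjacency would make `size` positive.
copies-empty : ∀ k i j → adj (copies k (K 1)) i j ≡ false
copies-empty k i j = ≢true⇒ λ p → contradiction
  (≤-trans (≤-reflexive (cong (_▹ 1) (sym p))) (≤-trans (∑-term (λ j → adj (copies k (K 1)) i j ▹ 1) j)
    (≤-trans (∑-term (deg (copies k (K 1))) i) (≤-reflexive (size-copies k))))) λ ()

-- Colourings with too many odd classes

class-size : ∀ {n k} → (Fin n → Fin k) → Fin k → ℕ
class-size κ c = ∑ λ v → (κ v == c) ▹ 1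

mass-const : ∀ {n k} (κ : Fin n → Fin k) x c → mass (λ _ → x) κ c ≡ class-size κ c * x
mass-const κ x c = trans (sum-cong-≗ λ v → pt (κ v == c)) (sym (*-distribʳ-sum x λ v → (κ v == c) ▹ 1))
  where
  pt : ∀ b → b ▹ x ≡ b ▹ 1 * x
  pt true  = sym (+-identityʳ x)
  pt false = refl

∑-fibres : ∀ {n k} (κ : Fin n → Fin k) (φ : Fin k → ℕ) → ∑ (λ v → φ (κ v)) ≡ ∑ λ c → class-size κ c * φ c
∑-fibres κ φ = trans (sum-cong-≗ λ v → sym (∑-delta (κ v) φ))
  (trans (∑-comm λ v c → (κ v == c) ▹ φ c) (sum-cong-≗ λ c → mass-const κ (φ c) c))

module BadColouring {n} (G : Graph n) (connected : Connected G) (2∣n : 2 ∣ n) (b′ δ : ℕ)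
  (δ≤deg : ∀ v → δ ≤ deg G v)
  (T₁ : FirstBound b′ δ n) (T₂ : SecondBound (suc b′) δ n)
  (large : size (adj (extremal n (suc b′) δ)) ≤ size (adj G))
  {m} (κ : Fin n → Fin (suc m)) (proper : Proper G κ)
  (bad : mass (λ _ → suc b′) κ zero < #odd (λ _ → b′) κ) where

  b s : ℕ
  b = suc b′
  s = class-size κ zero

  c : Fin m → ℕ
  c i = class-size κ (suc i)

  n≡ : n ≡ s + ∑ c
  n≡ = sym (trans (weight-fibres κ λ _ → 1) (trans (∑-const n 1) (*-identityʳ n)))

  -- Only a nonempty class can be odd.
  k<support : b * s < ∑ λ i → 1 ⊓ c i
  k<support = ≤-trans (≤-trans (≤-reflexive (cong suc (trans (*-comm b s) (sym (mass-const κ b zero))))) bad)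
    (∑-mono λ i → ≤-trans (≤-reflexive (cong odd (mass-const κ b′ (suc i)))) (pt (c i)))
    where
    pt : ∀ x → odd (x * b′) ≤ 1 ⊓ x
    pt zero    = z≤n
    pt (suc x) = odd≤1 (suc x * b′)

  -- With S empty, connectedness puts all vertices into one class, whose mass `n * b′` is even; but
  -- `bad` requires an odd class.
  s>0 : 0 < s
  s>0 = n≢0⇒n>0 λ s≡0 →
    let i , i-odd = ∑-positive (λ i → odd (mass (λ _ → b′) κ (suc i))) (≤-trans (s≤s z≤n) bad)
        v₀ , v₀∈ = ∑-positive (λ v → (κ v == suc i) ▹ b′) (≤-trans i-odd (odd≤ (mass (λ _ → b′) κ (suc i))))
        nonzero = λ v κv → contradiction (trans (sym (cong (_▹ 1) (≡⇒== κv))) (∑≤0⇒ (λ v → (κ v == zero) ▹ 1) (≤-reflexive s≡0) v)) λ ()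
        constant = λ v → fold nonzero (connected v v₀)
        total = sum-cong-≗ λ v → trans (cong (λ k → (k == suc i) ▹ b′) (constant v)) (cong (_▹ b′) (in-class v₀ v₀∈))
    in contradiction i-odd (≤⇒≯ (≤-reflexive (trans (cong odd (trans total (∑-const n b′)))
         (n∣m⇒m%n≡0 (n * b′) 2 (∣m⇒∣m*n b′ 2∣n)))))
    where
    in-class : ∀ {i} v → 0 < (κ v == suc i) ▹ b′ → (κ v == suc i) ≡ true
    in-class {i} v p with κ v == suc i
    ... | true = refl
    fold : (∀ v → κ v ≢ zero) → ∀ {u v} → Star (Adj G) u v → κ u ≡ κ v
    fold nonzero ε = refl
    fold nonzero {u} (_◅_ {j = w} p q) with adj G u w in eq
    ... | true = trans (proper u w eq (nonzero u) (nonzero w)) (fold nonzero q)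

  -- Bounds the entries of the adjacency matrix with ones on the diagonal; row sums are therefore
  -- `deg G v + 1`. The `if` keeps vertices of S from counting S twice.
  cap : Fin n → Fin n → ℕ
  cap v u = if κ v == zero then 1 else (κ u == zero) ▹ 1 + (κ u == κ v) ▹ 1

  capacity : Fin (suc m) → ℕ
  capacity zero    = n
  capacity (suc i) = s + c i

  ∑-cap : ∀ v → ∑ (cap v) ≡ capacity (κ v)
  ∑-cap v with κ v
  ... | zero  = trans (∑-const n 1) (*-identityʳ n)
  ... | suc i = ∑-distrib-+ (λ u → (κ u == zero) ▹ 1) _

  adj≤cap : ∀ v u → adj G v u ▹ 1 + (v == u) ▹ 1 ≤ cap v u
  adj≤cap v u with v Fin.≟ u
  ... | yes refl rewrite irrefl G v | ==-refl (κ v) with κ v == zero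
  ...   | true  = ≤-refl
  ...   | false = s≤s z≤n
  adj≤cap v u | no v≢u with adj G v u in Gvu
  ... | false = z≤n
  ... | true with κ v Fin.≟ zero | κ u Fin.≟ zero
  ...   | yes _ | _     = ≤-refl
  ...   | no _  | yes _ = s≤s z≤n
  ...   | no p  | no q rewrite sym (proper v u Gvu p q) | ==-refl (κ v) = ≤-refl

  deg-+1 : ∀ v → deg G v + 1 ≡ ∑ λ u → adj G v u ▹ 1 + (v == u) ▹ 1
  deg-+1 v = trans (cong (deg G v +_) (sym (∑-delta v λ _ → 1))) (sym (∑-distrib-+ (λ u → adj G v u ▹ 1) _))

  deg≤capacity : ∀ v → deg G v + 1 ≤ capacity (κ v)
  deg≤capacity v = ≤-trans (≤-reflexive (deg-+1 v)) (≤-trans (∑-mono (adj≤cap v)) (≤-reflexive (∑-cap v)))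

  size-+n : size (adj G) + n ≡ ∑ λ v → deg G v + 1
  size-+n = trans (cong (size (adj G) +_) (sym (trans (∑-const n 1) (*-identityʳ n)))) (sym (∑-distrib-+ (deg G) _))

  squares : ℕ
  squares = ∑ λ i → c i * c i

  ∑-capacity : ∑ (λ v → capacity (κ v)) ≡ s * n + s * ∑ c + squares
  ∑-capacity = trans (∑-fibres κ capacity) (trans (cong (s * n +_) (trans (sum-cong-≗ λ i → *-distribˡ-+ (c i) s (c i))
    (trans (∑-distrib-+ (λ i → c i * s) _) (cong (_+ squares)
      (trans (sum-cong-≗ λ i → *-comm (c i) s) (sym (*-distribˡ-sum s c))))))) (sym (+-assoc (s * n) _ _)))

  size-bound : size (adj G) + n ≤ s * n + s * ∑ c + squares
  size-bound = ≤-trans (≤-reflexive size-+n) (≤-trans (∑-mono deg≤capacity) (≤-reflexive ∑-capacity))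

  -- Writing `n` as a sum ensures that the truncated subtraction in `extremal` loses nothing.
  extremalSize≤ : ∀ M₀ → n ≡ (b + 1) * δ + M₀ → extremalSize b δ M₀ ≤ size (adj G) + n
  extremalSize≤ M₀ refl = ≤-trans (≤-reflexive (sym (trans (cong (λ M → size (adj (extremal n b δ)) + (δ + (M + b * δ))) (sym M≡))
      (trans (size-extremal n b δ) (cong (extremalSize b δ) M≡)))))
    (+-mono-≤ large (≤-reflexive (order b′ δ M₀)))
    where
    M≡ : (b + 1) * δ + M₀ ∸ (b + 1) * δ ≡ M₀
    M≡ = m+n∸m≡n ((b + 1) * δ) M₀
    order : ∀ b′ δ M → δ + (M + suc b′ * δ) ≡ (suc b′ + 1) * δ + M
    order b′ δ M = solve (b′ ∷ δ ∷ M ∷ [])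

  module Bound (t : ℕ) (0<t : 0 < t) (c≥t : ∀ i → 0 < c i → t ≤ c i) where
    open Squares c t (b * s) 0<t c≥t k<support public

    n≡M : n ≡ s + (M + b * s * t)
    n≡M = trans n≡ (cong (s +_) ∑c)

    size≤classBound : size (adj G) + n ≤ classBound b s t M
    size≤classBound = ≤-trans size-bound (+-mono-≤ (≤-reflexive (cong₂ (λ x y → s * x + s * y) n≡M ∑c)) ∑-squares)

  -- A vertex of class `i` has at most `s + c i − 1` neighbours, so nonempty classes have at least
  -- `δ − s + 1` vertices. With this as `t`, the second bound contradicts `large`.
  s≮δ : ¬ s < δ
  s≮δ s<δ = go (m≤n⇒∃[o]m+o≡n s>0) (m≤n⇒∃[o]m+o≡n s<δ)
    where
    go : (∃ λ a → suc a ≡ s) → (∃ λ d′ → suc (s + d′) ≡ δ) → ⊥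
    go (a , a≡) (d′ , d≡) = final (m≤n⇒∃[o]m+o≡n t≤M)
      where
      δ≡ : δ ≡ s + suc d′
      δ≡ = trans (sym d≡) (sym (+-suc s d′))
      c≥t : ∀ i → 0 < c i → suc (suc d′) ≤ c i
      c≥t i 0<c with ∑-positive (λ v → (κ v == suc i) ▹ 1) 0<c
      ... | v , p with κ v Fin.≟ suc i
      ...   | yes κv = +-cancelˡ-≤ s _ _ (≤-trans (≤-reflexive (trans (+-suc s (suc d′))
                (trans (cong suc (sym δ≡)) (+-comm 1 δ)))) (≤-trans (+-monoˡ-≤ 1 (δ≤deg v))
                (≤-trans (deg≤capacity v) (≤-reflexive (cong capacity κv)))))
      open Bound (suc (suc d′)) (s≤s z≤n) c≥t
      final : (∃ λ y → suc (suc d′) + y ≡ M) → ⊥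
      final (y , M≡) = <-irrefl refl (≤-trans (s≤s (≤-trans (extremalSize≤ (1 + y + b * a * suc d′) n≡₀) size≤classBound))
          (subst₂ (λ s M → classBound b s (suc (suc d′)) M < extremalSize b δ (1 + y + b * a * suc d′)) a≡ M≡
            (subst (λ δ → classBound b (suc a) (suc (suc d′)) (suc (suc d′) + y) < extremalSize b δ (1 + y + b * a * suc d′)) (sym δ≡a)
              (classBound-< b′ a d′ y (subst₂ (SecondBound b) δ≡a n≡a T₂)))))
        where
        δ≡a : δ ≡ suc a + suc d′
        δ≡a = trans δ≡ (cong (_+ suc d′) (sym a≡))
        n≡a : n ≡ suc a + (suc (suc d′) + y + b * suc a * suc (suc d′))
        n≡a = trans n≡M (cong₂ (λ s M → s + (M + b * s * suc (suc d′))) (sym a≡) (sym M≡))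
        n≡₀ : n ≡ (b + 1) * δ + (1 + y + b * a * suc d′)
        n≡₀ = trans n≡a (trans (identity b′ a d′ y) (cong (λ δ → (b + 1) * δ + (1 + y + b * a * suc d′)) (sym δ≡a)))
          where
          identity : ∀ b′ a d′ y → suc a + (suc (suc d′) + y + suc b′ * suc a * suc (suc d′)) ≡
                                   (suc b′ + 1) * (suc a + suc d′) + (1 + y + suc b′ * a * suc d′)
          identity b′ a d′ y = solve (b′ ∷ a ∷ d′ ∷ y ∷ [])

  open Bound 1 (s≤s z≤n) (λ _ p → p)

  -- The minimum degree gives nothing better than `t = 1` here, and the first bound decides.
  s≯δ : ¬ δ < s
  s≯δ δ<s = go (m≤n⇒∃[o]m+o≡n δ<s) (m≤n⇒∃[o]m+o≡n t≤M)
    where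
    go : (∃ λ r′ → suc (δ + r′) ≡ s) → (∃ λ M′ → suc M′ ≡ M) → ⊥
    go (r′ , r≡) (M′ , M≡) = <-irrefl refl (≤-trans (s≤s (≤-trans (extremalSize≤ ((b + 1) * suc r′ + suc M′) n≡₀) size≤classBound))
        (subst₂ (λ s M → classBound b s 1 M < extremalSize b δ ((b + 1) * suc r′ + suc M′)) (sym s≡) M≡
          (classBound-> b′ δ r′ M′ (subst (FirstBound b′ δ) n≡a T₁))))
      where
      s≡ : s ≡ δ + suc r′
      s≡ = trans (sym r≡) (sym (+-suc δ r′))
      n≡a : n ≡ δ + suc r′ + (suc M′ + b * (δ + suc r′) * 1)
      n≡a = trans n≡M (cong₂ (λ s M → s + (M + b * s * 1)) s≡ (sym M≡))
      n≡₀ : n ≡ (b + 1) * δ + ((b + 1) * suc r′ + suc M′)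
      n≡₀ = trans n≡a (identity b′ δ r′ M′)
        where
        identity : ∀ b′ δ r′ M′ → δ + suc r′ + (suc M′ + suc b′ * (δ + suc r′) * 1) ≡
                                  (suc b′ + 1) * δ + ((suc b′ + 1) * suc r′ + suc M′)
        identity b′ δ r′ M′ = solve (b′ ∷ δ ∷ r′ ∷ M′ ∷ [])

  s≡δ : s ≡ δ
  s≡δ with <-cmp s δ
  ... | tri< p _ _ = contradiction p s≮δ
  ... | tri≈ _ p _ = p
  ... | tri> _ _ p = contradiction p s≯δ

  n≡δ : n ≡ δ + (M + b * δ)
  n≡δ = trans n≡M (cong₂ (λ s x → s + (M + x)) s≡δ (trans (*-identityʳ (b * s)) (cong (b *_) s≡δ)))

  -- At `s ≡ δ` and `t = 1` the class bound is the extremal size itself, so every estimate of the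
  -- count is tight.
  size-reached : s * n + s * ∑ c + (M * M + b * s) ≤ size (adj G) + n
  size-reached = ≤-trans (≤-reflexive (trans (cong₂ (λ x y → s * x + s * y + (M * M + b * s)) n≡M ∑c)
      (trans (cong (λ s → s * (s + (M + b * s * 1)) + s * (M + b * s * 1) + (M * M + b * s)) s≡δ) (expand b δ M))))
    (extremalSize≤ M (trans n≡δ (order b δ M)))
    where
    expand : ∀ b δ M → δ * (δ + (M + b * δ * 1)) + δ * (M + b * δ * 1) + (M * M + b * δ) ≡
                       δ * δ + M * M + b * δ + 2 * δ * (M + b * δ)
    expand b δ M = solve (b ∷ δ ∷ M ∷ [])
    order : ∀ b δ M → δ + (M + b * δ) ≡ (b + 1) * δ + M
    order b δ M = solve (b ∷ δ ∷ M ∷ [])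

  squares-reached : M * M + b * s ≤ squares
  squares-reached = +-cancelˡ-≤ (s * n + s * ∑ c) _ _ (≤-trans size-reached size-bound)

  adj≡cap : ∀ v u → adj G v u ▹ 1 + (v == u) ▹ 1 ≡ cap v u
  adj≡cap v = ∑-rigid (λ u → adj G v u ▹ 1 + (v == u) ▹ 1) (cap v) (adj≤cap v)
    (≤-reflexive (trans (∑-cap v) (trans (sym (deg≡capacity v)) (deg-+1 v))))
    where
    deg≡capacity : ∀ v → deg G v + 1 ≡ capacity (κ v)
    deg≡capacity = ∑-rigid (λ v → deg G v + 1) (capacity ∘ κ) deg≤capacity
      (≤-trans (≤-reflexive ∑-capacity) (≤-trans (+-monoʳ-≤ (s * n + s * ∑ c) ∑-squares)
        (≤-trans (≤-reflexive (cong (λ x → s * n + s * ∑ c + (M * M + x)) (*-identityʳ (b * s))))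
          (≤-trans size-reached (≤-reflexive size-+n)))))

  -- `σ` is S and `τ` the class of size `M`. All other classes are single vertices, so tight
  -- capacities determine every adjacency.
  extremal-structure : ∃₂ λ σ τ → Extremal G δ (n ∸ (b + 1) * δ) (b * δ) σ τ
  extremal-structure with i , ci ← SquaresTight.large c (b * s) k<support squares-reached =
    σ , τ i , mkExtremal s≡δ (trans (#τ i) (trans ci (sym M≡)))
      (+-cancelˡ-≡ (s + M) (#rest i) (b * δ) (trans (cong (λ x → s + x + #rest i) (trans (sym ci) (sym (#τ i)))) (trans (three i)
        (trans n≡δ (trans (sym (+-assoc δ M _)) (cong (λ x → x + M + b * δ) (sym s≡δ)))))))
      (edge i ci)
    where
    σ : Fin n → Bool
    σ v = κ v == zero
    τ : Fin m → Fin n → Bool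
    τ i v = κ v == suc i
    M≡ : n ∸ (b + 1) * δ ≡ M
    M≡ = trans (cong (_∸ (b + 1) * δ) (trans n≡δ (order b δ M))) (m+n∸m≡n ((b + 1) * δ) M)
      where
      order : ∀ b δ M → δ + (M + b * δ) ≡ (b + 1) * δ + M
      order b δ M = solve (b ∷ δ ∷ M ∷ [])
    not-σ : ∀ i v → not (σ v) ∧ τ i v ≡ τ i v
    not-σ i v with κ v
    ... | zero  = refl
    ... | suc _ = refl
    #τ : ∀ i → ∑ (λ v → (not (σ v) ∧ τ i v) ▹ 1) ≡ c i
    #τ i = sum-cong-≗ λ v → cong (_▹ 1) (not-σ i v)
    #rest : Fin m → ℕ
    #rest i = ∑ λ v → (not (σ v) ∧ not (τ i v)) ▹ 1
    three : ∀ i → s + ∑ (λ v → (not (σ v) ∧ τ i v) ▹ 1) + #rest i ≡ n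
    three i = trans (cong (_+ #rest i) (sym (∑-distrib-+ (λ v → σ v ▹ 1) _)))
      (trans (sym (∑-distrib-+ (λ v → σ v ▹ 1 + (not (σ v) ∧ τ i v) ▹ 1) _))
        (trans (sum-cong-≗ λ v → one (σ v) (τ i v)) (trans (∑-const n 1) (*-identityʳ n))))
      where
      one : ∀ p q → p ▹ 1 + (not p ∧ q) ▹ 1 + (not p ∧ not q) ▹ 1 ≡ 1
      one true  q     = refl
      one false true  = refl
      one false false = refl
    alone : ∀ i → c i ≡ M → ∀ j → j ≢ i → ∀ {u v} → κ u ≡ suc j → κ v ≡ suc j → u ≡ v
    alone i ci j j≢i {u} {v} κu κv with u Fin.≟ v
    ... | yes p = p
    ... | no u≢v = contradiction (SquaresTight.others-small c (b * s) k<support squares-reached i ci j j≢i)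
        (<⇒≱ (≤-trans (≤-reflexive (sym (trans (∑-distrib-+ (λ w → (w == u) ▹ 1) _) (cong₂ _+_ (∑-delta′ u λ _ → 1) (∑-delta′ v λ _ → 1)))))
                      (∑-mono two)))
      where
      two : ∀ w → (w == u) ▹ 1 + (w == v) ▹ 1 ≤ (κ w == suc j) ▹ 1
      two w with w Fin.≟ u | w Fin.≟ v
      ... | yes refl | yes refl = contradiction refl u≢v
      ... | yes refl | no _     = ≤-reflexive (sym (cong (_▹ 1) (≡⇒== κu)))
      ... | no _     | yes refl = ≤-reflexive (sym (cong (_▹ 1) (≡⇒== κv)))
      ... | no _     | no _     = z≤n
    edge : ∀ i → c i ≡ M → ∀ u v → adj G u v ≡ not (u == v) ∧ ((σ u ∨ σ v) ∨ ((not (σ u) ∧ τ i u) ∧ (not (σ v) ∧ τ i v)))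
    edge i ci u v with u Fin.≟ v
    ... | yes refl = irrefl G u
    ... | no u≢v = bit (trans (trans (sym (+-identityʳ _)) (trans (cong (λ x → adj G u v ▹ 1 + x ▹ 1) (sym (≢⇒== u≢v))) (adj≡cap u v)))
                              (colours (κ u) (κ v) refl refl))
      where
      bit : ∀ {x y} → x ▹ 1 ≡ y ▹ 1 → x ≡ y
      bit {true}  {true}  _ = refl
      bit {false} {false} _ = refl
      colours : ∀ k l → κ u ≡ k → κ v ≡ l → (if k == zero then 1 else (l == zero) ▹ 1 + (l == k) ▹ 1) ≡
                (((k == zero) ∨ (l == zero)) ∨ ((not (k == zero) ∧ (k == suc i)) ∧ (not (l == zero) ∧ (l == suc i)))) ▹ 1
      colours zero    l       _  _  = refl
      colours (suc j) zero    _  _  = refl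
      colours (suc j) (suc k) κu κv with j Fin.≟ i | k Fin.≟ i
      ... | yes refl | yes refl rewrite ==-refl j = refl
      ... | yes refl | no  k≢i  rewrite ≢⇒== k≢i = refl
      ... | no j≢i   | yes refl rewrite ≢⇒== (j≢i ∘ sym) = refl
      ... | no j≢i   | no _     with k Fin.≟ j
      ...   | yes refl = contradiction (alone i ci j j≢i κu κv) u≢v
      ...   | no _     = refl

-- Deciding the conclusion by finite search

Searchable : (A : Set) → (A → A → Set) → Set₁
Searchable A _≈_ = ∀ (P : A → Set) → (∀ {x y} → x ≈ y → P x → P y) → (∀ x → Dec (P x)) → Dec (∃ P)

search-Bool : Searchable Bool _≡_
search-Bool P _ P? with P? true | P? false
... | yes p | _     = yes (true , p)
... | no _  | yes p = yes (false , p)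
... | no ¬p | no ¬q = no λ { (true , p) → ¬p p ; (false , q) → ¬q q }

-- Head and tail rebuild a function only up to pointwise equality; hence predicates are required to
-- respect `≈`.
search-→ : ∀ {A _≈_} → Searchable A _≈_ → (∀ x → x ≈ x) → ∀ n → Searchable (Fin n → A) (λ f g → ∀ i → f i ≈ g i)
search-→ search rfl zero    P resp P? = map′ (Vector.[] ,_) (λ (f , p) → resp (λ ()) p) (P? Vector.[])
search-→ {A} {_≈_} search rfl (suc n) P resp P? = map′
  (λ (a , f , p) → a Vector.∷ f , p)
  (λ (f , p) → f zero , f ∘ suc , resp (λ { zero → rfl _ ; (suc i) → rfl _ }) p)
  (search (λ a → ∃ λ f → P (a Vector.∷ f))
    (λ a≈b (f , p) → f , resp (λ { zero → a≈b ; (suc i) → rfl _ }) p)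
    (λ a → search-→ search rfl n (λ f → P (a Vector.∷ f)) (λ f≈g → resp λ { zero → rfl _ ; (suc i) → f≈g i }) (λ f → P? (a Vector.∷ f))))

search-set : ∀ n → Searchable (Fin n → Bool) (λ f g → ∀ i → f i ≡ g i)
search-set = search-→ search-Bool (λ _ → refl)

search-relation : ∀ n → Searchable (Relation n) (λ f g → ∀ i j → f i j ≡ g i j)
search-relation n = search-→ (search-set n) (λ _ _ → refl) n

allowedDegree? : ∀ b d → Dec (AllowedDegree b d)
allowedDegree? b d = (¬? (2 ∣? d) ×-dec (1 ≤? d ×-dec d ≤? b ∸ 1)) ⊎-dec (d ℕ.≟ b)

hasHFactor? : ∀ {n} b (G : Graph n) → Dec (HasHFactor b G)
hasHFactor? {n} b G = map′
  (λ (E , s , i , sub , d) → record { adj = E ; sym = s ; irrefl = i } ,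
     (λ u v p → ≡⇒T (sub u v (T⇒≡ p))) ,
     λ v → subst (AllowedDegree b) (sym (degree≡deg (record { adj = E ; sym = s ; irrefl = i }) v)) (d v))
  (λ (F , sub , d) → adj F , Graph.sym F , irrefl F , (λ u v p → T⇒≡ (sub u v (≡⇒T p))) ,
     λ v → subst (AllowedDegree b) (degree≡deg F v) (d v))
  (search-relation n FactorRelation
    (λ {E} {E′} E≈E′ (s , i , sub , d) →
      (λ u v → trans (sym (E≈E′ u v)) (trans (s u v) (E≈E′ v u))) ,
      (λ v → trans (sym (E≈E′ v v)) (i v)) ,
      (λ u v p → sub u v (trans (E≈E′ u v) p)) ,
      λ v → subst (AllowedDegree b) (sum-cong-≗ λ u → cong (_▹ 1) (E≈E′ v u)) (d v))
    (λ E → Fin.all? (λ u → Fin.all? λ v → E u v Bool.≟ E v u) ×-dec (Fin.all? (λ v → E v v Bool.≟ false) ×-dec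
      (Fin.all? (λ u → Fin.all? λ v → (E u v Bool.≟ true) →-dec (adj G u v Bool.≟ true)) ×-dec
        Fin.all? λ v → allowedDegree? b _))))
  where
  FactorRelation : Relation n → Set
  FactorRelation E = (∀ u v → E u v ≡ E v u) × (∀ v → E v v ≡ false) ×
    (∀ u v → E u v ≡ true → adj G u v ≡ true) × (∀ v → AllowedDegree b (∑ λ u → E v u ▹ 1))

extremal? : ∀ {n} (G : Graph n) a b c → Dec (∃₂ λ σ τ → Extremal G a b c σ τ)
extremal? {n} G a b c = search-set n _ (λ σ≈σ′ (τ , x) → τ , resp σ≈σ′ (λ _ → refl) x) λ σ →
  search-set n _ (λ τ≈τ′ x → resp (λ _ → refl) τ≈τ′ x) λ τ →
    map′ (λ (p , q , r , x) → mkExtremal p q r x) (λ { (mkExtremal p q r x) → p , q , r , x })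
      ((_ ℕ.≟ a) ×-dec ((_ ℕ.≟ b) ×-dec ((_ ℕ.≟ c) ×-dec Fin.all? λ u → Fin.all? λ v → adj G u v Bool.≟ _)))
  where
  resp : ∀ {σ σ′ τ τ′} → (∀ v → σ v ≡ σ′ v) → (∀ v → τ v ≡ τ′ v) → Extremal G a b c σ τ → Extremal G a b c σ′ τ′
  resp {σ} {σ′} {τ} {τ′} σ≈ τ≈ (mkExtremal p q r x) = mkExtremal
    (trans (sym (sum-cong-≗ λ v → cong (_▹ 1) (σ≈ v))) p)
    (trans (sym (sum-cong-≗ λ v → cong (_▹ 1) (cong₂ (λ s t → not s ∧ t) (σ≈ v) (τ≈ v)))) q)
    (trans (sym (sum-cong-≗ λ v → cong (_▹ 1) (cong₂ (λ s t → not s ∧ not t) (σ≈ v) (τ≈ v)))) r)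
    (λ u v → trans (x u v) (cong (not (u == v) ∧_) (cong₂ _∨_ (cong₂ _∨_ (σ≈ u) (σ≈ v))
      (cong₂ _∧_ (cong₂ (λ s t → not s ∧ t) (σ≈ u) (τ≈ u)) (cong₂ (λ s t → not s ∧ t) (σ≈ v) (τ≈ v))))))

-- Clearing denominators and drawing the conclusion

open import Data.Integer using (+_)
open import Data.Rational.Unnormalised using (_/_) renaming (_≥_ to _≥ℚ_)

-- An inequality of fractions unfolds to cross products. In the first one `δ + 1` is added on both
-- sides to leave ℤ.
threshold-bounds : ∀ b″ δ n → (+ n / 1) ≥ℚ threshold (suc (suc b″)) δ (s≤s (s≤s z≤n)) →
  FirstBound (suc b″) δ n × SecondBound (suc (suc b″)) δ n
threshold-bounds b″ δ n n≥ = first , second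
  where
  b = suc (suc b″)
  X Y : ℕ
  X = b ^ 2 * δ + 2 * b * δ
  Y = b ^ 2 * δ ^ 2 + (4 * b ^ 2 + 5 * b) * δ + b ^ 2 + 4 * b + 1
  p q : ℚᵘ.ℚᵘ
  p = (+ X ℤ.- + δ ℤ.- ℤ.1ℤ) / suc b″
  q = + Y / (6 * b)
  p≤n : p ℚᵘ.≤ (+ n / 1)
  p≤n = ℚᵘ.≤-trans (ℚᵘ.p≤p⊔q p q) n≥
  q≤n : q ℚᵘ.≤ (+ n / 1)
  q≤n = ℚᵘ.≤-trans (ℚᵘ.p≤q⊔p p q) n≥
  first : FirstBound (suc b″) δ n
  first with ℚᵘ.*≤* h ← p≤n = ≤-trans (≤-reflexive (powers b δ))
    (≤-trans (ℤ.drop‿+≤+ (subst₂ ℤ._≤_ (cancel (+ X) (+ δ)) cast (ℤ.+-monoˡ-≤ (+ (δ + 1)) h)))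
             (≤-reflexive (swap n b″ δ)))
    where
    powers : ∀ b δ → (b * b + 2 * b) * δ ≡ b * (b * 1) * δ + 2 * b * δ
    powers b δ = solve (b ∷ δ ∷ [])
    swap : ∀ n b″ δ → n * suc b″ + (δ + 1) ≡ suc b″ * n + δ + 1
    swap n b″ δ = solve (n ∷ b″ ∷ δ ∷ [])
    cancel : ∀ x d → (x ℤ.- d ℤ.- ℤ.1ℤ) ℤ.* ℤ.1ℤ ℤ.+ (d ℤ.+ ℤ.1ℤ) ≡ x
    cancel x d = ℤSolver.solve (x ∷ d ∷ [])
    cast : + n ℤ.* + suc b″ ℤ.+ + (δ + 1) ≡ + (n * suc b″ + (δ + 1))
    cast = cong (ℤ._+ + (δ + 1)) (sym (ℤ.pos-* n (suc b″)))
  second : SecondBound b δ n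
  second with ℚᵘ.*≤* h ← q≤n = ≤-trans (≤-reflexive (powers b δ))
    (≤-trans (ℤ.drop‿+≤+ (subst₂ ℤ._≤_ (ℤ.*-identityʳ (+ Y)) (sym (ℤ.pos-* n (6 * b))) h)) (≤-reflexive (*-comm n (6 * b))))
    where
    powers : ∀ b δ → b * b * (δ * δ) + (4 * (b * b) + 5 * b) * δ + b * b + 4 * b + 1 ≡
                     b * (b * 1) * (δ * (δ * 1)) + (4 * (b * (b * 1)) + 5 * b) * δ + b * (b * 1) + 4 * b + 1
    powers b δ = solve (b ∷ δ ∷ [])

factor⇒HFactor : ∀ {n} b′ (G : Graph n) → odd b′ ≡ 1 → Factor G (λ _ → b′) (λ _ → suc b′) → HasHFactor (suc b′) G
factor⇒HFactor b′ G b′-odd F = graph , (λ u v p → ≡⇒T (subgraph u v (T⇒≡ p))) ,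
    λ v → subst (AllowedDegree (suc b′)) (sym (degree≡deg graph v)) (allowed (degrees v))
  where
  open Factor F
  odd-allowed : ∀ {d} → odd d ≡ odd b′ → d ≤ b′ → AllowedDegree (suc b′) d
  odd-allowed {d} d-odd d≤b′ = inj₁
    ( (λ 2∣d → contradiction (trans (sym (n∣m⇒m%n≡0 d 2 2∣d)) (trans d-odd b′-odd)) λ ())
    , n≢0⇒n>0 (λ { refl → contradiction (trans d-odd b′-odd) λ () })
    , d≤b′ )
  allowed : ∀ {d} → DegreeAllowed b′ (suc b′) d → AllowedDegree (suc b′) d
  allowed (inj₁ (d-odd , d≤b′)) = odd-allowed d-odd d≤b′
  allowed (inj₂ (b′≤d , d≤b)) with m≤n⇒m<n∨m≡n d≤b
  ... | inj₁ d<b = odd-allowed (cong odd (≤-antisym (s≤s⁻¹ d<b) b′≤d)) (s≤s⁻¹ d<b)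
  ... | inj₂ d≡b = inj₂ d≡b

theorem1p1 : (b : ℕ) (2≤b : 2 ≤ b) → 2 ∣ b →
    (n : ℕ) → 2 ∣ n →
    (G : Graph n) → Connected G →
    (δ : ℕ) → IsMinDegree G δ → δ ≥ 1 →
    (+ n / 1) ≥ℚ threshold b δ 2≤b →
    e G ≥ e (extremal n b δ) →
    HasHFactor b G ⊎ G ≅ extremal n b δ
theorem1p1 (suc (suc b″)) (s≤s (s≤s z≤n)) 2∣b n 2∣n G connected δ (δ≤degree , _) _ n≥ large =
  Sum.map₂ (λ (_ , _ , structure) → extremal-≅ (copies (b * δ) (K 1)) (copies-empty (b * δ)) structure)
    -- `Extremal` stands in for the isomorphism, because it makes the disjunction decidable and so
    -- lets the double negation be removed.
    (decidable-stable (hasHFactor? b G ⊎-dec extremal? G δ (n ∸ (b + 1) * δ) (b * δ * 1)) λ ¬goal →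
      bounded-factor G (λ _ → suc b″) (λ _ → b) (λ _ → n≤1+n (suc b″)) (λ _ → s≤s z≤n)
        (λ κ proper → ≮⇒≥ λ bad → ¬goal (inj₂
          (subst (λ k → ∃₂ (Extremal G δ (n ∸ (b + 1) * δ) k)) (sym (*-identityʳ (b * δ)))
            (BadColouring.extremal-structure G connected 2∣n (suc b″) δ δ≤deg T₁ T₂ large′ κ proper bad))))
        λ F → ¬goal (inj₁ (factor⇒HFactor (suc b″) G b′-odd F)))
  where
  b = suc (suc b″)
  T₁ = proj₁ (threshold-bounds b″ δ n n≥)
  T₂ = proj₂ (threshold-bounds b″ δ n n≥)
  δ≤deg : ∀ v → δ ≤ deg G v
  δ≤deg v = ≤-trans (δ≤degree v) (≤-reflexive (degree≡deg G v))
  large′ : size (adj (extremal n b δ)) ≤ size (adj G)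
  large′ = subst₂ _≤_ (handshake (extremal n b δ)) (handshake G) (+-mono-≤ large large)
  b′-odd : odd (suc b″) ≡ 1
  b′-odd = +-cancelʳ-≡ (odd b) (odd (suc b″)) 1 (trans (odd-suc (suc b″)) (cong suc (sym (n∣m⇒m%n≡0 b 2 2∣b))))
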